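{- Let $l,m\geq 1$ be integers and let $\epsilon$ be the sequence of length $2ml$ consisting of $2m$ consecutive blocks of length $l$, where the first block consists of $+1$'s, the second of $-1$'s, the third of $+1$'s, and so on alternately (so the last block consists of $-1$'s). Then the number of pairs $(\sigma,<)$, where $\sigma$ is a non-crossing pairing of $\{1,\dots,2ml\}$ compatible with $\epsilon$ and $<$ is a total order on the vertices of the quotient tree $T_\sigma$ which is compatible with the orientations of the edges, is exactly $m^{ml}$.
   Context: For $\epsilon=(\epsilon(1),\dots,\epsilon(k))\in\{ -1,+1\}^k$, let $G_\epsilon$ be the oriented $k$-gon with vertices $v_1,\dots,v_k$ and edges $e_1,\dots,e_k$, where $e_i$ joins $v_i$ and $v_{i+1}$ (with $v_{k+1}:=v_1$); $e_i$ is oriented from $v_{i+1}$ to $v_i$ if $\epsilon(i)=+1$ and from $v_i$ to $v_{i+1}$ if $\epsilon(i)=-1$. A pairing $\sigma$ of $\{1,\dots,k\}$ is a partition into 2-element blocks; it is compatible with $\epsilon$ if $\epsilon(i)+\epsilon(j)=0$ for every $\{i,j\}\in\sigma$, and it is non-crossing if there are no $p<q<r<s$ with $\{p,r\},\{q,s\}\in\sigma$. The quotient graph $T_\sigma$ is obtained from $G_\epsilon$ by gluing, for each $\{i,j\}\in\sigma$, the edge $e_i$ to the edge $e_j$ so that $v_i$ is identified with $v_{j+1}$ and $v_{i+1}$ with $v_j$ (vertices are identified according to the equivalence relation generated by these identifications); each edge of $T_\sigma$ inherits the common orientation of the two edges of $G_\epsilon$ it comes from. For non-crossing $\sigma$,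 $T_\sigma$ is a tree. For vertices $x,y$ of $T_\sigma$ write $x\prec y$ if there is a nonempty directed path from $y$ to $x$ travelling along edges in the direction of their arrows. A total order $<$ on the vertices of $T_\sigma$ is compatible with the orientations of the edges if $x\prec y$ implies $x<y$. -}

module Defs where

open import Data.Nat using (ℕ; zero; suc; _+_; _*_)
open import Data.Nat.Properties using (_≟_)
open import Data.Bool using (Bool; true; false)
open import Data.Fin using (Fin; toℕ; lower₁) renaming (zero to fzero; suc to fsuc; _<_ to _<ᶠ_)
open import Data.Vec using (Vec; lookup; concat; replicate; _++_)
open import Data.Product using (_×_; _,_)
open import Data.Sum using (_⊎_)
open import Data.Empty using (⊥)
open import Relation.Nullary using (¬_; yes; no)
open import Relation.Binary.PropositionalEquality using (_≡_; _≢_)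

-- k = 2ml, written m * (l + l) (m blocks of the shape (+1)^l (-1)^l).
len : ℕ → ℕ → ℕ
len m l = m * (l + l)

-- Positions / vertices / edges are indexed 0..k-1 (paper: 1..k).
-- The sign sequence ε: true = +1, false = -1.
eps : (m l : ℕ) → Vec Bool (len m l)
eps m l = concat (replicate m (replicate l true ++ replicate l false))

next : ∀ {k} → Fin k → Fin k
next {suc n} i with n ≟ toℕ i
... | yes _ = fzero
... | no ne = fsuc (lower₁ i ne)

module _ (m l : ℕ) where
  K : ℕ
  K = len m l

  ε : Fin K → Bool
  ε i = lookup (eps m l) i

  -- A pairing σ is encoded as a fixed-point-free involution p (σ = {{i, p i}}).
  Pairing : Set
  Pairing = Vec (Fin K) K

  IsPairing : Pairing → Set
  IsPairing p = (∀ i → lookup p (lookup p i) ≡ i) × (∀ i → lookup p i ≢ i)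

  CompatibleEps : Pairing → Set
  CompatibleEps p = ∀ i → ε i ≢ ε (lookup p i)

  NonCrossing : Pairing → Set
  NonCrossing p = ∀ a b c d → a <ᶠ b → b <ᶠ c → c <ᶠ d →
                  lookup p a ≡ c → lookup p b ≡ d → ⊥

  data Glue (p : Pairing) : Fin K → Fin K → Set where
    glue₁ : ∀ i → Glue p i (next (lookup p i))
    glue₂ : ∀ i → Glue p (next i) (lookup p i)

  -- equivalence relation generated by Glue: vertices of T_σ are its classes
  data Same (p : Pairing) : Fin K → Fin K → Set where
    s-refl  : ∀ {x} → Same p x x
    s-step  : ∀ {x y} → Glue p x y → Same p x y
    s-sym   : ∀ {x y} → Same p x y → Same p y x
    s-trans : ∀ {x y z} → Same p x y → Same p y z → Same p x z

  -- edge e_i joins v_i and v_{i+1}; arrow from tail to head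
  tail head : Fin K → Fin K
  tail i with ε i
  ... | true  = next i
  ... | false = i
  head i with ε i
  ... | true  = i
  ... | false = next i

  data Path (p : Pairing) : Fin K → Fin K → Set where
    one  : ∀ {y x} i → Same p y (tail i) → Same p (head i) x → Path p y x
    more : ∀ {y x} i → Same p y (tail i) → Path p (head i) x → Path p y x

  Prec : Pairing → Fin K → Fin K → Set
  Prec p x y = Path p y x

  -- A strict total order on the vertices of T_σ, encoded as a Boolean matrix
  -- on representatives that is invariant under Same p.
  Order : Set
  Order = Vec (Vec Bool K) K

  LT : Order → Fin K → Fin K → Set
  LT o x y = lookup (lookup o x) y ≡ true

  IsTotalOrderOnClasses : Pairing → Order → Set
  IsTotalOrderOnClasses p o =
      (∀ x x' y y' → Same p x x' → Same p y y' → LT o x y → LT o x' y')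
    × (∀ x → ¬ LT o x x)
    × (∀ x y z → LT o x y → LT o y z → LT o x z)
    × (∀ x y → ¬ Same p x y → LT o x y ⊎ LT o y x)

  CompatibleOrientation : Pairing → Order → Set
  CompatibleOrientation p o = ∀ x y → Prec p x y → LT o x y

  Valid : Pairing × Order → Set
  Valid (p , o) = IsPairing p × CompatibleEps p × NonCrossing p
                × IsTotalOrderOnClasses p o × CompatibleOrientation p o

-- Label the root of a plane tree by x in [0,1] and its other vertices by independent
-- uniform variables, and let F_w(x) be the expected number of trees with word w whose
-- labels respect the orientations. These polynomials satisfy the first-return recursion
-- in w, and F_w' is obtained by contracting an edge at the root. Let M_n(w) be the sum of
-- F_{w_0} ... F_{w_n} over all ways to delete n letters from w, leaving the words w_i.
-- The derivatives of the M_n telescope, and for w = (+^l -^l)^m, which never goes below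
-- its initial height, they give F_w^{(j)} = (-1)^j M_{2j}(w). At x = 1 the words at an
-- ascent from the root contribute 0, so the first and the last l letters of w must be
-- deleted; together with the symmetry exchanging + and - this shows, for F_m := F_w, that
--   F_m^{(l)}(x) = (-1)^l F_{m-1}(x - 1),   F_m(1) = ... = F_m^{(l-1)}(1) = 0.
-- Hence (ml+1)! times the integral of F_m counts the ways to throw ml+1 balls into m boxes
-- such that for all j the first j boxes get at least jl+1 balls. By the cycle lemma
-- exactly one rotation of every distribution of the balls has this property.
-- In order to count integrally, a polynomial is replaced by the coefficients f a b of its
-- expansion into x^a/a! (1-x)^b/b!, which count trees with a vertices below the root and
-- b above it.

module Submission where

-- The derivative of `F w` is a sum of products of three such polynomials, so single words are not
-- closed under differentiation, but the family `M n` is. In coefficients, differentiation,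
-- evaluation at 1 and integration become `∂`, the column b = 0 and `up`, and the derivative formula
-- becomes a recursion without signs: the value of `M n` at (a, b + 1) is that of `M n` at (a + 1,
-- b) plus that of `M (n + 2)` at (a, b). The same recursion decides whether the next ball lands in
-- the first box. Under this correspondence, j differentiations mean that the partial sums start at
-- height j + 1, and integrating lowers the start from 1 to 0, where the cycle lemma applies. The
-- list in the theorem arises by repeating each operation on arrays with lists, so that its length
-- obeys the recursion of the counts. A pair (σ, <) amounts to a plane tree labelled by 0, ..., ml:
-- the pairing gives the shape, and the ranks of the vertices in the order give the labels.

module Arrays where

  open import Data.Nat using (ℕ; zero; suc)
  open import Data.Integer using (ℤ; _+_; _*_; 0ℤ; 1ℤ; -1ℤ)
  import Data.Integer.Properties as ℤP
  open import Data.Integer.Solver using (module +-*-Solver)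
  open +-*-Solver using (solve; _:+_; _:*_; con; _:=_)
  open import Function using (_∘_)
  open import Relation.Binary.PropositionalEquality

  -- Coefficient arrays with their product and derivative

  Array : Set
  Array = ℕ → ℕ → ℤ

  infix 4 _≈_
  _≈_ : Array → Array → Set
  f ≈ g = ∀ a b → f a b ≡ g a b

  infixl 6 _⊕_
  _⊕_ : Array → Array → Array
  (f ⊕ g) a b = f a b + g a b

  infixr 7 _·_
  _·_ : ℤ → Array → Array
  (k · f) a b = k * f a b

  -- If f stands for the sum of f a b x^a/a! y^b/b! at y = 1 - x, the two shifts are the partial
  -- derivatives and `∂` is d/dx; the sign is the derivative of 1 - x.
  ∂X ∂Y ∂ : Array → Array
  ∂X f a b = f (suc a) b
  ∂Y f a b = f a (suc b)
  ∂ f = ∂X f ⊕ -1ℤ · ∂Y f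

  𝟘 𝟙 : Array
  𝟘 _ _ = 0ℤ
  𝟙 zero zero = 1ℤ
  𝟙 zero (suc b) = 0ℤ
  𝟙 (suc a) b = 0ℤ

  -- If f a b counts the structures on a + b points, of which a lie below and b
  -- above a root, then f ⊗ g counts the pairs of such structures on complementary
  -- sets of points: the first remaining point goes either left or right.
  infixl 7 _⊗_
  _⊗_ : Array → Array → Array
  (f ⊗ g) zero zero = f 0 0 * g 0 0
  (f ⊗ g) zero (suc b) = (∂Y f ⊗ g) zero b + (f ⊗ ∂Y g) zero b
  (f ⊗ g) (suc a) b = (∂X f ⊗ g) a b + (f ⊗ ∂X g) a b

  interchange : ∀ x y z w → (x + y) + (z + w) ≡ (x + z) + (y + w)
  interchange = solve 4 (λ x y z w → (x :+ y) :+ (z :+ w) := (x :+ z) :+ (y :+ w)) refl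

  addˡ : ∀ x {y z : ℤ} → y ≡ z → x + y ≡ x + z
  addˡ x = cong (x +_)

  addʳ : ∀ {y z : ℤ} x → y ≡ z → y + x ≡ z + x
  addʳ x = cong (_+ x)

  ⊗-cong : ∀ {f f′ g g′} → f ≈ f′ → g ≈ g′ → f ⊗ g ≈ f′ ⊗ g′
  ⊗-cong p q zero zero = cong₂ _*_ (p 0 0) (q 0 0)
  ⊗-cong p q zero (suc b) =
    cong₂ _+_ (⊗-cong (λ a b → p a (suc b)) q zero b) (⊗-cong p (λ a b → q a (suc b)) zero b)
  ⊗-cong p q (suc a) b =
    cong₂ _+_ (⊗-cong (λ a → p (suc a)) q a b) (⊗-cong p (λ a → q (suc a)) a b)

  -- The clauses of `⊗` deal the points below the root first. Hence the Leibniz rule for `∂X` is a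
  -- clause, while the one for `∂Y` is a clause only in the row a = 0 and needs an induction on a
  -- elsewhere.
  ∂Y-⊗ : ∀ f g → ∂Y (f ⊗ g) ≈ ∂Y f ⊗ g ⊕ f ⊗ ∂Y g
  ∂Y-⊗ f g zero b = refl
  ∂Y-⊗ f g (suc a) b =
    trans (cong₂ _+_ (∂Y-⊗ (∂X f) g a b) (∂Y-⊗ f (∂X g) a b))
          (interchange ((∂Y (∂X f) ⊗ g) a b) ((∂X f ⊗ ∂Y g) a b) _ _)

  ⊗-distribʳ : ∀ f f′ g → (f ⊕ f′) ⊗ g ≈ f ⊗ g ⊕ f′ ⊗ g
  ⊗-distribʳ f f′ g zero zero = ℤP.*-distribʳ-+ (g 0 0) (f 0 0) (f′ 0 0)
  ⊗-distribʳ f f′ g zero (suc b) =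
    trans (cong₂ _+_ (⊗-distribʳ (∂Y f) (∂Y f′) g zero b) (⊗-distribʳ f f′ (∂Y g) zero b))
          (interchange ((∂Y f ⊗ g) zero b) _ _ _)
  ⊗-distribʳ f f′ g (suc a) b =
    trans (cong₂ _+_ (⊗-distribʳ (∂X f) (∂X f′) g a b) (⊗-distribʳ f f′ (∂X g) a b))
          (interchange ((∂X f ⊗ g) a b) _ _ _)

  ⊗-distribˡ : ∀ f g g′ → f ⊗ (g ⊕ g′) ≈ f ⊗ g ⊕ f ⊗ g′
  ⊗-distribˡ f g g′ zero zero = ℤP.*-distribˡ-+ (f 0 0) (g 0 0) (g′ 0 0)
  ⊗-distribˡ f g g′ zero (suc b) =
    trans (cong₂ _+_ (⊗-distribˡ (∂Y f) g g′ zero b) (⊗-distribˡ f (∂Y g) (∂Y g′) zero b))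
          (interchange ((∂Y f ⊗ g) zero b) _ _ _)
  ⊗-distribˡ f g g′ (suc a) b =
    trans (cong₂ _+_ (⊗-distribˡ (∂X f) g g′ a b) (⊗-distribˡ f (∂X g) (∂X g′) a b))
          (interchange ((∂X f ⊗ g) a b) _ _ _)

  ⊗-·ˡ : ∀ k f g → (k · f) ⊗ g ≈ k · (f ⊗ g)
  ⊗-·ˡ k f g zero zero = ℤP.*-assoc k (f 0 0) (g 0 0)
  ⊗-·ˡ k f g zero (suc b) =
    trans (cong₂ _+_ (⊗-·ˡ k (∂Y f) g zero b) (⊗-·ˡ k f (∂Y g) zero b))
          (sym (ℤP.*-distribˡ-+ k _ _))
  ⊗-·ˡ k f g (suc a) b =
    trans (cong₂ _+_ (⊗-·ˡ k (∂X f) g a b) (⊗-·ˡ k f (∂X g) a b))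
          (sym (ℤP.*-distribˡ-+ k _ _))

  ⊗-·ʳ : ∀ k f g → f ⊗ (k · g) ≈ k · (f ⊗ g)
  ⊗-·ʳ k f g zero zero = solve 3 (λ k x y → x :* (k :* y) := k :* (x :* y)) refl k (f 0 0) (g 0 0)
  ⊗-·ʳ k f g zero (suc b) =
    trans (cong₂ _+_ (⊗-·ʳ k (∂Y f) g zero b) (⊗-·ʳ k f (∂Y g) zero b))
          (sym (ℤP.*-distribˡ-+ k _ _))
  ⊗-·ʳ k f g (suc a) b =
    trans (cong₂ _+_ (⊗-·ʳ k (∂X f) g a b) (⊗-·ʳ k f (∂X g) a b))
          (sym (ℤP.*-distribˡ-+ k _ _))

  -- Both sides obey the Leibniz rule in each variable, so induction on a and b reduces the claim to
  -- the constant terms.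
  ⊗-assoc : ∀ f g h → (f ⊗ g) ⊗ h ≈ f ⊗ (g ⊗ h)
  ⊗-assoc f g h zero zero = ℤP.*-assoc (f 0 0) (g 0 0) (h 0 0)
  ⊗-assoc f g h zero (suc b) = begin
    (∂Y (f ⊗ g) ⊗ h) 0 b + ((f ⊗ g) ⊗ ∂Y h) 0 b
      ≡⟨ addʳ _ (⊗-cong (∂Y-⊗ f g) (λ _ _ → refl) 0 b) ⟩
    ((∂Y f ⊗ g ⊕ f ⊗ ∂Y g) ⊗ h) 0 b + ((f ⊗ g) ⊗ ∂Y h) 0 b
      ≡⟨ addʳ _ (⊗-distribʳ (∂Y f ⊗ g) (f ⊗ ∂Y g) h 0 b) ⟩
    (((∂Y f ⊗ g) ⊗ h) 0 b + ((f ⊗ ∂Y g) ⊗ h) 0 b) + ((f ⊗ g) ⊗ ∂Y h) 0 b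
      ≡⟨ cong₂ _+_ (cong₂ _+_ (⊗-assoc (∂Y f) g h 0 b) (⊗-assoc f (∂Y g) h 0 b)) (⊗-assoc f g (∂Y h) 0 b) ⟩
    ((∂Y f ⊗ (g ⊗ h)) 0 b + (f ⊗ (∂Y g ⊗ h)) 0 b) + (f ⊗ (g ⊗ ∂Y h)) 0 b
      ≡⟨ ℤP.+-assoc ((∂Y f ⊗ (g ⊗ h)) 0 b) _ _ ⟩
    (∂Y f ⊗ (g ⊗ h)) 0 b + ((f ⊗ (∂Y g ⊗ h)) 0 b + (f ⊗ (g ⊗ ∂Y h)) 0 b)
      ≡⟨ addˡ ((∂Y f ⊗ (g ⊗ h)) 0 b) (sym (⊗-distribˡ f (∂Y g ⊗ h) (g ⊗ ∂Y h) 0 b)) ⟩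
    (∂Y f ⊗ (g ⊗ h)) 0 b + (f ⊗ (∂Y g ⊗ h ⊕ g ⊗ ∂Y h)) 0 b
      ≡⟨ addˡ ((∂Y f ⊗ (g ⊗ h)) 0 b) (⊗-cong {f} (λ _ _ → refl) (λ a b → sym (∂Y-⊗ g h a b)) 0 b) ⟩
    (∂Y f ⊗ (g ⊗ h)) 0 b + (f ⊗ ∂Y (g ⊗ h)) 0 b ∎
    where open ≡-Reasoning
  ⊗-assoc f g h (suc a) b = begin
    ((∂X f ⊗ g ⊕ f ⊗ ∂X g) ⊗ h) a b + ((f ⊗ g) ⊗ ∂X h) a b
      ≡⟨ addʳ _ (⊗-distribʳ (∂X f ⊗ g) (f ⊗ ∂X g) h a b) ⟩
    (((∂X f ⊗ g) ⊗ h) a b + ((f ⊗ ∂X g) ⊗ h) a b) + ((f ⊗ g) ⊗ ∂X h) a b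
      ≡⟨ cong₂ _+_ (cong₂ _+_ (⊗-assoc (∂X f) g h a b) (⊗-assoc f (∂X g) h a b)) (⊗-assoc f g (∂X h) a b) ⟩
    ((∂X f ⊗ (g ⊗ h)) a b + (f ⊗ (∂X g ⊗ h)) a b) + (f ⊗ (g ⊗ ∂X h)) a b
      ≡⟨ ℤP.+-assoc ((∂X f ⊗ (g ⊗ h)) a b) _ _ ⟩
    (∂X f ⊗ (g ⊗ h)) a b + ((f ⊗ (∂X g ⊗ h)) a b + (f ⊗ (g ⊗ ∂X h)) a b)
      ≡⟨ addˡ ((∂X f ⊗ (g ⊗ h)) a b) (sym (⊗-distribˡ f (∂X g ⊗ h) (g ⊗ ∂X h) a b)) ⟩
    (∂X f ⊗ (g ⊗ h)) a b + (f ⊗ (∂X g ⊗ h ⊕ g ⊗ ∂X h)) a b ∎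
    where open ≡-Reasoning

  ⊗-zeroˡ : ∀ {f} g → f ≈ 𝟘 → f ⊗ g ≈ 𝟘
  ⊗-zeroˡ g p zero zero = cong (_* g 0 0) (p 0 0)
  ⊗-zeroˡ g p zero (suc b) =
    cong₂ _+_ (⊗-zeroˡ g (λ a b → p a (suc b)) zero b) (⊗-zeroˡ (∂Y g) p zero b)
  ⊗-zeroˡ g p (suc a) b =
    cong₂ _+_ (⊗-zeroˡ g (λ a → p (suc a)) a b) (⊗-zeroˡ (∂X g) p a b)

  ⊗-zeroʳ : ∀ f {g} → g ≈ 𝟘 → f ⊗ g ≈ 𝟘
  ⊗-zeroʳ f p zero zero = trans (cong (f 0 0 *_) (p 0 0)) (ℤP.*-zeroʳ (f 0 0))
  ⊗-zeroʳ f p zero (suc b) =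
    cong₂ _+_ (⊗-zeroʳ (∂Y f) p zero b) (⊗-zeroʳ f (λ a b → p a (suc b)) zero b)
  ⊗-zeroʳ f p (suc a) b =
    cong₂ _+_ (⊗-zeroʳ (∂X f) p a b) (⊗-zeroʳ f (λ a → p (suc a)) a b)

  ⊗-identityˡ : ∀ g → 𝟙 ⊗ g ≈ g
  ⊗-identityˡ g zero zero = ℤP.*-identityˡ (g 0 0)
  ⊗-identityˡ g zero (suc b) =
    trans (cong₂ _+_ (zeroY g b) (⊗-identityˡ (∂Y g) zero b)) (ℤP.+-identityˡ _)
    where
    zeroY : ∀ g b → (∂Y 𝟙 ⊗ g) zero b ≡ 0ℤ
    zeroY g b = ⊗-zeroˡ g (λ { zero _ → refl ; (suc _) _ → refl }) zero b
  ⊗-identityˡ g (suc a) b =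
    trans (cong₂ _+_ (⊗-zeroˡ g (λ _ _ → refl) a b) (⊗-identityˡ (∂X g) a b)) (ℤP.+-identityˡ _)

  ⊗-identityʳ : ∀ f → f ⊗ 𝟙 ≈ f
  ⊗-identityʳ f zero zero = ℤP.*-identityʳ (f 0 0)
  ⊗-identityʳ f zero (suc b) =
    trans (cong₂ _+_ (⊗-identityʳ (∂Y f) zero b) (⊗-zeroʳ f (λ { zero _ → refl ; (suc _) _ → refl }) zero b))
          (ℤP.+-identityʳ _)
  ⊗-identityʳ f (suc a) b =
    trans (cong₂ _+_ (⊗-identityʳ (∂X f) a b) (⊗-zeroʳ f (λ _ _ → refl) a b)) (ℤP.+-identityʳ _)

  -- The substitution of 1 - x for x.
  swap : Array → Array
  swap f a b = f b a

  ⊗-swap : ∀ f g → swap (f ⊗ g) ≈ swap f ⊗ swap g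
  ⊗-swap f g zero zero = refl
  ⊗-swap f g zero (suc b) = cong₂ _+_ (⊗-swap (∂X f) g zero b) (⊗-swap f (∂X g) zero b)
  ⊗-swap f g (suc a) b =
    trans (∂Y-⊗ f g b a) (cong₂ _+_ (⊗-swap (∂Y f) g a b) (⊗-swap f (∂Y g) a b))

  -- b = 0: all points lie below the root.
  Vanish : Array → Set
  Vanish f = ∀ a → f a 0 ≡ 0ℤ

  ⊗-vanishˡ : ∀ {f} g → Vanish f → Vanish (f ⊗ g)
  ⊗-vanishˡ g p zero = cong (_* g 0 0) (p 0)
  ⊗-vanishˡ g p (suc a) = cong₂ _+_ (⊗-vanishˡ g (p ∘ suc) a) (⊗-vanishˡ (∂X g) p a)

  ⊗-vanishʳ : ∀ f {g} → Vanish g → Vanish (f ⊗ g)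
  ⊗-vanishʳ f p zero = trans (cong (f 0 0 *_) (p 0)) (ℤP.*-zeroʳ (f 0 0))
  ⊗-vanishʳ f p (suc a) = cong₂ _+_ (⊗-vanishʳ (∂X f) p a) (⊗-vanishʳ f (p ∘ suc) a)

  ∂-⊗ : ∀ f g → ∂ (f ⊗ g) ≈ ∂ f ⊗ g ⊕ f ⊗ ∂ g
  ∂-⊗ f g a b = begin
    ((∂X f ⊗ g) a b + (f ⊗ ∂X g) a b) + -1ℤ * (f ⊗ g) a (suc b)
      ≡⟨ addˡ ((∂X (f ⊗ g)) a b) (cong (-1ℤ *_) (∂Y-⊗ f g a b)) ⟩
    ((∂X f ⊗ g) a b + (f ⊗ ∂X g) a b) + -1ℤ * ((∂Y f ⊗ g) a b + (f ⊗ ∂Y g) a b)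
      ≡⟨ solve 4 (λ x y z w → (x :+ y) :+ con -1ℤ :* (z :+ w) := (x :+ con -1ℤ :* z) :+ (y :+ con -1ℤ :* w)) refl
           ((∂X f ⊗ g) a b) ((f ⊗ ∂X g) a b) ((∂Y f ⊗ g) a b) ((f ⊗ ∂Y g) a b) ⟩
    ((∂X f ⊗ g) a b + -1ℤ * (∂Y f ⊗ g) a b) + ((f ⊗ ∂X g) a b + -1ℤ * (f ⊗ ∂Y g) a b)
      ≡⟨ sym (cong₂ _+_
           (trans (⊗-distribʳ (∂X f) (-1ℤ · ∂Y f) g a b) (addˡ ((∂X f ⊗ g) a b) (⊗-·ˡ -1ℤ (∂Y f) g a b)))
           (trans (⊗-distribˡ f (∂X g) (-1ℤ · ∂Y g) a b) (addˡ ((f ⊗ ∂X g) a b) (⊗-·ʳ -1ℤ f (∂Y g) a b)))) ⟩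
    (∂ f ⊗ g) a b + (f ⊗ ∂ g) a b ∎
    where open ≡-Reasoning

-- Power series in two noncommuting letters

module Series where

  open Arrays
  open import Data.Nat using (suc)
  open import Data.Integer using (ℤ; _+_; _*_; 0ℤ; 1ℤ; -1ℤ)
  import Data.Integer.Properties as ℤP
  open import Data.Integer.Solver using (module +-*-Solver)
  open +-*-Solver using (solve; _:+_; _:*_; con; _:=_)
  open import Data.Bool using (Bool; true; false; not)
  open import Data.List using (List; []; _∷_; _++_; _∷ʳ_; map)
  open import Function using (_∘_)
  open import Relation.Binary.PropositionalEquality

  Ser : Set
  Ser = List Bool → Array

  infixl 6 _⊞_
  _⊞_ : Ser → Ser → Ser
  (Φ ⊞ Ψ) w = Φ w ⊕ Ψ w

  infixr 7 _▹_
  _▹_ : ℤ → Ser → Ser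
  (k ▹ Φ) w = k · Φ w

  -- The comparison of letters enters as a scalar factor, so that linearity, associativity and the
  -- Leibniz rule of `_⟨_⟩_` are proved without distinguishing letters.
  κ : Bool → Bool → ℤ
  κ true true = 1ℤ
  κ true false = 0ℤ
  κ false true = 0ℤ
  κ false false = 1ℤ

  -- (Φ ⟨ c ⟩ Ψ) w is the sum of Φ u ⊗ Ψ v over all factorisations w = u c v.
  infixr 8 _⟨_⟩_
  _⟨_⟩_ : Ser → Bool → Ser → Ser
  (Φ ⟨ c ⟩ Ψ) [] = 𝟘
  (Φ ⟨ c ⟩ Ψ) (d ∷ w) = κ c d · (Φ [] ⊗ Ψ w) ⊕ ((Φ ∘ (d ∷_)) ⟨ c ⟩ Ψ) w

  -- The factors are compared only at factorisations of `w`, whose parts are shorter than `w`; this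
  -- makes induction hypotheses on shorter words applicable.
  ⟨⟩-ext : ∀ {c Φ Φ′ Ψ Ψ′} w →
           (∀ u v → w ≡ u ++ c ∷ v → Φ u ⊗ Ψ v ≈ Φ′ u ⊗ Ψ′ v) →
           (Φ ⟨ c ⟩ Ψ) w ≈ (Φ′ ⟨ c ⟩ Ψ′) w
  ⟨⟩-ext [] h a b = refl
  ⟨⟩-ext {true} (true ∷ w) h a b =
    cong₂ _+_ (cong (1ℤ *_) (h [] w refl a b)) (⟨⟩-ext w (λ u v e → h (true ∷ u) v (cong (true ∷_) e)) a b)
  ⟨⟩-ext {true} (false ∷ w) h a b =
    cong (0ℤ +_) (⟨⟩-ext w (λ u v e → h (false ∷ u) v (cong (false ∷_) e)) a b)
  ⟨⟩-ext {false} (true ∷ w) h a b =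
    cong (0ℤ +_) (⟨⟩-ext w (λ u v e → h (true ∷ u) v (cong (true ∷_) e)) a b)
  ⟨⟩-ext {false} (false ∷ w) h a b =
    cong₂ _+_ (cong (1ℤ *_) (h [] w refl a b)) (⟨⟩-ext w (λ u v e → h (false ∷ u) v (cong (false ∷_) e)) a b)

  ⟨⟩-cong : ∀ {c Φ Φ′ Ψ Ψ′} → (∀ w → Φ w ≈ Φ′ w) → (∀ w → Ψ w ≈ Ψ′ w) →
            ∀ w → (Φ ⟨ c ⟩ Ψ) w ≈ (Φ′ ⟨ c ⟩ Ψ′) w
  ⟨⟩-cong p q w = ⟨⟩-ext w (λ u v _ → ⊗-cong (p u) (q v))

  ⟨⟩-congʳ : ∀ {c} Φ {Ψ Ψ′} → (∀ w → Ψ w ≈ Ψ′ w) → ∀ w → (Φ ⟨ c ⟩ Ψ) w ≈ (Φ ⟨ c ⟩ Ψ′) w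
  ⟨⟩-congʳ Φ = ⟨⟩-cong {Φ = Φ} (λ _ _ _ → refl)

  ⟨⟩-congˡ : ∀ {c Φ Φ′} Ψ → (∀ w → Φ w ≈ Φ′ w) → ∀ w → (Φ ⟨ c ⟩ Ψ) w ≈ (Φ′ ⟨ c ⟩ Ψ) w
  ⟨⟩-congˡ Ψ p = ⟨⟩-cong {Ψ = Ψ} p (λ _ _ _ → refl)

  ⟨⟩-zeroˡ : ∀ c Ψ w → ((λ _ → 𝟘) ⟨ c ⟩ Ψ) w ≈ 𝟘
  ⟨⟩-zeroˡ c Ψ [] a b = refl
  ⟨⟩-zeroˡ c Ψ (d ∷ w) a b =
    cong₂ _+_ (trans (cong (κ c d *_) (⊗-zeroˡ (Ψ w) (λ _ _ → refl) a b)) (ℤP.*-zeroʳ (κ c d)))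
              (⟨⟩-zeroˡ c Ψ w a b)

  ⟨⟩-zero : ∀ {c Φ Ψ} w → (∀ u v → w ≡ u ++ c ∷ v → Φ u ⊗ Ψ v ≈ 𝟘) → (Φ ⟨ c ⟩ Ψ) w ≈ 𝟘
  ⟨⟩-zero {c} {Φ} {Ψ} w h a b =
    trans (⟨⟩-ext {Φ′ = λ _ → 𝟘} {Ψ′ = Ψ} w
            (λ u v e a b → trans (h u v e a b) (sym (⊗-zeroˡ (Ψ v) (λ _ _ → refl) a b))) a b)
          (⟨⟩-zeroˡ c Ψ w a b)

  ⟨⟩-vanish : ∀ {c Φ Ψ} w → (∀ u v → w ≡ u ++ c ∷ v → Vanish (Φ u ⊗ Ψ v)) → Vanish ((Φ ⟨ c ⟩ Ψ) w)
  ⟨⟩-vanish [] h a = refl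
  ⟨⟩-vanish {true} (true ∷ w) h a =
    cong₂ _+_ (cong (1ℤ *_) (h [] w refl a)) (⟨⟩-vanish w (λ u v e → h (true ∷ u) v (cong (true ∷_) e)) a)
  ⟨⟩-vanish {true} (false ∷ w) h a =
    cong (0ℤ +_) (⟨⟩-vanish w (λ u v e → h (false ∷ u) v (cong (false ∷_) e)) a)
  ⟨⟩-vanish {false} (true ∷ w) h a =
    cong (0ℤ +_) (⟨⟩-vanish w (λ u v e → h (true ∷ u) v (cong (true ∷_) e)) a)
  ⟨⟩-vanish {false} (false ∷ w) h a =
    cong₂ _+_ (cong (1ℤ *_) (h [] w refl a)) (⟨⟩-vanish w (λ u v e → h (false ∷ u) v (cong (false ∷_) e)) a)

  ⟨⟩-distribʳ : ∀ c Φ Φ′ Ψ w → ((Φ ⊞ Φ′) ⟨ c ⟩ Ψ) w ≈ (Φ ⟨ c ⟩ Ψ ⊞ Φ′ ⟨ c ⟩ Ψ) w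
  ⟨⟩-distribʳ c Φ Φ′ Ψ [] a b = refl
  ⟨⟩-distribʳ c Φ Φ′ Ψ (d ∷ w) a b =
    trans (cong₂ _+_ (trans (cong (κ c d *_) (⊗-distribʳ (Φ []) (Φ′ []) (Ψ w) a b)) (ℤP.*-distribˡ-+ (κ c d) _ _))
                     (⟨⟩-distribʳ c (Φ ∘ (d ∷_)) (Φ′ ∘ (d ∷_)) Ψ w a b))
          (interchange (κ c d * (Φ [] ⊗ Ψ w) a b) _ _ _)

  ⟨⟩-distribˡ : ∀ c Φ Ψ Ψ′ w → (Φ ⟨ c ⟩ (Ψ ⊞ Ψ′)) w ≈ (Φ ⟨ c ⟩ Ψ ⊞ Φ ⟨ c ⟩ Ψ′) w
  ⟨⟩-distribˡ c Φ Ψ Ψ′ [] a b = refl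
  ⟨⟩-distribˡ c Φ Ψ Ψ′ (d ∷ w) a b =
    trans (cong₂ _+_ (trans (cong (κ c d *_) (⊗-distribˡ (Φ []) (Ψ w) (Ψ′ w) a b)) (ℤP.*-distribˡ-+ (κ c d) _ _))
                     (⟨⟩-distribˡ c (Φ ∘ (d ∷_)) Ψ Ψ′ w a b))
          (interchange (κ c d * (Φ [] ⊗ Ψ w) a b) _ _ _)

  *-rotate : ∀ x k y → x * (k * y) ≡ k * (x * y)
  *-rotate = solve 3 (λ x k y → x :* (k :* y) := k :* (x :* y)) refl

  ⟨⟩-▹ˡ : ∀ c k Φ Ψ w → ((k ▹ Φ) ⟨ c ⟩ Ψ) w ≈ (k ▹ Φ ⟨ c ⟩ Ψ) w
  ⟨⟩-▹ˡ c k Φ Ψ [] a b = sym (ℤP.*-zeroʳ k)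
  ⟨⟩-▹ˡ c k Φ Ψ (d ∷ w) a b =
    trans (cong₂ _+_ (trans (cong (κ c d *_) (⊗-·ˡ k (Φ []) (Ψ w) a b)) (*-rotate (κ c d) k _))
                     (⟨⟩-▹ˡ c k (Φ ∘ (d ∷_)) Ψ w a b))
          (sym (ℤP.*-distribˡ-+ k _ _))

  ⟨⟩-▹ʳ : ∀ c k Φ Ψ w → (Φ ⟨ c ⟩ (k ▹ Ψ)) w ≈ (k ▹ Φ ⟨ c ⟩ Ψ) w
  ⟨⟩-▹ʳ c k Φ Ψ [] a b = sym (ℤP.*-zeroʳ k)
  ⟨⟩-▹ʳ c k Φ Ψ (d ∷ w) a b =
    trans (cong₂ _+_ (trans (cong (κ c d *_) (⊗-·ʳ k (Φ []) (Ψ w) a b)) (*-rotate (κ c d) k _))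
                     (⟨⟩-▹ʳ c k (Φ ∘ (d ∷_)) Ψ w a b))
          (sym (ℤP.*-distribˡ-+ k _ _))

  ⊗-⟨⟩ : ∀ d f Ψ Ξ w → ((λ u → f ⊗ Ψ u) ⟨ d ⟩ Ξ) w ≈ f ⊗ (Ψ ⟨ d ⟩ Ξ) w
  ⊗-⟨⟩ d f Ψ Ξ [] a b = sym (⊗-zeroʳ f (λ _ _ → refl) a b)
  ⊗-⟨⟩ d f Ψ Ξ (e ∷ w) a b = begin
    κ d e * ((f ⊗ Ψ []) ⊗ Ξ w) a b + ((λ u → f ⊗ Ψ (e ∷ u)) ⟨ d ⟩ Ξ) w a b
      ≡⟨ cong₂ _+_ (trans (cong (κ d e *_) (⊗-assoc f (Ψ []) (Ξ w) a b)) (sym (⊗-·ʳ (κ d e) f (Ψ [] ⊗ Ξ w) a b)))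
                   (⊗-⟨⟩ d f (Ψ ∘ (e ∷_)) Ξ w a b) ⟩
    (f ⊗ (κ d e · (Ψ [] ⊗ Ξ w))) a b + (f ⊗ ((Ψ ∘ (e ∷_)) ⟨ d ⟩ Ξ) w) a b
      ≡⟨ sym (⊗-distribˡ f _ _ a b) ⟩
    (f ⊗ (κ d e · (Ψ [] ⊗ Ξ w) ⊕ ((Ψ ∘ (e ∷_)) ⟨ d ⟩ Ξ) w)) a b ∎
    where open ≡-Reasoning

  ⟨⟩-assoc : ∀ c d Φ Ψ Ξ w → ((Φ ⟨ c ⟩ Ψ) ⟨ d ⟩ Ξ) w ≈ (Φ ⟨ c ⟩ (Ψ ⟨ d ⟩ Ξ)) w
  ⟨⟩-assoc c d Φ Ψ Ξ [] a b = refl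
  ⟨⟩-assoc c d Φ Ψ Ξ (e ∷ w) a b = begin
    κ d e * (𝟘 ⊗ Ξ w) a b + ((κ c e ▹ (λ u → Φ [] ⊗ Ψ u) ⊞ Φₑ ⟨ c ⟩ Ψ) ⟨ d ⟩ Ξ) w a b
      ≡⟨ cong₂ _+_ (trans (cong (κ d e *_) (⊗-zeroˡ (Ξ w) (λ _ _ → refl) a b)) (ℤP.*-zeroʳ (κ d e)))
                   (⟨⟩-distribʳ d (κ c e ▹ (λ u → Φ [] ⊗ Ψ u)) (Φₑ ⟨ c ⟩ Ψ) Ξ w a b) ⟩
    0ℤ + (((κ c e ▹ (λ u → Φ [] ⊗ Ψ u)) ⟨ d ⟩ Ξ) w a b + ((Φₑ ⟨ c ⟩ Ψ) ⟨ d ⟩ Ξ) w a b)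
      ≡⟨ ℤP.+-identityˡ _ ⟩
    ((κ c e ▹ (λ u → Φ [] ⊗ Ψ u)) ⟨ d ⟩ Ξ) w a b + ((Φₑ ⟨ c ⟩ Ψ) ⟨ d ⟩ Ξ) w a b
      ≡⟨ cong₂ _+_ (trans (⟨⟩-▹ˡ d (κ c e) (λ u → Φ [] ⊗ Ψ u) Ξ w a b) (cong (κ c e *_) (⊗-⟨⟩ d (Φ []) Ψ Ξ w a b)))
                   (⟨⟩-assoc c d Φₑ Ψ Ξ w a b) ⟩
    κ c e * (Φ [] ⊗ (Ψ ⟨ d ⟩ Ξ) w) a b + (Φₑ ⟨ c ⟩ (Ψ ⟨ d ⟩ Ξ)) w a b ∎
    where
    open ≡-Reasoning
    Φₑ : Ser
    Φₑ u = Φ (e ∷ u)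

  ∂ₛ : Ser → Ser
  ∂ₛ Φ w = ∂ (Φ w)

  ∂-⟨⟩ : ∀ c Φ Ψ w → ∂ ((Φ ⟨ c ⟩ Ψ) w) ≈ (∂ₛ Φ ⟨ c ⟩ Ψ ⊞ Φ ⟨ c ⟩ ∂ₛ Ψ) w
  ∂-⟨⟩ c Φ Ψ [] a b = refl
  ∂-⟨⟩ c Φ Ψ (d ∷ w) a b = begin
    (κ c d * x (suc a) b + y (suc a) b) + -1ℤ * (κ c d * x a (suc b) + y a (suc b))
      ≡⟨ solve 5 (λ k x y x′ y′ → (k :* x :+ y) :+ con -1ℤ :* (k :* x′ :+ y′)
                             := k :* (x :+ con -1ℤ :* x′) :+ (y :+ con -1ℤ :* y′)) refl
           (κ c d) (x (suc a) b) (y (suc a) b) (x a (suc b)) (y a (suc b)) ⟩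
    κ c d * ∂ x a b + ∂ y a b
      ≡⟨ cong₂ _+_ (cong (κ c d *_) (∂-⊗ (Φ []) (Ψ w) a b)) (∂-⟨⟩ c Φ′ Ψ w a b) ⟩
    κ c d * ((∂ (Φ []) ⊗ Ψ w) a b + (Φ [] ⊗ ∂ (Ψ w)) a b) + ((∂ₛ Φ′ ⟨ c ⟩ Ψ) w a b + (Φ′ ⟨ c ⟩ ∂ₛ Ψ) w a b)
      ≡⟨ solve 5 (λ k x y z w → k :* (x :+ y) :+ (z :+ w) := (k :* x :+ z) :+ (k :* y :+ w)) refl
           (κ c d) ((∂ (Φ []) ⊗ Ψ w) a b) ((Φ [] ⊗ ∂ (Ψ w)) a b) _ _ ⟩
    (κ c d * (∂ (Φ []) ⊗ Ψ w) a b + (∂ₛ Φ′ ⟨ c ⟩ Ψ) w a b) + (κ c d * (Φ [] ⊗ ∂ (Ψ w)) a b + (Φ′ ⟨ c ⟩ ∂ₛ Ψ) w a b) ∎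
    where
    open ≡-Reasoning
    Φ′ : Ser
    Φ′ u = Φ (d ∷ u)
    x y : Array
    x = Φ [] ⊗ Ψ w
    y = (Φ′ ⟨ c ⟩ Ψ) w

  -- The definition takes words apart from the left. This counterpart at the right end serves the
  -- lemmas about the last letter.
  ⟨⟩-∷ʳ : ∀ c d Φ Ψ w → (Φ ⟨ c ⟩ Ψ) (w ∷ʳ d) ≈ κ c d · (Φ w ⊗ Ψ []) ⊕ (Φ ⟨ c ⟩ (Ψ ∘ (_∷ʳ d))) w
  ⟨⟩-∷ʳ c d Φ Ψ [] a b = refl
  ⟨⟩-∷ʳ c d Φ Ψ (e ∷ w) a b =
    trans (addˡ (κ c e * (Φ [] ⊗ Ψ (w ∷ʳ d)) a b) (⟨⟩-∷ʳ c d (Φ ∘ (e ∷_)) Ψ w a b))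
          (solve 3 (λ x y z → x :+ (y :+ z) := y :+ (x :+ z)) refl
            (κ c e * (Φ [] ⊗ Ψ (w ∷ʳ d)) a b) (κ c d * (Φ (e ∷ w) ⊗ Ψ []) a b) _)

  κ-not : ∀ c d → κ (not c) (not d) ≡ κ c d
  κ-not true true = refl
  κ-not true false = refl
  κ-not false true = refl
  κ-not false false = refl

  ⟨⟩-map-not : ∀ c Φ Ψ w → (Φ ⟨ not c ⟩ Ψ) (map not w) ≈ ((Φ ∘ map not) ⟨ c ⟩ (Ψ ∘ map not)) w
  ⟨⟩-map-not c Φ Ψ [] a b = refl
  ⟨⟩-map-not c Φ Ψ (d ∷ w) a b =
    cong₂ _+_ (cong (_* (Φ [] ⊗ Ψ (map not w)) a b) (κ-not c d)) (⟨⟩-map-not c (Φ ∘ (not d ∷_)) Ψ w a b)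

  swapₛ : Ser → Ser
  swapₛ Φ w = swap (Φ w)

  ⟨⟩-swap : ∀ c Φ Ψ w → swap ((Φ ⟨ c ⟩ Ψ) w) ≈ (swapₛ Φ ⟨ c ⟩ swapₛ Ψ) w
  ⟨⟩-swap c Φ Ψ [] a b = refl
  ⟨⟩-swap c Φ Ψ (d ∷ w) a b =
    cong₂ _+_ (cong (κ c d *_) (⊗-swap (Φ []) (Ψ w) a b)) (⟨⟩-swap c (Φ ∘ (d ∷_)) Ψ w a b)

-- The first-return recursion and the derivatives of its solutions

module RootedTrees where

  open Arrays
  open Series
  open import Data.Nat using (ℕ; zero; suc; s≤s) renaming (_≤_ to _≤ⁿ_; _<_ to _<ⁿ_; _+_ to _+ⁿ_)
  import Data.Nat.Properties as ℕP
  open import Data.Integer using (ℤ; _+_; _*_; 0ℤ; 1ℤ; -1ℤ; _≟_) renaming (+_ to pos)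
  import Data.Integer.Properties as ℤP
  open import Data.Integer.Solver using (module +-*-Solver)
  open +-*-Solver using (solve; _:+_; _:*_; con; _:=_)
  open import Data.Bool using (Bool; true; false; not)
  open import Data.List using (List; []; _∷_; _++_; _∷ʳ_; length; map)
  import Data.List.Properties as LP
  open import Data.Product using (_×_; _,_; proj₁; proj₂)
  open import Data.Empty using (⊥; ⊥-elim)
  open import Relation.Nullary using (yes; no)
  open import Function using (_∘_)
  open import Relation.Binary.PropositionalEquality

  -- Structures on a tree hanging from the root by a single edge, whose other end
  -- lies above (true) or below (false) the root; f refers to that other end.
  up : Array → Array
  up f a zero = 0ℤ
  -- The lowest point above the root either is the other end of the edge or lies below that end.
  up f a (suc b) = f a b + up f (suc a) b

  int : Bool → Array → Array
  int true f = up f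
  int false f = swap (up (swap f))

  up-cong : ∀ {f g} → f ≈ g → up f ≈ up g
  up-cong p a zero = refl
  up-cong p a (suc b) = cong₂ _+_ (p a b) (up-cong p (suc a) b)

  int-cong : ∀ c {f g} → f ≈ g → int c f ≈ int c g
  int-cong true p = up-cong p
  int-cong false p a b = up-cong (λ a b → p b a) b a

  up-𝟘 : up 𝟘 ≈ 𝟘
  up-𝟘 a zero = refl
  up-𝟘 a (suc b) = cong (0ℤ +_) (up-𝟘 (suc a) b)

  int-𝟘 : ∀ c → int c 𝟘 ≈ 𝟘
  int-𝟘 true = up-𝟘
  int-𝟘 false a b = up-𝟘 b a

  int-zero : ∀ c {f} → f ≈ 𝟘 → int c f ≈ 𝟘
  int-zero c p a b = trans (int-cong c p a b) (int-𝟘 c a b)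

  σ : Bool → ℤ
  σ true = -1ℤ
  σ false = 1ℤ

  -- `int true` is integration from x to 1 and `int false` integration from 0 to x; the sign tells
  -- which limit is the variable.
  ∂-int : ∀ c f → ∂ (int c f) ≈ σ c · f
  ∂-int true f a b = solve 2 (λ x y → y :+ con -1ℤ :* (x :+ y) := con -1ℤ :* x) refl (f a b) (int true f (suc a) b)
  ∂-int false f a b = solve 2 (λ x y → (x :+ y) :+ con -1ℤ :* y := con 1ℤ :* x) refl (f a b) (int false f a (suc b))

  int-swap : ∀ c f → int (not c) (swap f) ≈ swap (int c f)
  int-swap true f a b = refl
  int-swap false f a b = refl

  ht : List Bool → ℤ
  ht [] = 0ℤ
  ht (true ∷ w) = 1ℤ + ht w
  ht (false ∷ w) = -1ℤ + ht w

  ht-++ : ∀ u v → ht (u ++ v) ≡ ht u + ht v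
  ht-++ [] v = sym (ℤP.+-identityˡ _)
  ht-++ (true ∷ u) v = trans (cong (1ℤ +_) (ht-++ u v)) (sym (ℤP.+-assoc 1ℤ (ht u) (ht v)))
  ht-++ (false ∷ u) v = trans (cong (-1ℤ +_) (ht-++ u v)) (sym (ℤP.+-assoc -1ℤ (ht u) (ht v)))

  ht-edge : ∀ c u v → ht (c ∷ u ++ not c ∷ v) ≡ ht u + ht v
  ht-edge true u v = trans (cong (1ℤ +_) (ht-++ u (false ∷ v)))
    (solve 2 (λ x y → con 1ℤ :+ (x :+ (con -1ℤ :+ y)) := x :+ y) refl (ht u) (ht v))
  ht-edge false u v = trans (cong (-1ℤ +_) (ht-++ u (true ∷ v)))
    (solve 2 (λ x y → con -1ℤ :+ (x :+ (con 1ℤ :+ y)) := x :+ y) refl (ht u) (ht v))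

  -- Lattice paths from height k to height 0 that never go below 0.
  Above : ℕ → List Bool → Set
  Above k [] = k ≡ 0
  Above k (true ∷ w) = Above (suc k) w
  Above zero (false ∷ w) = ⊥
  Above (suc k) (false ∷ w) = Above k w

  suc-step : ∀ k x → pos k + (1ℤ + x) ≡ pos (suc k) + x
  suc-step k x = trans (sym (ℤP.+-assoc (pos k) 1ℤ x)) (cong (_+ x) (ℤP.+-comm (pos k) 1ℤ))

  pred-step : ∀ k x → pos (suc k) + (-1ℤ + x) ≡ pos k + x
  pred-step k x = sym (ℤP.+-assoc (pos (suc k)) -1ℤ x)

  above-ht : ∀ k w → Above k w → pos k + ht w ≡ 0ℤ
  above-ht k [] refl = refl
  above-ht k (true ∷ w) h = trans (suc-step k (ht w)) (above-ht (suc k) w h)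
  above-ht (suc k) (false ∷ w) h = trans (pred-step k (ht w)) (above-ht k w h)

  -- A descent has to start at a positive height.
  above-prefix : ∀ k u v → Above k (u ++ false ∷ v) → pos k + ht u ≢ 0ℤ
  above-prefix (suc k) [] v h ()
  above-prefix k (true ∷ u) v h e = above-prefix (suc k) u v h (trans (sym (suc-step k (ht u))) e)
  above-prefix (suc k) (false ∷ u) v h e = above-prefix k u v h (trans (sym (pred-step k (ht u))) e)

  -- After an ascent the path is at a positive height, from which the suffix returns to 0.
  above-suffix : ∀ k u v → Above k (u ++ true ∷ v) → ht v ≢ 0ℤ
  above-suffix k [] v h e with trans (cong (pos (suc k) +_) (sym e)) (above-ht (suc k) v h)
  ... | ()
  above-suffix k (true ∷ u) v h = above-suffix (suc k) u v h
  above-suffix (suc k) (false ∷ u) v h = above-suffix k u v h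

  prefix-< : ∀ (u : List Bool) c v {n} → length (u ++ c ∷ v) ≤ⁿ n → length u <ⁿ suc n × length v <ⁿ n
  prefix-< u c v {n} h rewrite LP.length-++ u {c ∷ v} =
    s≤s (ℕP.≤-trans (ℕP.m≤m+n (length u) _) h) ,
    ℕP.≤-trans (ℕP.m≤n+m (suc (length v)) (length u)) h

  -- Only the recursion is assumed here; the enumeration of trees supplies such an `F` later.
  module WithF (F : Ser) (F-[] : F [] ≈ 𝟙)
               (F-∷ : ∀ c w → F (c ∷ w) ≈ ((int c ∘ F) ⟨ not c ⟩ F) w) where

    induction : (P : List Bool → Set) → P [] →
                (∀ c w → (∀ u → length u ≤ⁿ length w → P u) → P (c ∷ w)) → ∀ w → P w
    induction P p[] p∷ w = go (length w) w ℕP.≤-refl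
      where
      go : ∀ n w → length w ≤ⁿ n → P w
      go n [] _ = p[]
      go (suc n) (c ∷ w) (s≤s h) = p∷ c w (λ u q → go n u (ℕP.≤-trans q h))

    split-≤ : ∀ {w : List Bool} u c v → w ≡ u ++ c ∷ v → length u ≤ⁿ length w × length v ≤ⁿ length w
    split-≤ u c v refl = ℕP.≤-pred (proj₁ p) , ℕP.<⇒≤ (proj₂ p)
      where p = prefix-< u c v ℕP.≤-refl

    -- If the part u enclosed by the first edge is balanced, then v has the height of the whole
    -- word. So every summand of the recursion has a factor of non-zero height.
    F-zero : ∀ w → ht w ≢ 0ℤ → F w ≈ 𝟘
    F-zero = induction _ (λ h → ⊥-elim (h refl)) step
      where
      step : ∀ c w → (∀ u → length u ≤ⁿ length w → ht u ≢ 0ℤ → F u ≈ 𝟘) → ht (c ∷ w) ≢ 0ℤ → F (c ∷ w) ≈ 𝟘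
      step c w ih h a b = trans (F-∷ c w a b) (⟨⟩-zero {not c} {int c ∘ F} {F} w zeros a b)
        where
        zeros : ∀ u v → w ≡ u ++ not c ∷ v → int c (F u) ⊗ F v ≈ 𝟘
        zeros u v e with ht u ≟ 0ℤ
        ... | no hu = ⊗-zeroˡ (F v) (int-zero c (ih u (proj₁ (split-≤ u (not c) v e)) hu))
        ... | yes hu = ⊗-zeroʳ (int c (F u)) (ih v (proj₂ (split-≤ u (not c) v e))
                (λ hv → h (trans (cong (ht ∘ (c ∷_)) e) (trans (ht-edge c u v) (cong₂ _+_ hu hv)))))

    -- The separating `d` is either the first letter itself, after an empty left factor, or a later
    -- one; then the left factor starts with `c` and the recursion applies to it.
    F⟨⟩-∷ : ∀ d Ψ c w → (F ⟨ d ⟩ Ψ) (c ∷ w) ≈ κ d c · Ψ w ⊕ ((int c ∘ F) ⟨ not c ⟩ (F ⟨ d ⟩ Ψ)) w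
    F⟨⟩-∷ d Ψ c w a b = cong₂ _+_
      (cong (κ d c *_) (trans (⊗-cong {g = Ψ w} F-[] (λ _ _ → refl) a b) (⊗-identityˡ (Ψ w) a b)))
      (trans (⟨⟩-congˡ Ψ (F-∷ c) w a b) (⟨⟩-assoc (not c) d (int c ∘ F) F Ψ w a b))

    -- Moving the label of the root past the label of one of its neighbours
    -- contracts the edge between them.
    F-∂ : ∀ w → ∂ₛ F w ≈ (F ⟨ false ⟩ (F ⟨ true ⟩ F) ⊞ -1ℤ ▹ F ⟨ true ⟩ (F ⟨ false ⟩ F)) w
    F-∂ = induction _ base step
      where
      open ≡-Reasoning
      FUF FDF G : Ser
      FUF = F ⟨ true ⟩ F
      FDF = F ⟨ false ⟩ F
      G = F ⟨ false ⟩ FUF ⊞ -1ℤ ▹ F ⟨ true ⟩ FDF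
      base : ∂ₛ F [] ≈ G []
      base zero b = cong₂ _+_ (F-[] 1 b) (cong (-1ℤ *_) (F-[] 0 (suc b)))
      base (suc a) b = cong₂ _+_ (F-[] (suc (suc a)) b) (cong (-1ℤ *_) (F-[] (suc a) (suc b)))
      -- Differentiating the integral over the first edge leaves `F ⟨ not c ⟩ F`. This is the
      -- summand of `G` in which the leading `c` is a deleted letter, and `σ c` is its sign there.
      edge : ∀ c w (x y : ℤ) a b →
             σ c * (F ⟨ not c ⟩ F) w a b + (x + -1ℤ * y) ≡
             (κ false c * FUF w a b + x) + -1ℤ * (κ true c * FDF w a b + y)
      edge true w x y a b =
        solve 4 (λ z u x y → con -1ℤ :* z :+ (x :+ con -1ℤ :* y) := (con 0ℤ :* u :+ x) :+ con -1ℤ :* (con 1ℤ :* z :+ y)) refl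
          (FDF w a b) (FUF w a b) x y
      edge false w x y a b =
        solve 4 (λ z u x y → con 1ℤ :* z :+ (x :+ con -1ℤ :* y) := (con 1ℤ :* z :+ x) :+ con -1ℤ :* (con 0ℤ :* u :+ y)) refl
          (FUF w a b) (FDF w a b) x y
      step : ∀ c w → (∀ u → length u ≤ⁿ length w → ∂ₛ F u ≈ G u) → ∂ₛ F (c ∷ w) ≈ G (c ∷ w)
      step c w ih a b = begin
        ∂ (F (c ∷ w)) a b
          ≡⟨ cong₂ (λ x y → x + -1ℤ * y) (F-∷ c w (suc a) b) (F-∷ c w a (suc b)) ⟩
        ∂ ((I ⟨ not c ⟩ F) w) a b
          ≡⟨ ∂-⟨⟩ (not c) I F w a b ⟩
        (∂ₛ I ⟨ not c ⟩ F) w a b + (I ⟨ not c ⟩ ∂ₛ F) w a b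
          ≡⟨ cong₂ _+_
               (trans (⟨⟩-congˡ F (λ u → ∂-int c (F u)) w a b) (⟨⟩-▹ˡ (not c) (σ c) F F w a b))
               (⟨⟩-ext {Φ = I} {Ψ = ∂ₛ F} {Ψ′ = G} w
                 (λ u v e → ⊗-cong {I u} (λ _ _ → refl) (ih v (proj₂ (split-≤ u (not c) v e)))) a b) ⟩
        σ c * (F ⟨ not c ⟩ F) w a b + (I ⟨ not c ⟩ G) w a b
          ≡⟨ addˡ (σ c * (F ⟨ not c ⟩ F) w a b)
               (trans (⟨⟩-distribˡ (not c) I (F ⟨ false ⟩ FUF) (-1ℤ ▹ F ⟨ true ⟩ FDF) w a b)
                      (addˡ ((I ⟨ not c ⟩ (F ⟨ false ⟩ FUF)) w a b) (⟨⟩-▹ʳ (not c) -1ℤ I (F ⟨ true ⟩ FDF) w a b))) ⟩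
        σ c * (F ⟨ not c ⟩ F) w a b
          + ((I ⟨ not c ⟩ (F ⟨ false ⟩ FUF)) w a b + -1ℤ * (I ⟨ not c ⟩ (F ⟨ true ⟩ FDF)) w a b)
          ≡⟨ edge c w ((I ⟨ not c ⟩ (F ⟨ false ⟩ FUF)) w a b) ((I ⟨ not c ⟩ (F ⟨ true ⟩ FDF)) w a b) a b ⟩
        (κ false c * FUF w a b + (I ⟨ not c ⟩ (F ⟨ false ⟩ FUF)) w a b)
          + -1ℤ * (κ true c * FDF w a b + (I ⟨ not c ⟩ (F ⟨ true ⟩ FDF)) w a b)
          ≡⟨ sym (cong₂ (λ x y → x + -1ℤ * y) (F⟨⟩-∷ false FUF c w a b) (F⟨⟩-∷ true FDF c w a b)) ⟩
        G (c ∷ w) a b ∎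
        where
        I : Ser
        I = int c ∘ F

    -- n + 1 trees with a common root, consecutive ones separated by a letter.
    M : ℕ → Ser
    M zero = F
    M (suc n) = F ⟨ true ⟩ M n ⊞ F ⟨ false ⟩ M n

    F⟨⟩F⟨⟩-M : ∀ c d n w → (F ⟨ c ⟩ (F ⟨ d ⟩ (F ⟨ true ⟩ M n)) ⊞ F ⟨ c ⟩ (F ⟨ d ⟩ (F ⟨ false ⟩ M n))) w
                         ≈ (F ⟨ c ⟩ (F ⟨ d ⟩ M (suc n))) w
    F⟨⟩F⟨⟩-M c d n w a b = sym (trans
      (⟨⟩-congʳ F (⟨⟩-distribˡ d F (F ⟨ true ⟩ M n) (F ⟨ false ⟩ M n)) w a b)
      (⟨⟩-distribˡ c F (F ⟨ d ⟩ (F ⟨ true ⟩ M n)) (F ⟨ d ⟩ (F ⟨ false ⟩ M n)) w a b))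

    M-suc-⟨⟩F : ∀ c n w → (F ⟨ true ⟩ (M n ⟨ c ⟩ F) ⊞ F ⟨ false ⟩ (M n ⟨ c ⟩ F)) w ≈ (M (suc n) ⟨ c ⟩ F) w
    M-suc-⟨⟩F c n w a b = sym (trans
      (⟨⟩-distribʳ c (F ⟨ true ⟩ M n) (F ⟨ false ⟩ M n) F w a b)
      (cong₂ _+_ (⟨⟩-assoc true c F (M n) F w a b) (⟨⟩-assoc false c F (M n) F w a b)))

    -- Let s be the sum of the two letters and U the letter `true`. Adding and subtracting F U F U F
    -- writes the derivative of F as F s F U F - F U F s F. In the derivative of F s F s ... s F the
    -- positive term from each factor cancels the negative term from the next one, and only the two
    -- ends remain.
    M-∂ : ∀ n w → ∂ₛ (M n) w ≈ (M (suc n) ⟨ true ⟩ F ⊞ -1ℤ ▹ F ⟨ true ⟩ M (suc n)) w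
    M-∂ zero w a b = begin
      ∂ (F w) a b
        ≡⟨ F-∂ w a b ⟩
      (F ⟨ false ⟩ FUF) w a b + -1ℤ * (F ⟨ true ⟩ FDF) w a b
        ≡⟨ solve 3 (λ x y z → x :+ con -1ℤ :* y := (z :+ x) :+ con -1ℤ :* (z :+ y)) refl
             ((F ⟨ false ⟩ FUF) w a b) ((F ⟨ true ⟩ FDF) w a b) ((F ⟨ true ⟩ FUF) w a b) ⟩
      ((F ⟨ true ⟩ FUF) w a b + (F ⟨ false ⟩ FUF) w a b) + -1ℤ * ((F ⟨ true ⟩ FUF) w a b + (F ⟨ true ⟩ FDF) w a b)
        ≡⟨ cong₂ (λ x y → x + -1ℤ * y) (M-suc-⟨⟩F true zero w a b) (sym (⟨⟩-distribˡ true F FUF FDF w a b)) ⟩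
      (M 1 ⟨ true ⟩ F) w a b + -1ℤ * (F ⟨ true ⟩ M 1) w a b ∎
      where
      open ≡-Reasoning
      FUF FDF : Ser
      FUF = F ⟨ true ⟩ F
      FDF = F ⟨ false ⟩ F
    M-∂ (suc n) w a b = begin
      (p true (suc a) b + p false (suc a) b) + -1ℤ * (p true a (suc b) + p false a (suc b))
        ≡⟨ solve 4 (λ x y z w → (x :+ y) :+ con -1ℤ :* (z :+ w) := (x :+ con -1ℤ :* z) :+ (y :+ con -1ℤ :* w)) refl
             (p true (suc a) b) (p false (suc a) b) (p true a (suc b)) (p false a (suc b)) ⟩
      ∂ (p true) a b + ∂ (p false) a b
        ≡⟨ cong₂ _+_ (∂p true) (∂p false) ⟩
      ((x true + -1ℤ * y true) + (z true + -1ℤ * t true)) + ((x false + -1ℤ * y false) + (z false + -1ℤ * t false))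
        ≡⟨ solve 8 (λ x x′ y y′ z z′ t t′ →
               ((x :+ con -1ℤ :* y) :+ (z :+ con -1ℤ :* t)) :+ ((x′ :+ con -1ℤ :* y′) :+ (z′ :+ con -1ℤ :* t′))
            := (z :+ z′) :+ (((x :+ x′) :+ con -1ℤ :* (y :+ y′)) :+ con -1ℤ :* (t :+ t′))) refl
             (x true) (x false) (y true) (y false) (z true) (z false) (t true) (t false) ⟩
      (z true + z false) + (((x true + x false) + -1ℤ * (y true + y false)) + -1ℤ * (t true + t false))
        ≡⟨ cong₂ _+_ (M-suc-⟨⟩F true (suc n) w a b)
             (cong₂ (λ x y → x + -1ℤ * y)
               (cong₂ (λ x y → x + -1ℤ * y) (F⟨⟩F⟨⟩-M false true n w a b) (F⟨⟩F⟨⟩-M true false n w a b)) refl) ⟩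
      -- The two `x` terms have combined to `t false`, which cancels in the next step.
      (M (2 +ⁿ n) ⟨ true ⟩ F) w a b + ((t false + -1ℤ * (F ⟨ true ⟩ (F ⟨ false ⟩ M (suc n))) w a b) + -1ℤ * (t true + t false))
        ≡⟨ solve 4 (λ z t t′ s → z :+ ((t′ :+ con -1ℤ :* s) :+ con -1ℤ :* (t :+ t′)) := z :+ con -1ℤ :* (t :+ s)) refl
             ((M (2 +ⁿ n) ⟨ true ⟩ F) w a b) (t true) (t false) ((F ⟨ true ⟩ (F ⟨ false ⟩ M (suc n))) w a b) ⟩
      (M (2 +ⁿ n) ⟨ true ⟩ F) w a b + -1ℤ * (t true + (F ⟨ true ⟩ (F ⟨ false ⟩ M (suc n))) w a b)
        ≡⟨ addˡ ((M (2 +ⁿ n) ⟨ true ⟩ F) w a b) (cong (-1ℤ *_)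
             (sym (⟨⟩-distribˡ true F (F ⟨ true ⟩ M (suc n)) (F ⟨ false ⟩ M (suc n)) w a b))) ⟩
      (M (2 +ⁿ n) ⟨ true ⟩ F) w a b + -1ℤ * (F ⟨ true ⟩ M (2 +ⁿ n)) w a b ∎
      where
      open ≡-Reasoning
      p : Bool → Array
      p c = (F ⟨ c ⟩ M n) w
      x y z t : Bool → ℤ
      x c = (F ⟨ false ⟩ (F ⟨ true ⟩ (F ⟨ c ⟩ M n))) w a b
      y c = (F ⟨ true ⟩ (F ⟨ false ⟩ (F ⟨ c ⟩ M n))) w a b
      z c = (F ⟨ c ⟩ (M (suc n) ⟨ true ⟩ F)) w a b
      t c = (F ⟨ c ⟩ (F ⟨ true ⟩ M (suc n))) w a b
      assoc² : ∀ d e c → ((F ⟨ d ⟩ (F ⟨ e ⟩ F)) ⟨ c ⟩ M n) w a b ≡ (F ⟨ d ⟩ (F ⟨ e ⟩ (F ⟨ c ⟩ M n))) w a b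
      assoc² d e c = trans (⟨⟩-assoc d c F (F ⟨ e ⟩ F) (M n) w a b)
                           (⟨⟩-congʳ F (⟨⟩-assoc e c F F (M n)) w a b)
      ∂p : ∀ c → ∂ (p c) a b ≡ (x c + -1ℤ * y c) + (z c + -1ℤ * t c)
      ∂p c = trans (∂-⟨⟩ c F (M n) w a b) (cong₂ _+_
        (trans (⟨⟩-congˡ (M n) F-∂ w a b)
          (trans (⟨⟩-distribʳ c (F ⟨ false ⟩ (F ⟨ true ⟩ F)) (-1ℤ ▹ F ⟨ true ⟩ (F ⟨ false ⟩ F)) (M n) w a b)
            (cong₂ _+_ (assoc² false true c)
              (trans (⟨⟩-▹ˡ c -1ℤ (F ⟨ true ⟩ (F ⟨ false ⟩ F)) (M n) w a b) (cong (-1ℤ *_) (assoc² true false c))))))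
        (trans (⟨⟩-congʳ F (M-∂ n) w a b)
          (trans (⟨⟩-distribˡ c F (M (suc n) ⟨ true ⟩ F) (-1ℤ ▹ F ⟨ true ⟩ M (suc n)) w a b)
            (addˡ (z c) (⟨⟩-▹ʳ c -1ℤ F (F ⟨ true ⟩ M (suc n)) w a b)))))

    -- On a path that stays above 0 the remaining terms of M-∂ are unbalanced.
    M-∂-above : ∀ n w → Above 0 w → ∀ a b → M n w a (suc b) ≡ M n w (suc a) b + M (2 +ⁿ n) w a b
    M-∂-above n w h a b = begin
      M n w a (suc b)
        ≡⟨ solve 2 (λ x y → y := x :+ con -1ℤ :* (x :+ con -1ℤ :* y)) refl (M n w (suc a) b) (M n w a (suc b)) ⟩
      M n w (suc a) b + -1ℤ * ∂ₛ (M n) w a b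
        ≡⟨ addˡ (M n w (suc a) b) (cong (-1ℤ *_) (trans (M-∂ n w a b) (addʳ (-1ℤ * (F ⟨ true ⟩ M (suc n)) w a b) zero₁))) ⟩
      M n w (suc a) b + -1ℤ * (0ℤ + -1ℤ * (F ⟨ true ⟩ M (suc n)) w a b)
        ≡⟨ solve 2 (λ x y → x :+ con -1ℤ :* (con 0ℤ :+ con -1ℤ :* y) := x :+ (y :+ con 0ℤ)) refl
             (M n w (suc a) b) ((F ⟨ true ⟩ M (suc n)) w a b) ⟩
      M n w (suc a) b + ((F ⟨ true ⟩ M (suc n)) w a b + 0ℤ)
        -- The other half `F ⟨ false ⟩ M (suc n)` is zero on such a path, and adding it completes
        -- `M (2 +ⁿ n)`.
        ≡⟨ addˡ (M n w (suc a) b) (addˡ ((F ⟨ true ⟩ M (suc n)) w a b) (sym zero₂)) ⟩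
      M n w (suc a) b + M (2 +ⁿ n) w a b ∎
      where
      open ≡-Reasoning
      zero₁ : (M (suc n) ⟨ true ⟩ F) w a b ≡ 0ℤ
      zero₁ = ⟨⟩-zero {true} {M (suc n)} {F} w (λ u v e → ⊗-zeroʳ (M (suc n) u)
        (F-zero v (above-suffix 0 u v (subst (Above 0) e h)))) a b
      zero₂ : (F ⟨ false ⟩ M (suc n)) w a b ≡ 0ℤ
      zero₂ = ⟨⟩-zero {false} {F} {M (suc n)} w (λ u v e → ⊗-zeroˡ (M (suc n) v)
        (F-zero u (λ q → above-prefix 0 u v (subst (Above 0) e h) (trans (ℤP.+-identityˡ (ht u)) q)))) a b

    -- The first child would have to exceed the root, but with b = 0 no label does.
    F-true-vanish : ∀ w → Vanish (F (true ∷ w))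
    F-true-vanish w a = trans (F-∷ true w a 0)
      (⟨⟩-vanish {false} {int true ∘ F} {F} w (λ u v _ → ⊗-vanishˡ (F v) (λ _ → refl)) a)

    -- A final descent returns to the root from a larger child. In the recursion this last letter
    -- either closes the first edge or ends the word v.
    F-false-vanish : ∀ w → Vanish (F (w ∷ʳ false))
    F-false-vanish = induction _ (λ a → F-∷ false [] a 0) step
      where
      last : ∀ c w a → κ (not c) false * (int c (F w) ⊗ F []) a 0 ≡ 0ℤ
      last true w a = cong (1ℤ *_) (⊗-vanishˡ {int true (F w)} (F []) (λ _ → refl) a)
      last false w a = refl
      step : ∀ c w → (∀ u → length u ≤ⁿ length w → Vanish (F (u ∷ʳ false))) → Vanish (F (c ∷ w ∷ʳ false))
      step c w ih a = trans (F-∷ c (w ∷ʳ false) a 0)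
        (trans (⟨⟩-∷ʳ (not c) false (int c ∘ F) F w a 0)
          (cong₂ _+_ (last c w a)
            (⟨⟩-vanish {not c} {int c ∘ F} {F ∘ (_∷ʳ false)} w
              (λ u v e → ⊗-vanishʳ (int c (F u)) (ih v (proj₂ (split-≤ u (not c) v e)))) a)))

    -- At b = 0 the first of the trees cannot have a word starting with `true`; so it is a single
    -- vertex and the leading letter is the first one deleted.
    M-true : ∀ n w a → M (suc n) (true ∷ w) a 0 ≡ M n w a 0
    M-true n w a = begin
      (1ℤ * (F [] ⊗ M n w) a 0 + ((F ∘ (true ∷_)) ⟨ true ⟩ M n) w a 0)
        + (0ℤ + ((F ∘ (true ∷_)) ⟨ false ⟩ M n) w a 0)
        ≡⟨ cong₂ (λ x y → (1ℤ * (F [] ⊗ M n w) a 0 + x) + (0ℤ + y)) (zeros true) (zeros false) ⟩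
      (1ℤ * (F [] ⊗ M n w) a 0 + 0ℤ) + 0ℤ
        ≡⟨ solve 1 (λ x → (con 1ℤ :* x :+ con 0ℤ) :+ con 0ℤ := x) refl _ ⟩
      (F [] ⊗ M n w) a 0
        ≡⟨ trans (⊗-cong {g = M n w} F-[] (λ _ _ → refl) a 0) (⊗-identityˡ (M n w) a 0) ⟩
      M n w a 0 ∎
      where
      open ≡-Reasoning
      zeros : ∀ c → ((F ∘ (true ∷_)) ⟨ c ⟩ M n) w a 0 ≡ 0ℤ
      zeros c = ⟨⟩-vanish {c} {F ∘ (true ∷_)} {M n} w (λ u v _ → ⊗-vanishˡ (M n v) (F-true-vanish u)) a

    -- Splits off the last tree instead of the first, in preparation for the last letter.
    M-sucʳ : ∀ n w → M (suc n) w ≈ (M n ⟨ true ⟩ F ⊞ M n ⟨ false ⟩ F) w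
    M-sucʳ zero w a b = refl
    M-sucʳ (suc n) w a b = begin
      (F ⟨ true ⟩ M (suc n)) w a b + (F ⟨ false ⟩ M (suc n)) w a b
        ≡⟨ cong₂ _+_ (expand true) (expand false) ⟩
      ((F ⟨ true ⟩ (M n ⟨ true ⟩ F)) w a b + (F ⟨ true ⟩ (M n ⟨ false ⟩ F)) w a b)
        + ((F ⟨ false ⟩ (M n ⟨ true ⟩ F)) w a b + (F ⟨ false ⟩ (M n ⟨ false ⟩ F)) w a b)
        ≡⟨ interchange ((F ⟨ true ⟩ (M n ⟨ true ⟩ F)) w a b) _ _ _ ⟩
      ((F ⟨ true ⟩ (M n ⟨ true ⟩ F)) w a b + (F ⟨ false ⟩ (M n ⟨ true ⟩ F)) w a b)
        + ((F ⟨ true ⟩ (M n ⟨ false ⟩ F)) w a b + (F ⟨ false ⟩ (M n ⟨ false ⟩ F)) w a b)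
        ≡⟨ cong₂ _+_ (M-suc-⟨⟩F true n w a b) (M-suc-⟨⟩F false n w a b) ⟩
      (M (suc n) ⟨ true ⟩ F) w a b + (M (suc n) ⟨ false ⟩ F) w a b ∎
      where
      open ≡-Reasoning
      expand : ∀ c → (F ⟨ c ⟩ M (suc n)) w a b ≡ (F ⟨ c ⟩ (M n ⟨ true ⟩ F)) w a b + (F ⟨ c ⟩ (M n ⟨ false ⟩ F)) w a b
      expand c = trans (⟨⟩-congʳ F (M-sucʳ n) w a b) (⟨⟩-distribˡ c F (M n ⟨ true ⟩ F) (M n ⟨ false ⟩ F) w a b)

    M-false : ∀ n w a → M (suc n) (w ∷ʳ false) a 0 ≡ M n w a 0
    M-false n w a = begin
      M (suc n) (w ∷ʳ false) a 0
        ≡⟨ M-sucʳ n (w ∷ʳ false) a 0 ⟩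
      (M n ⟨ true ⟩ F) (w ∷ʳ false) a 0 + (M n ⟨ false ⟩ F) (w ∷ʳ false) a 0
        ≡⟨ cong₂ _+_ (⟨⟩-∷ʳ true false (M n) F w a 0) (⟨⟩-∷ʳ false false (M n) F w a 0) ⟩
      (0ℤ + (M n ⟨ true ⟩ (F ∘ (_∷ʳ false))) w a 0)
        + (1ℤ * (M n w ⊗ F []) a 0 + (M n ⟨ false ⟩ (F ∘ (_∷ʳ false))) w a 0)
        ≡⟨ cong₂ (λ x y → (0ℤ + x) + (1ℤ * (M n w ⊗ F []) a 0 + y)) (zeros true) (zeros false) ⟩
      0ℤ + (1ℤ * (M n w ⊗ F []) a 0 + 0ℤ)
        ≡⟨ solve 1 (λ x → con 0ℤ :+ (con 1ℤ :* x :+ con 0ℤ) := x) refl _ ⟩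
      (M n w ⊗ F []) a 0
        ≡⟨ trans (⊗-cong {M n w} (λ _ _ → refl) F-[] a 0) (⊗-identityʳ (M n w) a 0) ⟩
      M n w a 0 ∎
      where
      open ≡-Reasoning
      zeros : ∀ c → (M n ⟨ c ⟩ (F ∘ (_∷ʳ false))) w a 0 ≡ 0ℤ
      zeros c = ⟨⟩-vanish {c} {M n} {F ∘ (_∷ʳ false)} w (λ u v _ → ⊗-vanishʳ (M n u) (F-false-vanish v)) a

    -- Reversing the order of all labels exchanges ascents with descents and the points below the
    -- root with those above.
    F-swap : ∀ w → F (map not w) ≈ swap (F w)
    F-swap = induction _ base step
      where
      base : F [] ≈ swap (F [])
      base zero zero = refl
      base zero (suc b) = trans (F-[] 0 (suc b)) (sym (F-[] (suc b) 0))
      base (suc a) zero = trans (F-[] (suc a) 0) (sym (F-[] 0 (suc a)))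
      base (suc a) (suc b) = trans (F-[] (suc a) (suc b)) (sym (F-[] (suc b) (suc a)))
      step : ∀ c w → (∀ u → length u ≤ⁿ length w → F (map not u) ≈ swap (F u)) → F (map not (c ∷ w)) ≈ swap (F (c ∷ w))
      step c w ih a b = begin
        F (not c ∷ map not w) a b
          ≡⟨ F-∷ (not c) (map not w) a b ⟩
        ((int (not c) ∘ F) ⟨ not (not c) ⟩ F) (map not w) a b
          ≡⟨ ⟨⟩-map-not (not c) (int (not c) ∘ F) F w a b ⟩
        ((int (not c) ∘ F ∘ map not) ⟨ not c ⟩ (F ∘ map not)) w a b
          ≡⟨ ⟨⟩-ext {not c} {int (not c) ∘ F ∘ map not} {swapₛ (int c ∘ F)} {F ∘ map not} {swapₛ F} w (λ u v e → ⊗-cong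
               (λ a b → trans (int-cong (not c) (ih u (proj₁ (split-≤ u (not c) v e))) a b) (int-swap c (F u) a b))
               (ih v (proj₂ (split-≤ u (not c) v e)))) a b ⟩
        (swapₛ (int c ∘ F) ⟨ not c ⟩ swapₛ F) w a b
          ≡⟨ sym (⟨⟩-swap (not c) (int c ∘ F) F w a b) ⟩
        ((int c ∘ F) ⟨ not c ⟩ F) w b a
          ≡⟨ sym (F-∷ c w b a) ⟩
        F (c ∷ w) b a ∎
        where open ≡-Reasoning

    M-swap : ∀ n w → M n (map not w) ≈ swap (M n w)
    M-swap zero = F-swap
    M-swap (suc n) w a b = trans (ℤP.+-comm ((F ⟨ true ⟩ M n) (map not w) a b) _)
      (cong₂ _+_ (flip true) (flip false))
      where
      flip : ∀ c → (F ⟨ not c ⟩ M n) (map not w) a b ≡ (F ⟨ c ⟩ M n) w b a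
      flip c = trans (⟨⟩-map-not c F (M n) w a b)
        (trans (⟨⟩-cong F-swap (M-swap n) w a b) (sym (⟨⟩-swap c F (M n) w a b)))

-- Balls in boxes and the cycle lemma

module BallsInBoxes where

  open import Data.Nat using (ℕ; zero; suc; s≤s; z≤n; _+_; _*_; _^_)
  import Data.Nat.Properties as ℕP
  open import Data.Nat.Solver using (module +-*-Solver)
  open import Data.Integer using (ℤ; 0ℤ; 1ℤ; _<?_; _≟_) renaming (+_ to pos; _+_ to _+ᶻ_; _-_ to _-ᶻ_; -_ to -ᶻ_; _<_ to _<ᶻ_; _≤_ to _≤ᶻ_)
  import Data.Integer as ℤ
  import Data.Integer.Properties as ℤP
  import Data.Integer.Solver as ℤS
  open import Data.Bool using (Bool; true; false; _∧_)
  import Data.Bool.Properties as BP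
  open import Data.List using (List; []; _∷_; _++_; _∷ʳ_; length; replicate)
  open import Data.Nat.ListAction using (sum)
  import Data.List.Properties as LP
  open import Relation.Nullary using (yes; no; does)
  open import Relation.Nullary.Decidable using (dec-true; dec-false)
  open import Function using (_∘_)
  open import Relation.Binary.PropositionalEquality

  zeros : ℕ → List ℕ
  zeros m = replicate m 0

  -- The sum of ψ over all ways to throw one more ball into the boxes.
  Δ : (List ℕ → ℕ) → List ℕ → ℕ
  Δ ψ [] = 0
  Δ ψ (c ∷ cs) = ψ (suc c ∷ cs) + Δ (ψ ∘ (c ∷_)) cs

  Δ^ : ℕ → (List ℕ → ℕ) → List ℕ → ℕ
  Δ^ zero ψ = ψ
  Δ^ (suc n) ψ = Δ (Δ^ n ψ)

  Δ-cong-sum : ∀ {ψ ψ′} cs → (∀ cs′ → length cs′ ≡ length cs → sum cs′ ≡ suc (sum cs) → ψ cs′ ≡ ψ′ cs′) →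
               Δ ψ cs ≡ Δ ψ′ cs
  Δ-cong-sum [] h = refl
  Δ-cong-sum (c ∷ cs) h = cong₂ _+_ (h (suc c ∷ cs) refl refl)
    (Δ-cong-sum cs (λ cs′ p q → h (c ∷ cs′) (cong suc p) (trans (cong (c +_) q) (ℕP.+-suc c (sum cs)))))

  -- Throwing n balls reaches only lists with equally many boxes and n more balls; the cycle lemma
  -- needs exactly this control of the total.
  Δ^-cong-sum : ∀ n {ψ ψ′} cs → (∀ cs′ → length cs′ ≡ length cs → sum cs′ ≡ n + sum cs → ψ cs′ ≡ ψ′ cs′) →
                Δ^ n ψ cs ≡ Δ^ n ψ′ cs
  Δ^-cong-sum zero cs h = h cs refl refl
  Δ^-cong-sum (suc n) cs h = Δ-cong-sum cs (λ cs₁ p q → Δ^-cong-sum n cs₁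
    (λ cs₂ p′ q′ → h cs₂ (trans p′ p) (trans q′ (trans (cong (n +_) q) (ℕP.+-suc n (sum cs))))))

  Δ-cong : ∀ {ψ ψ′} → (∀ cs → ψ cs ≡ ψ′ cs) → ∀ cs → Δ ψ cs ≡ Δ ψ′ cs
  Δ-cong h cs = Δ-cong-sum cs (λ cs′ _ _ → h cs′)

  Δ^-cong : ∀ n {ψ ψ′} → (∀ cs → ψ cs ≡ ψ′ cs) → ∀ cs → Δ^ n ψ cs ≡ Δ^ n ψ′ cs
  Δ^-cong n h cs = Δ^-cong-sum n cs (λ cs′ _ _ → h cs′)

  Δ^-Δ : ∀ n ψ cs → Δ^ n (Δ ψ) cs ≡ Δ^ (suc n) ψ cs
  Δ^-Δ zero ψ cs = refl
  Δ^-Δ (suc n) ψ cs = Δ-cong (Δ^-Δ n ψ) cs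

  +-interchange : ∀ a b c d → (a + b) + (c + d) ≡ (a + c) + (b + d)
  +-interchange = solve 4 (λ x y z w → (x :+ y) :+ (z :+ w) := (x :+ z) :+ (y :+ w)) refl
    where open +-*-Solver

  Δ-+ : ∀ ψ ψ′ cs → Δ (λ c → ψ c + ψ′ c) cs ≡ Δ ψ cs + Δ ψ′ cs
  Δ-+ ψ ψ′ [] = refl
  Δ-+ ψ ψ′ (c ∷ cs) = trans (cong (ψ (suc c ∷ cs) + ψ′ (suc c ∷ cs) +_) (Δ-+ (ψ ∘ (c ∷_)) (ψ′ ∘ (c ∷_)) cs))
    (+-interchange (ψ (suc c ∷ cs)) _ _ _)

  Δ^-+ : ∀ n ψ ψ′ cs → Δ^ n (λ c → ψ c + ψ′ c) cs ≡ Δ^ n ψ cs + Δ^ n ψ′ cs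
  Δ^-+ zero ψ ψ′ cs = refl
  Δ^-+ (suc n) ψ ψ′ cs = trans (Δ-cong (Δ^-+ n ψ ψ′) cs) (Δ-+ (Δ^ n ψ) (Δ^ n ψ′) cs)

  Δ-const : ∀ k cs → Δ (λ _ → k) cs ≡ length cs * k
  Δ-const k [] = refl
  Δ-const k (c ∷ cs) = cong (k +_) (Δ-const k cs)

  Δ^-1 : ∀ n cs → Δ^ n (λ _ → 1) cs ≡ length cs ^ n
  Δ^-1 zero cs = refl
  Δ^-1 (suc n) cs = trans
    (Δ-cong-sum cs (λ cs′ p _ → trans (Δ^-1 n cs′) (cong (_^ n) p)))
    (Δ-const (length cs ^ n) cs)

  Δ^-0 : ∀ n cs → Δ^ n (λ _ → 0) cs ≡ 0
  Δ^-0 zero cs = refl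
  Δ^-0 (suc n) cs = trans (Δ-cong (Δ^-0 n) cs) (trans (Δ-const 0 cs) (ℕP.*-zeroʳ (length cs)))

  rot : List ℕ → List ℕ
  rot [] = []
  rot (c ∷ cs) = cs ∷ʳ c

  Δ-∷ʳ : ∀ ψ c cs → Δ ψ (cs ∷ʳ c) ≡ ψ (cs ∷ʳ suc c) + Δ (ψ ∘ (_∷ʳ c)) cs
  Δ-∷ʳ ψ c [] = refl
  Δ-∷ʳ ψ c (d ∷ cs) = trans (cong (ψ (suc d ∷ cs ∷ʳ c) +_) (Δ-∷ʳ (ψ ∘ (d ∷_)) c cs))
    (solve 3 (λ x y z → x :+ (y :+ z) := y :+ (x :+ z)) refl (ψ (suc d ∷ cs ∷ʳ c)) (ψ (d ∷ cs ∷ʳ suc c)) _)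
    where open +-*-Solver

  Δ-rot : ∀ ψ cs → Δ (ψ ∘ rot) cs ≡ Δ ψ (rot cs)
  Δ-rot ψ [] = refl
  Δ-rot ψ (c ∷ cs) = sym (Δ-∷ʳ ψ c cs)

  Δ^-rot : ∀ n ψ cs → Δ^ n (ψ ∘ rot) cs ≡ Δ^ n ψ (rot cs)
  Δ^-rot zero ψ cs = refl
  Δ^-rot (suc n) ψ cs = trans (Δ-cong (Δ^-rot n ψ) cs) (Δ-rot (Δ^ n ψ) cs)

  rot-zeros : ∀ m → rot (zeros m) ≡ zeros m
  rot-zeros zero = refl
  rot-zeros (suc zero) = refl
  rot-zeros (suc (suc m)) = cong (0 ∷_) (rot-zeros (suc m))

  rotations : ℕ → (List ℕ → ℕ) → List ℕ → ℕ
  rotations zero ψ cs = 0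
  rotations (suc k) ψ cs = ψ cs + rotations k ψ (rot cs)

  -- Throwing commutes with rotation and the empty boxes are invariant under it, so every rotation
  -- contributes the same sum.
  Δ^-rotations : ∀ n k ψ m → Δ^ n (rotations k ψ) (zeros m) ≡ k * Δ^ n ψ (zeros m)
  Δ^-rotations n zero ψ m = Δ^-0 n (zeros m)
  Δ^-rotations n (suc k) ψ m = trans (Δ^-+ n ψ (rotations k ψ ∘ rot) (zeros m))
    (cong (Δ^ n ψ (zeros m) +_) (trans (Δ^-rot n (rotations k ψ) (zeros m))
      (trans (cong (Δ^ n (rotations k ψ)) (rot-zeros m)) (Δ^-rotations n k ψ m))))

  𝟏 : Bool → ℕ
  𝟏 true = 1
  𝟏 false = 0

  positive : ℤ → Bool
  positive z = does (0ℤ <? z)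

  positive-true : ∀ {z} → 0ℤ <ᶻ z → positive z ≡ true
  positive-true {z} = dec-true (0ℤ <? z)

  positive-false : ∀ {z} → z ≤ᶻ 0ℤ → positive z ≡ false
  positive-false {z} h = dec-false (0ℤ <? z) (ℤP.≤⇒≯ h)

  module Boxes (l : ℕ) where

    e : ℕ → ℤ
    e c = pos c -ᶻ pos l

    D : List ℕ → ℤ
    D [] = 0ℤ
    D (c ∷ cs) = e c +ᶻ D cs

    -- The start z itself is not tested, which admits the start 0.
    positives : ℤ → List ℕ → Bool
    positives z [] = true
    positives z (c ∷ cs) = positive (z +ᶻ e c) ∧ positives (z +ᶻ e c) cs

    -- Whether z + e c₁ + ... + e cᵢ is positive for all i ≥ 1, and 1 in the end.
    φ : ℤ → List ℕ → ℕ
    φ z cs = 𝟏 (positives z cs ∧ does (z +ᶻ D cs ≟ 1ℤ))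

    φ-end : ∀ z cs → z +ᶻ D cs ≡ 1ℤ → φ z cs ≡ 𝟏 (positives z cs)
    φ-end z cs h = cong 𝟏 (trans (cong (positives z cs ∧_) (dec-true (z +ᶻ D cs ≟ 1ℤ) h)) (BP.∧-identityʳ _))

    φ-∷ : ∀ {z c z′} cs → z +ᶻ e c ≡ z′ → 0ℤ <ᶻ z′ → φ z (c ∷ cs) ≡ φ z′ cs
    φ-∷ {z} {c} {z′} cs refl p rewrite positive-true p | ℤP.+-assoc z (e c) (D cs) = refl

    φ-∷-zero : ∀ {z c z′} cs → z +ᶻ e c ≡ z′ → z′ ≤ᶻ 0ℤ → φ z (c ∷ cs) ≡ 0
    φ-∷-zero {z} {c} {z′} cs refl p rewrite positive-false p = refl

    -- A further ball in the first box raises all tested sums by one, just as a higher start does.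
    φ-shift : ∀ z c cs → φ z (suc c ∷ cs) ≡ φ (1ℤ +ᶻ z) (c ∷ cs)
    φ-shift z c cs = cong₂ (λ x y → 𝟏 ((positive x ∧ positives x cs) ∧ does (y ≟ 1ℤ))) step
      (trans (sym (ℤP.+-assoc z (e (suc c)) (D cs)))
        (trans (cong (_+ᶻ D cs) step) (ℤP.+-assoc (1ℤ +ᶻ z) (e c) (D cs))))
      where
      open ℤS.+-*-Solver
      step : z +ᶻ e (suc c) ≡ (1ℤ +ᶻ z) +ᶻ e c
      step = solve 3 (λ z c l → z :+ ((con 1ℤ :+ c) :- l) := (con 1ℤ :+ z) :+ (c :- l)) refl z (pos c) (pos l)

    Δ^-φ-shift : ∀ n z c cs → Δ^ n (φ z) (suc c ∷ cs) ≡ Δ^ n (φ (1ℤ +ᶻ z)) (c ∷ cs)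
    Δ^-φ-shift zero z c cs = φ-shift z c cs
    Δ^-φ-shift (suc n) z c cs = cong₂ _+_ (Δ^-φ-shift n z (suc c) cs) (Δ-cong (Δ^-φ-shift n z c) cs)

    D-++ : ∀ u v → D (u ++ v) ≡ D u +ᶻ D v
    D-++ [] v = sym (ℤP.+-identityˡ (D v))
    D-++ (c ∷ u) v = trans (cong (e c +ᶻ_) (D-++ u v)) (sym (ℤP.+-assoc (e c) (D u) (D v)))

    D-∷ʳ : ∀ u c → D (u ∷ʳ c) ≡ D u +ᶻ e c
    D-∷ʳ u c = trans (D-++ u (c ∷ [])) (cong (D u +ᶻ_) (ℤP.+-identityʳ (e c)))

    positives-++ : ∀ z u v → positives z (u ++ v) ≡ positives z u ∧ positives (z +ᶻ D u) v
    positives-++ z [] v = cong (λ x → positives x v) (sym (ℤP.+-identityʳ z))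
    positives-++ z (c ∷ u) v = trans
      (cong (positive (z +ᶻ e c) ∧_) (trans (positives-++ (z +ᶻ e c) u v)
        (cong (λ x → positives (z +ᶻ e c) u ∧ positives x v) (ℤP.+-assoc z (e c) (D u)))))
      (sym (BP.∧-assoc (positive (z +ᶻ e c)) _ _))

    positives-last : ∀ z c cs → positives z (c ∷ cs) ≡ true → 0ℤ <ᶻ z +ᶻ D (c ∷ cs)
    positives-last z c [] h with 0ℤ <? z +ᶻ e c
    ... | yes p = subst (0ℤ <ᶻ_) (cong (z +ᶻ_) (sym (ℤP.+-identityʳ (e c)))) p
    ... | no _ with () ← h
    positives-last z c (d ∷ cs) h with positive (z +ᶻ e c)
    ... | true = subst (0ℤ <ᶻ_) (ℤP.+-assoc z (e c) (D (d ∷ cs))) (positives-last (z +ᶻ e c) d cs h)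
    ... | false with () ← h

    -- k is the minimum of the partial sums of u, the empty one included.
    IsMin : List ℕ → ℤ → Set
    IsMin u k = ∀ z → 0ℤ <ᶻ z → positives z u ≡ positive (z +ᶻ k)

    positives-∷ʳ : ∀ z u c → positives z (u ∷ʳ c) ≡ positives z u ∧ positive (z +ᶻ (D u +ᶻ e c))
    positives-∷ʳ z u c = trans (positives-++ z u (c ∷ []))
      (cong (positives z u ∧_) (trans (BP.∧-identityʳ _) (cong positive (ℤP.+-assoc z (D u) (e c)))))

    isMin-keep : ∀ u {k} c → IsMin u k → k <ᶻ D u +ᶻ e c → IsMin (u ∷ʳ c) k
    isMin-keep u {k} c h k<x z p = trans (positives-∷ʳ z u c) (trans (cong (_∧ positive (z +ᶻ x)) (h z p)) absorb)
      where
      x = D u +ᶻ e c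
      absorb : positive (z +ᶻ k) ∧ positive (z +ᶻ x) ≡ positive (z +ᶻ k)
      absorb with 0ℤ <? z +ᶻ k
      ... | yes q = positive-true (ℤP.<-trans q (ℤP.+-monoʳ-< z k<x))
      ... | no _ = refl

    isMin-new : ∀ u {k} c → IsMin u k → D u +ᶻ e c ≤ᶻ k → IsMin (u ∷ʳ c) (D u +ᶻ e c)
    isMin-new u {k} c h x≤k z p = trans (positives-∷ʳ z u c) (trans (cong (_∧ positive (z +ᶻ x)) (h z p)) absorb)
      where
      x = D u +ᶻ e c
      absorb : positive (z +ᶻ k) ∧ positive (z +ᶻ x) ≡ positive (z +ᶻ x)
      absorb with 0ℤ <? z +ᶻ x
      ... | yes q = trans (BP.∧-identityʳ _) (positive-true (ℤP.<-≤-trans q (ℤP.+-monoʳ-≤ z x≤k)))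
      ... | no _ = BP.∧-zeroʳ _

    -- Among the rotations of a sequence with D = 1 exactly one has positive
    -- partial sums: the one starting after the last minimum of the partial sums.
    -- Here u ++ c ∷ v is the sequence, and the rotations starting in v are counted.
    cycle-step : ∀ c v u k → k ≤ᶻ 0ℤ → IsMin u k → D u +ᶻ D (c ∷ v) ≡ 1ℤ →
                 rotations (length v) (φ 0ℤ) (v ++ (u ∷ʳ c)) + 𝟏 (positives (D u -ᶻ k) (c ∷ v)) ≡ 1
    cycle-step c [] u k k≤0 min h = cong 𝟏 (trans (BP.∧-identityʳ _) (positive-true pf))
      where
      open ℤS.+-*-Solver
      eq : D u -ᶻ k +ᶻ e c ≡ 1ℤ +ᶻ -ᶻ k
      eq = trans (solve 3 (λ d k e → (d :- k) :+ e := (d :+ (e :+ con 0ℤ)) :+ :- k) refl (D u) k (e c))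
                 (cong (_+ᶻ -ᶻ k) h)
      pf : 0ℤ <ᶻ D u -ᶻ k +ᶻ e c
      pf = subst (0ℤ <ᶻ_) (sym eq) (ℤP.<-≤-trans (ℤ.+<+ (s≤s z≤n)) (ℤP.+-monoʳ-≤ 1ℤ (ℤP.neg-mono-≤ k≤0)))
    cycle-step c (d ∷ v) u k k≤0 min h = go (k <? x)
      where
      open ≡-Reasoning
      x = D u +ᶻ e c
      uc = u ∷ʳ c
      dv = d ∷ v
      D-sum : x +ᶻ D dv ≡ 1ℤ
      D-sum = trans (ℤP.+-assoc (D u) (e c) (D dv)) h
      D-dv : D dv ≡ 1ℤ -ᶻ x
      D-dv = trans (solve 2 (λ x y → y := (x :+ y) :- x) refl x (D dv)) (cong (_-ᶻ x) D-sum)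
        where open ℤS.+-*-Solver
      D-uc : D uc +ᶻ D dv ≡ 1ℤ
      D-uc = trans (cong (_+ᶻ D dv) (D-∷ʳ u c)) D-sum
      x-eq : D u -ᶻ k +ᶻ e c ≡ x -ᶻ k
      x-eq = solve 3 (λ d k e → (d :- k) :+ e := (d :+ e) :- k) refl (D u) k (e c)
        where open ℤS.+-*-Solver
      R = rotations (length v) (φ 0ℤ) (v ++ (uc ∷ʳ d))
      φ₀ : φ 0ℤ (dv ++ uc) ≡ 𝟏 (positives 0ℤ dv ∧ positives (D dv) uc)
      φ₀ = trans (φ-end 0ℤ (dv ++ uc) (trans (ℤP.+-identityˡ _) (trans (D-++ dv uc) (trans (ℤP.+-comm (D dv) (D uc)) D-uc))))
                 (cong 𝟏 (trans (positives-++ 0ℤ dv uc) (cong (λ z → positives 0ℤ dv ∧ positives z uc) (ℤP.+-identityˡ (D dv)))))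
      unfold : rotations (length dv) (φ 0ℤ) (dv ++ uc) ≡ φ 0ℤ (dv ++ uc) + R
      unfold = cong (λ w → φ 0ℤ (dv ++ uc) + rotations (length v) (φ 0ℤ) w) (LP.++-assoc v uc (d ∷ []))
      0<Ddv : positives 0ℤ dv ≡ true → 0ℤ <ᶻ D dv
      0<Ddv q = subst (0ℤ <ᶻ_) (ℤP.+-identityˡ (D dv)) (positives-last 0ℤ d v q)
      go : _ → rotations (length dv) (φ 0ℤ) (dv ++ uc) + 𝟏 (positives (D u -ᶻ k) (c ∷ dv)) ≡ 1
      go (yes k<x) = begin
        rotations (length dv) (φ 0ℤ) (dv ++ uc) + 𝟏 (positives (D u -ᶻ k) (c ∷ dv))
          ≡⟨ cong₂ _+_ (trans unfold (cong (_+ R) (trans φ₀ (cong 𝟏 fails)))) (cong 𝟏 first) ⟩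
        R + 𝟏 (positives (x -ᶻ k) dv)
          ≡⟨ cong (λ y → R + 𝟏 (positives (y -ᶻ k) dv)) (sym (D-∷ʳ u c)) ⟩
        R + 𝟏 (positives (D uc -ᶻ k) dv)
          ≡⟨ cycle-step d v uc k k≤0 (isMin-keep u c min k<x) D-uc ⟩
        1 ∎
        where
        0<x-k : 0ℤ <ᶻ x -ᶻ k
        0<x-k = subst (_<ᶻ x -ᶻ k) (ℤP.+-inverseʳ k) (ℤP.+-monoˡ-< (-ᶻ k) k<x)
        first : positives (D u -ᶻ k) (c ∷ dv) ≡ positives (x -ᶻ k) dv
        first rewrite x-eq = cong (_∧ positives (x -ᶻ k) dv) (positive-true 0<x-k)
        -- Started at `dv`, the sum is D dv = 1 - x at the return to the beginning of `uc` and falls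
        -- to 1 - x + k at the minimum, which is at most 0 because k < x.
        small : D dv +ᶻ k ≤ᶻ 0ℤ
        small = subst (_≤ᶻ 0ℤ) (sym (trans (cong (_+ᶻ k) D-dv)
                  (solve 2 (λ x k → (con 1ℤ :- x) :+ k := (con 1ℤ :+ k) :- x) refl x k)))
                  (ℤP.i≤j⇒i-j≤0 (ℤP.i<j⇒suc[i]≤j k<x))
          where open ℤS.+-*-Solver
        fails : positives 0ℤ dv ∧ positives (D dv) uc ≡ false
        fails with positives 0ℤ dv in eq
        ... | false = refl
        ... | true = trans (isMin-keep u c min k<x (D dv) (0<Ddv eq)) (positive-false small)
      go (no k≮x) = begin
        rotations (length dv) (φ 0ℤ) (dv ++ uc) + 𝟏 (positives (D u -ᶻ k) (c ∷ dv))
          ≡⟨ cong₂ _+_ (trans unfold (cong (_+ R) (trans φ₀ (cong 𝟏 holds)))) (cong 𝟏 first) ⟩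
        𝟏 (positives 0ℤ dv) + R + 0
          ≡⟨ trans (ℕP.+-identityʳ _) (ℕP.+-comm _ R) ⟩
        R + 𝟏 (positives 0ℤ dv)
          ≡⟨ cong (λ y → R + 𝟏 (positives y dv)) (sym (trans (cong (_-ᶻ x) (D-∷ʳ u c)) (ℤP.+-inverseʳ x))) ⟩
        R + 𝟏 (positives (D uc -ᶻ x) dv)
          ≡⟨ cycle-step d v uc x (ℤP.≤-trans x≤k k≤0) (isMin-new u c min x≤k) D-uc ⟩
        1 ∎
        where
        x≤k : x ≤ᶻ k
        x≤k = ℤP.≮⇒≥ k≮x
        first : positives (D u -ᶻ k) (c ∷ dv) ≡ false
        first rewrite x-eq = cong (_∧ positives (x -ᶻ k) dv) (positive-false (ℤP.i≤j⇒i-j≤0 x≤k))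
        one : D dv +ᶻ x ≡ 1ℤ
        one = trans (ℤP.+-comm (D dv) x) D-sum
        -- The minimum of `uc` is now its last partial sum x, where the rotation has total 1; so its
        -- second part stays positive whenever the first one does.
        holds : positives 0ℤ dv ∧ positives (D dv) uc ≡ positives 0ℤ dv
        holds with positives 0ℤ dv in eq
        ... | false = refl
        ... | true = trans (isMin-new u c min x≤k (D dv) (0<Ddv eq)) (cong positive one)

    cycle : ∀ c cs → D (c ∷ cs) ≡ 1ℤ → rotations (length (c ∷ cs)) (φ 0ℤ) (c ∷ cs) ≡ 1
    cycle c cs h = trans (ℕP.+-comm (φ 0ℤ (c ∷ cs)) _)
      (trans (cong (rotations (length cs) (φ 0ℤ) (cs ∷ʳ c) +_) (φ-end 0ℤ (c ∷ cs) (trans (ℤP.+-identityˡ _) h)))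
        (cycle-step c cs [] 0ℤ ℤP.≤-refl
          (λ z p → sym (trans (cong positive (ℤP.+-identityʳ z)) (positive-true p)))
          (trans (ℤP.+-identityˡ _) h)))

    D-sum : ∀ cs → D cs ≡ pos (sum cs) -ᶻ pos (length cs * l)
    D-sum [] = refl
    D-sum (c ∷ cs) = trans (cong (e c +ᶻ_) (D-sum cs))
      (solve 4 (λ c s l n → (c :- l) :+ (s :- n) := (c :+ s) :- (l :+ n)) refl
        (pos c) (pos (sum cs)) (pos l) (pos (length cs * l)))
      where open ℤS.+-*-Solver

    sum-zeros : ∀ m → sum (zeros m) ≡ 0
    sum-zeros zero = refl
    sum-zeros (suc m) = sum-zeros m

    -- Of the `suc m` rotations of any throw exactly one is counted by `φ 0ℤ`, and there are
    -- `suc m ^ n` throws. Cancelling `suc m` lowers the exponent n = `suc m * l` + 1 by one.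
    Δ^-φ₀ : ∀ m → Δ^ (suc (suc m * l)) (φ 0ℤ) (zeros (suc m)) ≡ suc m ^ (suc m * l)
    Δ^-φ₀ m = ℕP.*-cancelˡ-≡ _ _ (suc m) (begin
      suc m * Δ^ n (φ 0ℤ) (zeros (suc m))
        ≡⟨ sym (Δ^-rotations n (suc m) (φ 0ℤ) (suc m)) ⟩
      Δ^ n (rotations (suc m) (φ 0ℤ)) (zeros (suc m))
        ≡⟨ Δ^-cong-sum n (zeros (suc m)) one ⟩
      Δ^ n (λ _ → 1) (zeros (suc m))
        ≡⟨ Δ^-1 n (zeros (suc m)) ⟩
      length (zeros (suc m)) ^ n
        ≡⟨ cong (_^ n) (LP.length-replicate (suc m)) ⟩
      suc m ^ n ∎)
      where
      open ≡-Reasoning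
      n = suc (suc m * l)
      one : ∀ cs → length cs ≡ length (zeros (suc m)) → sum cs ≡ n + sum (zeros (suc m)) →
            rotations (suc m) (φ 0ℤ) cs ≡ 1
      one (c ∷ cs) p q = trans (cong (λ k → rotations k (φ 0ℤ) (c ∷ cs)) (sym len)) (cycle c cs total)
        where
        len : length (c ∷ cs) ≡ suc m
        len = trans p (LP.length-replicate (suc m))
        total : D (c ∷ cs) ≡ 1ℤ
        total = trans (D-sum (c ∷ cs)) (trans
          (cong₂ (λ s k → pos s -ᶻ pos (k * l)) (trans q (trans (cong (n +_) (sum-zeros m)) (ℕP.+-identityʳ n))) len)
          (solve 1 (λ x → (con 1ℤ :+ x) :- x := con 1ℤ) refl (pos (suc m * l))))
          where open ℤS.+-*-Solver

-- The zigzag word and its translation into balls and boxes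

module Zigzag where

  open Arrays
  open Series using (Ser; _⟨_⟩_)
  open RootedTrees
  open BallsInBoxes
  open import Data.Nat using (ℕ; zero; suc; s≤s; z≤n; _+_; _∸_; _*_; _^_; _≤_; _<_; _<?_)
  import Data.Nat.Properties as ℕP
  open import Data.Nat.Solver using (module +-*-Solver)
  open import Data.Integer using (0ℤ; 1ℤ) renaming (+_ to pos; _+_ to _+ᶻ_; _≤_ to _≤ᶻ_)
  import Data.Integer as ℤ
  import Data.Integer.Properties as ℤP
  import Data.Integer.Solver as ℤS
  open import Data.Bool using (Bool; true; false; not)
  open import Data.List using (List; []; _∷_; _++_; _∷ʳ_; map; replicate)
  import Data.List.Properties as LP
  open import Relation.Nullary using (yes; no)
  open import Function using (_∘_)
  open import Relation.Binary.PropositionalEquality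

  zigzag : ℕ → ℕ → List Bool
  zigzag l zero = []
  zigzag l (suc m) = replicate l true ++ replicate l false ++ zigzag l m

  map-not-replicate : ∀ l c → map not (replicate l c) ≡ replicate l (not c)
  map-not-replicate l c = LP.map-replicate not l c

  -- Prefixed with l ascents, this shows that removing the first and the last block of a zigzag
  -- leaves the next shorter one upside down.
  zigzag-end : ∀ l m → replicate l false ++ zigzag l m ≡ map not (zigzag l m) ++ replicate l false
  zigzag-end l zero = LP.++-identityʳ (replicate l false)
  zigzag-end l (suc m) = begin
    replicate l false ++ (replicate l true ++ replicate l false ++ zigzag l m)
      ≡⟨ cong (λ w → replicate l false ++ replicate l true ++ w) (zigzag-end l m) ⟩
    replicate l false ++ (replicate l true ++ map not (zigzag l m) ++ replicate l false)
      ≡⟨ cong₂ (λ x y → x ++ y ++ map not (zigzag l m) ++ replicate l false)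
           (sym (map-not-replicate l true)) (sym (map-not-replicate l false)) ⟩
    map not (replicate l true) ++ (map not (replicate l false) ++ map not (zigzag l m) ++ replicate l false)
      ≡⟨ cong (map not (replicate l true) ++_) (sym (LP.++-assoc (map not (replicate l false)) _ _)) ⟩
    map not (replicate l true) ++ ((map not (replicate l false) ++ map not (zigzag l m)) ++ replicate l false)
      ≡⟨ cong (λ w → map not (replicate l true) ++ w ++ replicate l false) (sym (LP.map-++ not (replicate l false) _)) ⟩
    map not (replicate l true) ++ (map not (replicate l false ++ zigzag l m) ++ replicate l false)
      ≡⟨ sym (LP.++-assoc (map not (replicate l true)) _ _) ⟩
    (map not (replicate l true) ++ map not (replicate l false ++ zigzag l m)) ++ replicate l false
      ≡⟨ cong (_++ replicate l false) (sym (LP.map-++ not (replicate l true) _)) ⟩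
    map not (zigzag l (suc m)) ++ replicate l false ∎
    where open ≡-Reasoning

  above-true : ∀ l k w → Above (l + k) w → Above k (replicate l true ++ w)
  above-true zero k w h = h
  above-true (suc l) k w h = above-true l (suc k) w (subst (λ i → Above i w) (sym (ℕP.+-suc l k)) h)

  above-false : ∀ l k w → Above k w → Above (l + k) (replicate l false ++ w)
  above-false zero k w h = h
  above-false (suc l) k w h = above-false l k w h

  above-zigzag : ∀ l m → Above 0 (zigzag l m)
  above-zigzag l zero = refl
  above-zigzag l (suc m) = above-true l 0 _ (above-false l 0 (zigzag l m) (above-zigzag l m))

  module Counting (F : Ser) (F-[] : F [] ≈ 𝟙)
                  (F-∷ : ∀ c w → F (c ∷ w) ≈ ((int c ∘ F) ⟨ not c ⟩ F) w) where

    open WithF F F-[] F-∷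

    M-true^ : ∀ l n w a → M (l + n) (replicate l true ++ w) a 0 ≡ M n w a 0
    M-true^ zero n w a = refl
    M-true^ (suc l) n w a = trans (M-true (l + n) (replicate l true ++ w) a) (M-true^ l n w a)

    M-true^-zero : ∀ {l n} w a → n < l → M n (replicate l true ++ w) a 0 ≡ 0ℤ
    M-true^-zero {suc l} {zero} w a h = F-true-vanish (replicate l true ++ w) a
    M-true^-zero {suc l} {suc n} w a (s≤s h) = trans (M-true n (replicate l true ++ w) a) (M-true^-zero w a h)

    replicate-∷ʳ : ∀ l w → w ++ replicate (suc l) false ≡ (w ++ replicate l false) ∷ʳ false
    replicate-∷ʳ l w = trans (cong (w ++_) (go l)) (sym (LP.++-assoc w (replicate l false) (false ∷ [])))
      where
      go : ∀ l → replicate (suc l) false ≡ replicate l false ∷ʳ false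
      go zero = refl
      go (suc l) = cong (false ∷_) (go l)

    M-false^ : ∀ l n w a → M (l + n) (w ++ replicate l false) a 0 ≡ M n w a 0
    M-false^ zero n w a = cong (λ v → M n v a 0) (LP.++-identityʳ w)
    M-false^ (suc l) n w a = trans (cong (λ v → M (suc l + n) v a 0) (replicate-∷ʳ l w))
      (trans (M-false (l + n) (w ++ replicate l false) a) (M-false^ l n w a))

    M-false^-zero : ∀ {l n} w a → n < l → M n (w ++ replicate l false) a 0 ≡ 0ℤ
    M-false^-zero {suc l} {zero} w a h = trans (cong (λ v → F v a 0) (replicate-∷ʳ l w)) (F-false-vanish _ a)
    M-false^-zero {suc l} {suc n} w a (s≤s h) = trans (cong (λ v → M (suc n) v a 0) (replicate-∷ʳ l w))
      (trans (M-false n (w ++ replicate l false) a) (M-false^-zero w a h))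

    module _ (l : ℕ) where

      open Boxes l

      -- The j-th derivative of the polynomial of the zigzag, up to its sign.
      q : ℕ → ℕ → Array
      q m j = M (j * 2) (zigzag l m)

      q-suc : ∀ m j a b → q m j a (suc b) ≡ q m j (suc a) b +ᶻ q m (suc j) a b
      q-suc m j a b = M-∂-above (j * 2) (zigzag l m) (above-zigzag l m) a b

      -- At b = 0 the l leading and the l trailing letters must all be deleted, and 2j deletions are
      -- too few.
      q-low : ∀ m j a → j < l → q (suc m) j a 0 ≡ 0ℤ
      q-low m j a j<l with j * 2 <? l
      -- Here the deletions do not even cover the leading block.
      ... | yes h = M-true^-zero _ a h
      ... | no h = begin
        M (j * 2) (zigzag l (suc m)) a 0
          ≡⟨ cong₂ (λ n w → M n (replicate l true ++ w) a 0) (sym (ℕP.m+[n∸m]≡n l≤2j)) (zigzag-end l m) ⟩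
        M (l + i) (replicate l true ++ map not (zigzag l m) ++ replicate l false) a 0
          ≡⟨ M-true^ l i _ a ⟩
        M i (map not (zigzag l m) ++ replicate l false) a 0
          ≡⟨ M-false^-zero (map not (zigzag l m)) a i<l ⟩
        0ℤ ∎
        where
        open ≡-Reasoning
        l≤2j = ℕP.≮⇒≥ h
        i = j * 2 ∸ l
        2j<2l : j * 2 < l + l
        2j<2l = subst₂ _<_ (ℕP.*-comm 2 j) (cong (l +_) (ℕP.+-identityʳ l)) (ℕP.*-monoʳ-< 2 j<l)
        i<l : i < l
        i<l = ℕP.+-cancelˡ-< l i l (subst (_< l + l) (sym (ℕP.m+[n∸m]≡n l≤2j)) 2j<2l)

      -- Of the 2(l + j) deletions 2l are forced. The others take place in an upside-down zigzag,
      -- which turns the a points below the root into points above it.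
      q-high : ∀ m j a → q (suc m) (l + j) a 0 ≡ q m j 0 a
      q-high m j a = begin
        M ((l + j) * 2) (zigzag l (suc m)) a 0
          ≡⟨ cong₂ (λ n w → M n (replicate l true ++ w) a 0) index (zigzag-end l m) ⟩
        M (l + (l + j * 2)) (replicate l true ++ map not (zigzag l m) ++ replicate l false) a 0
          ≡⟨ M-true^ l (l + j * 2) _ a ⟩
        M (l + j * 2) (map not (zigzag l m) ++ replicate l false) a 0
          ≡⟨ M-false^ l (j * 2) (map not (zigzag l m)) a ⟩
        M (j * 2) (map not (zigzag l m)) a 0
          ≡⟨ M-swap (j * 2) (zigzag l m) a 0 ⟩
        M (j * 2) (zigzag l m) 0 a ∎
        where
        open ≡-Reasoning
        index : (l + j) * 2 ≡ l + (l + j * 2)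
        index = solve 2 (λ l j → (l :+ j) :* con 2 := l :+ (l :+ j :* con 2)) refl l j
          where open +-*-Solver

      -- The b balls may land in any box, including the new empty one in front, whereas the balls of
      -- a surrounding `Δ^ a` reach only the boxes of `cs`.
      box : ℕ → ℕ → List ℕ → ℕ
      box z b cs = Δ^ b (φ (pos z)) (0 ∷ cs)

      box-suc : ∀ z b cs → box z (suc b) cs ≡ box (suc z) b cs + Δ (box z b) cs
      box-suc z b cs = cong (_+ Δ (box z b) cs) (Δ^-φ-shift b (pos z) 0 cs)

      Δ^-box-suc : ∀ z a b cs → Δ^ a (box z (suc b)) cs ≡ Δ^ (suc a) (box z b) cs + Δ^ a (box (suc z) b) cs
      Δ^-box-suc z a b cs = begin
        Δ^ a (box z (suc b)) cs
          ≡⟨ Δ^-cong a (box-suc z b) cs ⟩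
        Δ^ a (λ cs → box (suc z) b cs + Δ (box z b) cs) cs
          ≡⟨ Δ^-+ a (box (suc z) b) (Δ (box z b)) cs ⟩
        Δ^ a (box (suc z) b) cs + Δ^ a (Δ (box z b)) cs
          ≡⟨ ℕP.+-comm (Δ^ a (box (suc z) b) cs) _ ⟩
        Δ^ a (Δ (box z b)) cs + Δ^ a (box (suc z) b) cs
          ≡⟨ cong (_+ Δ^ a (box (suc z) b) cs) (Δ^-Δ a (box z b) cs) ⟩
        Δ^ (suc a) (box z b) cs + Δ^ a (box (suc z) b) cs ∎
        where open ≡-Reasoning

      e-step : ∀ z j → z ≡ l + j → pos (suc z) +ᶻ e 0 ≡ pos (suc j)
      e-step z j refl = solve 2 (λ l j → (con 1ℤ :+ (l :+ j)) :+ (con 0ℤ :- l) := con 1ℤ :+ j) refl (pos l) (pos j)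
        where open ℤS.+-*-Solver

      e-low : ∀ z → z ≤ l → pos z +ᶻ e 0 ≤ᶻ 0ℤ
      e-low z h = subst (_≤ᶻ 0ℤ) (cong (pos z +ᶻ_) (sym (ℤP.+-identityˡ (ℤ.- pos l)))) (ℤP.i≤j⇒i-j≤0 (ℤ.+≤+ h))

      box-low : ∀ z a cs → z ≤ l → Δ^ a (box z 0) cs ≡ 0
      box-low z a cs h = trans (Δ^-cong a (λ cs → φ-∷-zero {pos z} {0} cs refl (e-low z h)) cs) (Δ^-0 a cs)

      -- Both sides satisfy the same recursion in b, which is the rule by which a
      -- further ball lands in the first box or not; at b = 0 the first box is
      -- discarded, and q-low and q-high do the same for the first block.
      q-boxes : ∀ m j a b → q (suc m) j a b ≡ pos (Δ^ a (box (suc j) b) (zeros m))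
      q-front : ∀ m j b → q m j 0 b ≡ pos (Δ^ b (φ (pos (suc j))) (zeros m))
      q-boxes m j a (suc b) = trans (q-suc (suc m) j a b)
        (trans (cong₂ _+ᶻ_ (q-boxes m j (suc a) b) (q-boxes m (suc j) a b))
          (cong pos (sym (Δ^-box-suc (suc j) a b (zeros m)))))
      q-boxes m j a zero with j <? l
      ... | yes h = trans (q-low m j a h) (cong pos (sym (box-low (suc j) a (zeros m) h)))
      ... | no h = trans (subst (λ i → q (suc m) i a 0 ≡ q m j′ 0 a) (ℕP.m+[n∸m]≡n l≤j) (q-high m j′ a))
        (trans (q-front m j′ a) (cong pos (Δ^-cong a (λ cs → sym
          (φ-∷ {pos (suc j)} {0} cs (e-step j j′ (sym (ℕP.m+[n∸m]≡n l≤j))) (ℤ.+<+ (s≤s z≤n)))) (zeros m))))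
        where
        l≤j = ℕP.≮⇒≥ h
        j′ = j ∸ l
      -- For a = 0 every ball may use the first box, and `zeros (suc m)` is `0 ∷ zeros m`.
      q-front (suc m) j b = q-boxes m j 0 b
      -- Without boxes no ball can be thrown and `φ` requires the start to be 1, so j = 0 and b = 0;
      -- this is the array `𝟙` of the empty word.
      q-front zero zero zero = F-[] 0 0
      q-front zero zero (suc b) = F-[] 0 (suc b)
      q-front zero (suc j) zero = refl
      q-front zero (suc j) (suc b) = refl

      -- Integration extends the family to the start 0: `up` obeys the recursion of `box 0` in b,
      -- with `box 1` as its inhomogeneous term, and both vanish at b = 0.
      up-q : ∀ m a b → up (q (suc m) 0) a b ≡ pos (Δ^ a (box 0 b) (zeros m))
      up-q m a zero = cong pos (sym (box-low 0 a (zeros m) z≤n))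
      up-q m a (suc b) = trans (cong₂ _+ᶻ_ (q-boxes m 0 a b) (up-q m (suc a) b))
        (cong pos (trans (ℕP.+-comm (Δ^ a (box 1 b) (zeros m)) _) (sym (Δ^-box-suc 0 a b (zeros m)))))

      up-zigzag : ∀ m → up (F (zigzag l (suc m))) 0 (suc (suc m * l)) ≡ pos (suc m ^ (suc m * l))
      up-zigzag m = trans (up-q m 0 (suc (suc m * l))) (cong pos (Δ^-φ₀ m))

-- Lists of labelled plane trees with a given word

module Enumeration where

  open Arrays
  open Series
  open RootedTrees
  open import Data.Nat using (ℕ; zero; suc; s≤s; _+_; _*_; _≤_; _<_; _<ᵇ_)
  import Data.Nat.Properties as ℕP
  open import Data.Integer using () renaming (+_ to pos; _+_ to _+ᶻ_; _*_ to _*ᶻ_)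
  import Data.Integer.Properties as ℤP
  open import Data.Bool using (Bool; true; false; not; T)
  open import Data.List using (List; []; _∷_; _++_; _ʳ++_; length; map; cartesianProduct)
  import Data.List.Properties as LP
  open import Data.List.Membership.Propositional using (_∈_; _∉_)
  open import Data.List.Membership.Propositional.Properties
  open import Data.List.Relation.Unary.Any using (here; there)
  open import Data.List.Relation.Unary.All as All using (All; []; _∷_)
  import Data.List.Relation.Unary.All.Properties as All
  open import Data.List.Relation.Unary.AllPairs as AllPairs using (AllPairs; []; _∷_)
  open import Data.List.Relation.Unary.Unique.Propositional using (Unique)
  import Data.List.Relation.Unary.Unique.Propositional.Properties as Unique
  open import Data.List.Relation.Binary.Permutation.Propositional using (_↭_; prep; ↭-refl; ↭-reflexive; ↭-sym; ↭-trans; ↭⇒↭ₛ)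
  import Data.List.Relation.Binary.Permutation.Setoid.Properties as Permutationₛ
  open import Data.List.Relation.Binary.Permutation.Propositional.Properties
  open import Data.List.Relation.Binary.Sublist.Propositional using (_⊆_; []; _∷_; _∷ʳ_; ⊆-refl)
  open import Data.List.Relation.Binary.Sublist.Propositional.Properties using (All-resp-⊆; ʳ++⁺)
  open import Data.Product using (_×_; _,_; proj₁; proj₂; ∃)
  open import Data.Sum using (_⊎_; inj₁; inj₂)
  open import Data.Empty using (⊥-elim)
  open import Function using (_∘_; flip)
  open import Relation.Nullary using (¬_)
  open import Relation.Binary.PropositionalEquality hiding ([_])

  -- A plane forest with labelled vertices, given by the label and the children of
  -- its first root and the remaining trees. A root x turns it into a plane tree.
  data Forest : Set where
    nil : Forest
    node : ℕ → Forest → Forest → Forest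

  labels : Forest → List ℕ
  labels nil = []
  labels (node y u v) = y ∷ labels u ++ labels v

  -- The walk around the tree; true marks a step to a larger label.
  word : ℕ → Forest → List Bool
  word x nil = []
  word x (node y u v) = (x <ᵇ y) ∷ word y u ++ not (x <ᵇ y) ∷ word x v

  -- Enumerations of structures on a label set that is split at a root: the labels
  -- below it, in decreasing order, and the labels above it, in increasing order.
  Enum : Set → Set
  Enum X = List ℕ → List ℕ → List X

  -- This and the next operations follow `⊗`, `up`, `int` and `_⟨_⟩_` clause by clause, so their
  -- lengths are the corresponding arrays.
  conv : ∀ {X Y} → Enum X → Enum Y → Enum (X × Y)
  conv f g [] [] = cartesianProduct (f [] []) (g [] [])
  conv f g [] (y ∷ A) = conv (λ B A → f B (y ∷ A)) g [] A ++ conv f (λ B A → g B (y ∷ A)) [] A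
  conv f g (y ∷ B) A = conv (λ B → f (y ∷ B)) g B A ++ conv f (λ B → g (y ∷ B)) B A

  upE : ∀ {X} → (ℕ → Enum X) → Enum (ℕ × X)
  upE f B [] = []
  upE f B (y ∷ A) = map (y ,_) (f y B A) ++ upE f (y ∷ B) A

  intE : ∀ {X} → Bool → (ℕ → Enum X) → Enum (ℕ × X)
  intE true f = upE f
  intE false f = flip (upE (flip ∘ f))

  pick : ∀ {X : Set} → Bool → Bool → List X → List X
  pick true true xs = xs
  pick true false xs = []
  pick false true xs = []
  pick false false xs = xs

  splE : ∀ {X Y} → (List Bool → Enum X) → Bool → (List Bool → Enum Y) → List Bool → Enum (X × Y)
  splE Φ c Ψ [] B A = []
  splE Φ c Ψ (d ∷ w) B A = pick c d (conv (Φ []) (Ψ w) B A) ++ splE (Φ ∘ (d ∷_)) c Ψ w B A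

  build : (ℕ × Forest) × Forest → Forest
  build ((y , u) , v) = node y u v

  -- The first argument bounds the depth of the recursion.
  forests : ℕ → ℕ → List Bool → Enum Forest
  forests zero x w B A = []
  forests (suc n) x [] [] [] = nil ∷ []
  forests (suc n) x [] [] (_ ∷ _) = []
  forests (suc n) x [] (_ ∷ _) A = []
  forests (suc n) x (s ∷ w) B A =
    map build (splE (λ u → intE s (λ y → forests n y u)) (not s) (forests n x) w B A)

  Counts : ∀ {X} → Enum X → Array → Set
  Counts f f′ = ∀ B A → pos (length (f B A)) ≡ f′ (length B) (length A)

  length-++ᶻ : ∀ {X : Set} (xs : List X) {ys} → pos (length (xs ++ ys)) ≡ pos (length xs) +ᶻ pos (length ys)
  length-++ᶻ xs = cong pos (LP.length-++ xs)

  length-cartesianProduct : ∀ {X Y : Set} (xs : List X) (ys : List Y) →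
                            length (cartesianProduct xs ys) ≡ length xs * length ys
  length-cartesianProduct [] ys = refl
  length-cartesianProduct (x ∷ xs) ys = trans (LP.length-++ (map (x ,_) ys))
    (cong₂ _+_ (LP.length-map (x ,_) ys) (length-cartesianProduct xs ys))

  conv-counts : ∀ {X Y} {f : Enum X} {g : Enum Y} {f′ g′} → Counts f f′ → Counts g g′ → Counts (conv f g) (f′ ⊗ g′)
  conv-counts {f = f} {g} p q [] [] = trans (cong pos (length-cartesianProduct (f [] []) (g [] [])))
    (trans (ℤP.pos-* (length (f [] [])) _) (cong₂ _*ᶻ_ (p [] []) (q [] [])))
  conv-counts p q [] (y ∷ A) = trans (length-++ᶻ (conv _ _ [] A))
    (cong₂ _+ᶻ_ (conv-counts (λ B A → p B (y ∷ A)) q [] A) (conv-counts p (λ B A → q B (y ∷ A)) [] A))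
  conv-counts p q (y ∷ B) A = trans (length-++ᶻ (conv _ _ B A))
    (cong₂ _+ᶻ_ (conv-counts (λ B → p (y ∷ B)) q B A) (conv-counts p (λ B → q (y ∷ B)) B A))

  upE-counts : ∀ {X} {f : ℕ → Enum X} {f′} → (∀ y → Counts (f y) f′) → Counts (upE f) (up f′)
  upE-counts p B [] = refl
  upE-counts {f = f} p B (y ∷ A) = trans (length-++ᶻ (map (y ,_) (f y B A)))
    (cong₂ _+ᶻ_ (trans (cong pos (LP.length-map (y ,_) (f y B A))) (p y B A)) (upE-counts p (y ∷ B) A))

  intE-counts : ∀ s {X} {f : ℕ → Enum X} {f′} → (∀ y → Counts (f y) f′) → Counts (intE s f) (int s f′)
  intE-counts true p = upE-counts p
  intE-counts false p B A = upE-counts (λ y B A → p y A B) A B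

  splE-counts : ∀ {X Y} {Φ : List Bool → Enum X} {c} {Ψ : List Bool → Enum Y} {Φ′ Ψ′} →
                (∀ w → Counts (Φ w) (Φ′ w)) → (∀ w → Counts (Ψ w) (Ψ′ w)) →
                ∀ w → Counts (splE Φ c Ψ w) ((Φ′ ⟨ c ⟩ Ψ′) w)
  splE-counts p q [] B A = refl
  splE-counts {Φ = Φ} {c} {Ψ} {Φ′} {Ψ′} p q (d ∷ w) B A = trans (length-++ᶻ (pick c d (conv (Φ []) (Ψ w) B A)))
    (cong₂ _+ᶻ_ (picked c d) (splE-counts (p ∘ (d ∷_)) q w B A))
    where
    picked : ∀ c d → pos (length (pick c d (conv (Φ []) (Ψ w) B A))) ≡ κ c d *ᶻ (Φ′ [] ⊗ Ψ′ w) (length B) (length A)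
    picked true true = trans (conv-counts (p []) (q w) B A) (sym (ℤP.*-identityˡ _))
    picked true false = refl
    picked false true = refl
    picked false false = trans (conv-counts (p []) (q w) B A) (sym (ℤP.*-identityˡ _))

  Fₙ : ℕ → Ser
  Fₙ zero w = 𝟘
  Fₙ (suc n) [] = 𝟙
  Fₙ (suc n) (s ∷ w) = ((int s ∘ Fₙ n) ⟨ not s ⟩ Fₙ n) w

  forests-counts : ∀ n x w → Counts (forests n x w) (Fₙ n w)
  forests-counts zero x w B A = refl
  forests-counts (suc n) x [] [] [] = refl
  forests-counts (suc n) x [] [] (_ ∷ _) = refl
  forests-counts (suc n) x [] (_ ∷ _) A = refl
  forests-counts (suc n) x (s ∷ w) B A =
    trans (cong pos (LP.length-map build (splE (λ u → intE s (λ y → forests n y u)) (not s) (forests n x) w B A)))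
      (splE-counts {Φ = λ u → intE s (λ y → forests n y u)} {Φ′ = int s ∘ Fₙ n}
        (λ u → intE-counts s (λ y → forests-counts n y u)) (forests-counts n x) w B A)

  -- In the recursion for `F` the words u and v come with smaller depth bounds of their own, so
  -- sufficiently large bounds must give equal values.
  Fₙ-stable : ∀ m n w → length w < m → length w < n → Fₙ m w ≈ Fₙ n w
  Fₙ-stable (suc m) (suc n) [] p q a b = refl
  Fₙ-stable (suc m) (suc n) (s ∷ w) (s≤s p) (s≤s q) =
    ⟨⟩-ext {Φ = int s ∘ Fₙ m} {Φ′ = int s ∘ Fₙ n} {Ψ = Fₙ m} {Ψ′ = Fₙ n} w stable
    where
    stable : ∀ u v → w ≡ u ++ not s ∷ v → int s (Fₙ m u) ⊗ Fₙ m v ≈ int s (Fₙ n u) ⊗ Fₙ n v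
    stable u v refl = ⊗-cong
      (int-cong s (Fₙ-stable m n u (ℕP.≤-trans (proj₁ h) p) (ℕP.≤-trans (proj₁ h) q)))
      (Fₙ-stable m n v (ℕP.≤-trans (ℕP.m<n⇒m<1+n (proj₂ h)) p) (ℕP.≤-trans (ℕP.m<n⇒m<1+n (proj₂ h)) q))
      where h = prefix-< u (not s) v ℕP.≤-refl

  F : Ser
  F w = Fₙ (suc (length w)) w

  F-[] : F [] ≈ 𝟙
  F-[] a b = refl

  F-∷ : ∀ c w → F (c ∷ w) ≈ ((int c ∘ F) ⟨ not c ⟩ F) w
  F-∷ c w = ⟨⟩-ext {Φ = int c ∘ Fₙ (suc (length w))} {Φ′ = int c ∘ F} {Ψ = Fₙ (suc (length w))} {Ψ′ = F} w stable
    where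
    stable : ∀ u v → w ≡ u ++ not c ∷ v → _
    stable u v refl = ⊗-cong
      (int-cong c (Fₙ-stable _ (suc (length u)) u (proj₁ h) ℕP.≤-refl))
      (Fₙ-stable _ (suc (length v)) v (ℕP.m<n⇒m<1+n (proj₂ h)) ℕP.≤-refl)
      where h = prefix-< u (not c) v ℕP.≤-refl

  -- Deal B A B₁ A₁ B₂ A₂: one of the ways in which conv splits B and A.
  data Deal : (B A B₁ A₁ B₂ A₂ : List ℕ) → Set where
    done : Deal [] [] [] [] [] []
    A-left : ∀ {A B₁ A₁ B₂ A₂} y → Deal [] A B₁ A₁ B₂ A₂ → Deal [] (y ∷ A) B₁ (y ∷ A₁) B₂ A₂
    A-right : ∀ {A B₁ A₁ B₂ A₂} y → Deal [] A B₁ A₁ B₂ A₂ → Deal [] (y ∷ A) B₁ A₁ B₂ (y ∷ A₂)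
    B-left : ∀ {B A B₁ A₁ B₂ A₂} y → Deal B A B₁ A₁ B₂ A₂ → Deal (y ∷ B) A (y ∷ B₁) A₁ B₂ A₂
    B-right : ∀ {B A B₁ A₁ B₂ A₂} y → Deal B A B₁ A₁ B₂ A₂ → Deal (y ∷ B) A B₁ A₁ (y ∷ B₂) A₂

  conv-∈⁻ : ∀ {X Y} (f : Enum X) (g : Enum Y) B A {x y} → (x , y) ∈ conv f g B A →
            ∃ λ B₁ → ∃ λ A₁ → ∃ λ B₂ → ∃ λ A₂ → Deal B A B₁ A₁ B₂ A₂ × x ∈ f B₁ A₁ × y ∈ g B₂ A₂
  conv-∈⁻ f g [] [] h = _ , _ , _ , _ , done , ∈-cartesianProduct⁻ (f [] []) (g [] []) h
  conv-∈⁻ f g [] (z ∷ A) h with ∈-++⁻ (conv (λ B A → f B (z ∷ A)) g [] A) h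
  ... | inj₁ p = let _ , _ , _ , _ , d , r = conv-∈⁻ _ g [] A p in _ , _ , _ , _ , A-left z d , r
  ... | inj₂ p = let _ , _ , _ , _ , d , r = conv-∈⁻ f _ [] A p in _ , _ , _ , _ , A-right z d , r
  conv-∈⁻ f g (z ∷ B) A h with ∈-++⁻ (conv (λ B → f (z ∷ B)) g B A) h
  ... | inj₁ p = let _ , _ , _ , _ , d , r = conv-∈⁻ _ g B A p in _ , _ , _ , _ , B-left z d , r
  ... | inj₂ p = let _ , _ , _ , _ , d , r = conv-∈⁻ f _ B A p in _ , _ , _ , _ , B-right z d , r

  conv-∈⁺ : ∀ {X Y} (f : Enum X) (g : Enum Y) {B A B₁ A₁ B₂ A₂ x y} → Deal B A B₁ A₁ B₂ A₂ →
            x ∈ f B₁ A₁ → y ∈ g B₂ A₂ → (x , y) ∈ conv f g B A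
  conv-∈⁺ f g done p q = ∈-cartesianProduct⁺ p q
  conv-∈⁺ f g (A-left z d) p q = ∈-++⁺ˡ (conv-∈⁺ _ g d p q)
  conv-∈⁺ f g (A-right {A} z d) p q = ∈-++⁺ʳ (conv (λ B A → f B (z ∷ A)) g [] A) (conv-∈⁺ f _ d p q)
  conv-∈⁺ f g (B-left z d) p q = ∈-++⁺ˡ (conv-∈⁺ _ g d p q)
  conv-∈⁺ f g (B-right {B} {A} z d) p q = ∈-++⁺ʳ (conv (λ B → f (z ∷ B)) g B A) (conv-∈⁺ f _ d p q)

  -- For decreasing B and increasing A, all of B below A, `B ʳ++ A` is the increasing list of all
  -- labels; a root x has its place between the two.
  ʳ++-shift : ∀ y (B A : List ℕ) → B ʳ++ (y ∷ A) ↭ y ∷ (B ʳ++ A)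
  ʳ++-shift y B A = ↭-trans (↭-sym (++↭ʳ++ B (y ∷ A))) (↭-trans (shift y B A) (prep y (++↭ʳ++ B A)))

  deal-⊆ : ∀ {B A B₁ A₁ B₂ A₂} → Deal B A B₁ A₁ B₂ A₂ → (B₁ ⊆ B × A₁ ⊆ A) × (B₂ ⊆ B × A₂ ⊆ A)
  deal-⊆ done = ([] , []) , ([] , [])
  deal-⊆ (A-left y d) = let (p , q) , (r , s) = deal-⊆ d in (p , refl ∷ q) , (r , y ∷ʳ s)
  deal-⊆ (A-right y d) = let (p , q) , (r , s) = deal-⊆ d in (p , y ∷ʳ q) , (r , refl ∷ s)
  deal-⊆ (B-left y d) = let (p , q) , (r , s) = deal-⊆ d in (refl ∷ p , q) , (y ∷ʳ r , s)
  deal-⊆ (B-right y d) = let (p , q) , (r , s) = deal-⊆ d in (y ∷ʳ p , q) , (refl ∷ r , s)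

  deal-↭ : ∀ {B A B₁ A₁ B₂ A₂} → Deal B A B₁ A₁ B₂ A₂ → (B₁ ʳ++ A₁) ++ (B₂ ʳ++ A₂) ↭ B ʳ++ A
  deal-↭ done = ↭-refl
  deal-↭ (A-left {A} {B₁} {A₁} {B₂} {A₂} y d) = ↭-trans (++⁺ʳ (B₂ ʳ++ A₂) (ʳ++-shift y B₁ A₁)) (prep y (deal-↭ d))
  deal-↭ (A-right {A} {B₁} {A₁} {B₂} {A₂} y d) = ↭-trans (++⁺ˡ (B₁ ʳ++ A₁) (ʳ++-shift y B₂ A₂))
    (↭-trans (shift y (B₁ ʳ++ A₁) (B₂ ʳ++ A₂)) (prep y (deal-↭ d)))
  deal-↭ (B-left {B} {A} {B₁} {A₁} {B₂} {A₂} y d) = ↭-trans (++⁺ʳ (B₂ ʳ++ A₂) (ʳ++-shift y B₁ A₁))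
    (↭-trans (prep y (deal-↭ d)) (↭-sym (ʳ++-shift y B A)))
  deal-↭ (B-right {B} {A} {B₁} {A₁} {B₂} {A₂} y d) = ↭-trans (++⁺ˡ (B₁ ʳ++ A₁) (ʳ++-shift y B₂ A₂))
    (↭-trans (shift y (B₁ ʳ++ A₁) (B₂ ʳ++ A₂)) (↭-trans (prep y (deal-↭ d)) (↭-sym (ʳ++-shift y B A))))

  extract : ∀ {y : ℕ} {xs} → y ∈ xs → ∃ λ ys → xs ↭ y ∷ ys
  extract {y} h with ys , zs , refl ← ∈-∃++ h = ys ++ zs , shift y ys zs

  extract-++ : ∀ {y : ℕ} L₁ L₂ {L} → L₁ ++ L₂ ↭ y ∷ L →
               (∃ λ L′ → L₁ ↭ y ∷ L′ × L′ ++ L₂ ↭ L) ⊎ (∃ λ L′ → L₂ ↭ y ∷ L′ × L₁ ++ L′ ↭ L)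
  extract-++ {y} L₁ L₂ h with ∈-++⁻ L₁ (∈-resp-↭ (↭-sym h) (here refl))
  ... | inj₁ p = let L′ , q = extract p in inj₁ (L′ , q , drop-∷ (↭-trans (++⁺ʳ L₂ (↭-sym q)) h))
  ... | inj₂ p = let L′ , q = extract p in inj₂ (L′ , q , drop-∷ (↭-trans
        (↭-trans (↭-sym (shift y L₁ L′)) (++⁺ˡ L₁ (↭-sym q))) h))

  ++-↭-[] : ∀ (L₁ L₂ : List ℕ) → L₁ ++ L₂ ↭ [] → L₁ ≡ [] × L₂ ≡ []
  ++-↭-[] L₁ L₂ h = LP.++-conicalˡ L₁ L₂ (↭-empty-inv h) , LP.++-conicalʳ L₁ L₂ (↭-empty-inv h)

  -- Completeness needs every distribution of the labels between the first subtree and the rest. The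
  -- labels are handed out in the order in which `conv` reads them, each to the side where it
  -- occurs.
  deal : ∀ B A L₁ L₂ → L₁ ++ L₂ ↭ B ʳ++ A →
         ∃ λ B₁ → ∃ λ A₁ → ∃ λ B₂ → ∃ λ A₂ → Deal B A B₁ A₁ B₂ A₂ × L₁ ↭ B₁ ʳ++ A₁ × L₂ ↭ B₂ ʳ++ A₂
  deal [] [] L₁ L₂ h with refl , refl ← ++-↭-[] L₁ L₂ h = _ , _ , _ , _ , done , ↭-refl , ↭-refl
  deal [] (y ∷ A) L₁ L₂ h with extract-++ L₁ L₂ h
  ... | inj₁ (L′ , p , q) = let B₁ , A₁ , _ , _ , d , r , s = deal [] A L′ L₂ q in
        _ , _ , _ , _ , A-left y d , ↭-trans p (↭-trans (prep y r) (↭-sym (ʳ++-shift y B₁ A₁))) , s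
  ... | inj₂ (L′ , p , q) = let _ , _ , B₂ , A₂ , d , r , s = deal [] A L₁ L′ q in
        _ , _ , _ , _ , A-right y d , r , ↭-trans p (↭-trans (prep y s) (↭-sym (ʳ++-shift y B₂ A₂)))
  deal (y ∷ B) A L₁ L₂ h with extract-++ L₁ L₂ (↭-trans h (ʳ++-shift y B A))
  ... | inj₁ (L′ , p , q) = let B₁ , A₁ , _ , _ , d , r , s = deal B A L′ L₂ q in
        _ , _ , _ , _ , B-left y d , ↭-trans p (↭-trans (prep y r) (↭-sym (ʳ++-shift y B₁ A₁))) , s
  ... | inj₂ (L′ , p , q) = let _ , _ , B₂ , A₂ , d , r , s = deal B A L₁ L′ q in
        _ , _ , _ , _ , B-right y d , r , ↭-trans p (↭-trans (prep y s) (↭-sym (ʳ++-shift y B₂ A₂)))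

  Sorted : List ℕ → Set
  Sorted = AllPairs _<_

  sorted-resp-⊆ : ∀ {xs ys} → xs ⊆ ys → Sorted ys → Sorted xs
  sorted-resp-⊆ [] [] = []
  sorted-resp-⊆ (y ∷ʳ p) (_ ∷ h) = sorted-resp-⊆ p h
  sorted-resp-⊆ (refl ∷ p) (a ∷ h) = All-resp-⊆ p a ∷ sorted-resp-⊆ p h

  sorted-tail : ∀ B {A} → Sorted (B ʳ++ A) → Sorted A
  sorted-tail [] h = h
  sorted-tail (b ∷ B) h = AllPairs.tail (sorted-tail B h)

  sorted-above : ∀ B {x A y} → Sorted (B ʳ++ (x ∷ A)) → y ∈ A → x < y
  sorted-above B h p = All.lookup (AllPairs.head (sorted-tail B h)) p

  sorted-below : ∀ B {x A y} → Sorted (B ʳ++ (x ∷ A)) → y ∈ B → y < x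
  sorted-below (b ∷ B) h (here refl) = All.lookup (AllPairs.head (sorted-tail B h)) (here refl)
  sorted-below (b ∷ B) {x} {A} h (there p) = sorted-below B (sorted-resp-⊆ (ʳ++⁺ {as = B} ⊆-refl (b ∷ʳ ⊆-refl)) h) p

  sorted-unroot : ∀ B {x A} → Sorted (B ʳ++ (x ∷ A)) → Sorted (B ʳ++ A)
  sorted-unroot B {x} = sorted-resp-⊆ (ʳ++⁺ {as = B} ⊆-refl (x ∷ʳ ⊆-refl))

  sorted-⊆ : ∀ {B B′ x A A′} → B′ ⊆ B → A′ ⊆ A → Sorted (B ʳ++ (x ∷ A)) → Sorted (B′ ʳ++ (x ∷ A′))
  sorted-⊆ p q = sorted-resp-⊆ (ʳ++⁺ p (refl ∷ q))

  sorted-unique : ∀ {xs} → Sorted xs → Unique xs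
  sorted-unique = AllPairs.map ℕP.<⇒≢

  side : Bool → List ℕ → List ℕ → List ℕ
  side true B A = A
  side false B A = B

  upE-∈⁻ : ∀ {X} (f : ℕ → Enum X) B A {y t} → (y , t) ∈ upE f B A →
           ∃ λ P → ∃ λ A′ → A ≡ P ++ y ∷ A′ × t ∈ f y (P ʳ++ B) A′
  upE-∈⁻ f B (z ∷ A) h with ∈-++⁻ (map (z ,_) (f z B A)) h
  ... | inj₁ p with _ , q , refl ← ∈-map⁻ (z ,_) p = [] , A , refl , q
  ... | inj₂ p with P , A′ , refl , q ← upE-∈⁻ f (z ∷ B) A p = z ∷ P , A′ , refl , q

  upE-∈⁺ : ∀ {X} (f : ℕ → Enum X) P B {A y t} → t ∈ f y (P ʳ++ B) A → (y , t) ∈ upE f B (P ++ y ∷ A)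
  upE-∈⁺ f [] B {y = y} h = ∈-++⁺ˡ (∈-map⁺ (y ,_) h)
  upE-∈⁺ f (z ∷ P) B {A} {y} h = ∈-++⁺ʳ (map (z ,_) (f z B (P ++ y ∷ A))) (upE-∈⁺ f P (z ∷ B) h)

  intE-∈⁻ : ∀ s {X} (f : ℕ → Enum X) B A {y t} → (y , t) ∈ intE s f B A →
            ∃ λ B′ → ∃ λ A′ → y ∈ side s B A × B′ ʳ++ (y ∷ A′) ≡ B ʳ++ A × t ∈ f y B′ A′
  intE-∈⁻ true f B A {y} h with P , A′ , refl , q ← upE-∈⁻ f B A h =
    P ʳ++ B , A′ , ∈-++⁺ʳ P (here refl) , LP.ʳ++-ʳ++ P , q
  intE-∈⁻ false f B A {y} h with P , B′ , refl , q ← upE-∈⁻ (flip ∘ f) A B h =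
    B′ , P ʳ++ A , ∈-++⁺ʳ P (here refl) , sym (LP.++-ʳ++ P) , q

  intE-∈⁺ : ∀ s {X} (f : ℕ → Enum X) B A {y} → y ∈ side s B A →
            ∃ λ B′ → ∃ λ A′ → B′ ʳ++ (y ∷ A′) ≡ B ʳ++ A × (∀ {t} → t ∈ f y B′ A′ → (y , t) ∈ intE s f B A)
  intE-∈⁺ true f B A h with P , A′ , refl ← ∈-∃++ h = P ʳ++ B , A′ , LP.ʳ++-ʳ++ P , upE-∈⁺ f P B
  intE-∈⁺ false f B A h with P , B′ , refl ← ∈-∃++ h = B′ , P ʳ++ A , sym (LP.++-ʳ++ P) , upE-∈⁺ (flip ∘ f) P A

  upE-unique : ∀ {X} (f : ℕ → Enum X) B A → Unique A →
               (∀ P y A′ → A ≡ P ++ y ∷ A′ → Unique (f y (P ʳ++ B) A′)) → Unique (upE f B A)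
  upE-unique f B [] u h = []
  upE-unique f B (z ∷ A) (z∉A ∷ u) h = Unique.++⁺
    (Unique.map⁺ (λ { refl → refl }) (h [] z A refl))
    (upE-unique f (z ∷ B) A u (λ P y A′ e → h (z ∷ P) y A′ (cong (z ∷_) e)))
    disjoint
    where
    disjoint : ∀ {v} → ¬ (v ∈ map (z ,_) (f z B A) × v ∈ upE f (z ∷ B) A)
    disjoint (p , q) with _ , _ , refl ← ∈-map⁻ (z ,_) p | P , A′ , refl , _ ← upE-∈⁻ f (z ∷ B) A q =
      All.lookup z∉A (∈-++⁺ʳ P (here refl)) refl

  intE-unique : ∀ s {X} (f : ℕ → Enum X) B A → Unique B → Unique A →
                (∀ B′ y A′ → B′ ʳ++ (y ∷ A′) ≡ B ʳ++ A → Unique (f y B′ A′)) → Unique (intE s f B A)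
  intE-unique true f B A _ u h = upE-unique f B A u (λ { P y A′ refl → h _ y A′ (LP.ʳ++-ʳ++ P) })
  intE-unique false f B A u _ h = upE-unique (flip ∘ f) A B u (λ { P y B′ refl → h B′ y _ (sym (LP.++-ʳ++ P)) })

  -- The labels of the first component reveal the deal, so the two summands at each label, which
  -- give it to different sides, are disjoint.
  conv-unique : ∀ {X Y} (lab : X → List ℕ) (f : Enum X) (g : Enum Y) B A →
                (∀ {B₁ A₁ B₂ A₂} → Deal B A B₁ A₁ B₂ A₂ → Unique (f B₁ A₁) × Unique (g B₂ A₂)) →
                (∀ {B₁ A₁ B₂ A₂} → Deal B A B₁ A₁ B₂ A₂ → ∀ {x} → x ∈ f B₁ A₁ →
                   (∀ {z} → z ∈ B₁ ʳ++ A₁ → z ∈ lab x) × (∀ {z} → z ∈ B₂ ʳ++ A₂ → z ∉ lab x)) →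
                Unique (conv f g B A)
  conv-unique lab f g [] [] u _ = let p , q = u done in Unique.cartesianProduct⁺ p q
  conv-unique lab f g [] (y ∷ A) u h = Unique.++⁺
    (conv-unique lab _ g [] A (u ∘ A-left y) (λ {B₁} {A₁} d p → let r , s = h (A-left y d) p in
      (λ q → r (∈-resp-↭ (↭-sym (ʳ++-shift y B₁ A₁)) (there q))) , s))
    (conv-unique lab f _ [] A (u ∘ A-right y) (λ {B₁} {A₁} {B₂} {A₂} d p → let r , s = h (A-right y d) p in
      r , (λ q → s (∈-resp-↭ (↭-sym (ʳ++-shift y B₂ A₂)) (there q)))))
    disjoint
    where
    disjoint : ∀ {v} → ¬ (v ∈ conv _ g [] A × v ∈ conv f _ [] A)
    disjoint (p , q) with B₁ , A₁ , _ , _ , d , i , _ ← conv-∈⁻ _ g [] A p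
                        | _ , _ , B₂ , A₂ , d′ , j , _ ← conv-∈⁻ f _ [] A q =
      proj₂ (h (A-right y d′) j) (∈-resp-↭ (↭-sym (ʳ++-shift y B₂ A₂)) (here refl))
        (proj₁ (h (A-left y d) i) (∈-resp-↭ (↭-sym (ʳ++-shift y B₁ A₁)) (here refl)))
  conv-unique lab f g (y ∷ B) A u h = Unique.++⁺
    (conv-unique lab _ g B A (u ∘ B-left y) (λ {B₁} {A₁} d p → let r , s = h (B-left y d) p in
      (λ q → r (∈-resp-↭ (↭-sym (ʳ++-shift y B₁ A₁)) (there q))) , s))
    (conv-unique lab f _ B A (u ∘ B-right y) (λ {B₁} {A₁} {B₂} {A₂} d p → let r , s = h (B-right y d) p in
      r , (λ q → s (∈-resp-↭ (↭-sym (ʳ++-shift y B₂ A₂)) (there q)))))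
    disjoint
    where
    disjoint : ∀ {v} → ¬ (v ∈ conv _ g B A × v ∈ conv f _ B A)
    disjoint (p , q) with B₁ , A₁ , _ , _ , d , i , _ ← conv-∈⁻ _ g B A p
                        | _ , _ , B₂ , A₂ , d′ , j , _ ← conv-∈⁻ f _ B A q =
      proj₂ (h (B-right y d′) j) (∈-resp-↭ (↭-sym (ʳ++-shift y B₂ A₂)) (here refl))
        (proj₁ (h (B-left y d) i) (∈-resp-↭ (↭-sym (ʳ++-shift y B₁ A₁)) (here refl)))

  pick-∈⁻ : ∀ {X : Set} c d {xs : List X} {x} → x ∈ pick c d xs → c ≡ d × x ∈ xs
  pick-∈⁻ true true h = refl , h
  pick-∈⁻ false false h = refl , h

  pick-∈⁺ : ∀ {X : Set} c {xs : List X} {x} → x ∈ xs → x ∈ pick c c xs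
  pick-∈⁺ true h = h
  pick-∈⁺ false h = h

  pick-unique : ∀ {X : Set} c d {xs : List X} → (c ≡ d → Unique xs) → Unique (pick c d xs)
  pick-unique true true h = h refl
  pick-unique true false h = []
  pick-unique false true h = []
  pick-unique false false h = h refl

  module _ {X Y : Set} where

    splE-∈⁻ : ∀ (Φ : List Bool → Enum X) c (Ψ : List Bool → Enum Y) w {B A p} → p ∈ splE Φ c Ψ w B A →
              ∃ λ u → ∃ λ v → w ≡ u ++ c ∷ v × p ∈ conv (Φ u) (Ψ v) B A
    splE-∈⁻ Φ c Ψ (d ∷ w) {B} {A} h with ∈-++⁻ (pick c d (conv (Φ []) (Ψ w) B A)) h
    ... | inj₁ p with refl , q ← pick-∈⁻ c d p = [] , w , refl , q
    ... | inj₂ p with u , v , refl , q ← splE-∈⁻ (Φ ∘ (d ∷_)) c Ψ w p = d ∷ u , v , refl , q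

    splE-∈⁺ : ∀ (Φ : List Bool → Enum X) c (Ψ : List Bool → Enum Y) u v {B A p} →
              p ∈ conv (Φ u) (Ψ v) B A → p ∈ splE Φ c Ψ (u ++ c ∷ v) B A
    splE-∈⁺ Φ c Ψ [] v h = ∈-++⁺ˡ (pick-∈⁺ c h)
    splE-∈⁺ Φ c Ψ (d ∷ u) v {B} {A} h =
      ∈-++⁺ʳ (pick c d (conv (Φ []) (Ψ (u ++ c ∷ v)) B A)) (splE-∈⁺ (Φ ∘ (d ∷_)) c Ψ u v h)

    -- The second hypothesis lets an element determine its left word, so that no element comes from
    -- two factorisations.
    splE-unique : ∀ (Φ : List Bool → Enum X) c (Ψ : List Bool → Enum Y) w {B A} →
                  (∀ u v → w ≡ u ++ c ∷ v → Unique (conv (Φ u) (Ψ v) B A)) →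
                  (∀ {p} u v u′ v′ → p ∈ conv (Φ u) (Ψ v) B A → p ∈ conv (Φ u′) (Ψ v′) B A → u ≡ u′) →
                  Unique (splE Φ c Ψ w B A)
    splE-unique Φ c Ψ [] h k = []
    splE-unique Φ c Ψ (d ∷ w) {B} {A} h k = Unique.++⁺
      (pick-unique c d (λ { refl → h [] w refl }))
      (splE-unique (Φ ∘ (d ∷_)) c Ψ w (λ u v e → h (d ∷ u) v (cong (d ∷_) e))
        (λ u v u′ v′ p q → LP.∷-injectiveʳ (k (d ∷ u) v (d ∷ u′) v′ p q)))
      disjoint
      where
      disjoint : ∀ {p} → ¬ (p ∈ pick c d (conv (Φ []) (Ψ w) B A) × p ∈ splE (Φ ∘ (d ∷_)) c Ψ w B A)
      disjoint (p , q) with _ , p′ ← pick-∈⁻ c d p | u , v , _ , q′ ← splE-∈⁻ (Φ ∘ (d ∷_)) c Ψ w q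
        with () ← k [] w (d ∷ u) v p′ q′

  <ᵇ-true : ∀ {x y} → x < y → (x <ᵇ y) ≡ true
  <ᵇ-true {x} {y} h with x <ᵇ y | ℕP.<⇒<ᵇ h
  ... | true | _ = refl

  <ᵇ-false : ∀ {x y} → y ≤ x → (x <ᵇ y) ≡ false
  <ᵇ-false {x} {y} h with x <ᵇ y in e
  ... | false = refl
  ... | true = ⊥-elim (ℕP.<⇒≱ (ℕP.<ᵇ⇒< x y (subst T (sym e) _)) h)

  <ᵇ-true⁻ : ∀ {x y} → (x <ᵇ y) ≡ true → x < y
  <ᵇ-true⁻ {x} {y} e = ℕP.<ᵇ⇒< x y (subst T (sym e) _)

  <ᵇ-side : ∀ s B {x A y} → Sorted (B ʳ++ (x ∷ A)) → y ∈ side s B A → (x <ᵇ y) ≡ s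
  <ᵇ-side true B h p = <ᵇ-true (sorted-above B h p)
  <ᵇ-side false B h p = <ᵇ-false (ℕP.<⇒≤ (sorted-below B h p))

  side-<ᵇ : ∀ B {x A y} → Sorted (B ʳ++ (x ∷ A)) → y ∈ B ʳ++ A → y ∈ side (x <ᵇ y) B A
  side-<ᵇ B {x} {A} {y} h p with ∈-++⁻ B (∈-resp-↭ (↭-sym (++↭ʳ++ B A)) p)
  ... | inj₁ q rewrite <ᵇ-false (ℕP.<⇒≤ (sorted-below B h q)) = q
  ... | inj₂ q rewrite <ᵇ-true (sorted-above B h q) = q

  Spec : ℕ → List Bool → List ℕ → List ℕ → Forest → Set
  Spec x w B A t = word x t ≡ w × labels t ↭ B ʳ++ A

  forests-sound : ∀ n x w B A {t} → Sorted (B ʳ++ (x ∷ A)) → t ∈ forests n x w B A → Spec x w B A t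
  forests-sound (suc n) x [] [] [] h (here refl) = refl , ↭-refl
  forests-sound (suc n) x (s ∷ w) B A h p
    with ((y , u) , v) , q , refl ← ∈-map⁻ build p
    with wu , wv , refl , r ← splE-∈⁻ _ (not s) _ w q
    with B₁ , A₁ , B₂ , A₂ , d , i , j ← conv-∈⁻ _ _ B A r
    with B′ , A′ , y∈ , zip , k ← intE-∈⁻ s (λ y → forests n y wu) B₁ A₁ i
    with (⊆B₁ , ⊆A₁) , (⊆B₂ , ⊆A₂) ← deal-⊆ d =
    cong₂ _∷_ sign (cong₂ _++_ (proj₁ su) (cong₂ _∷_ (cong not sign) (proj₁ sv))) ,
    ↭-trans (++⁺ (↭-trans (prep y (proj₂ su)) (↭-trans (↭-sym (ʳ++-shift y B′ A′)) (↭-reflexive zip))) (proj₂ sv)) (deal-↭ d)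
    where
    h₁ = sorted-⊆ ⊆B₁ ⊆A₁ h
    sign : (x <ᵇ y) ≡ s
    sign = <ᵇ-side s B₁ h₁ y∈
    su = forests-sound n y wu B′ A′ (subst Sorted (sym zip) (sorted-unroot B₁ h₁)) k
    sv = forests-sound n x wv B₂ A₂ (sorted-⊆ ⊆B₂ ⊆A₂ h) j

  forests-complete : ∀ n x t B A → Sorted (B ʳ++ (x ∷ A)) → length (word x t) < n →
                     labels t ↭ B ʳ++ A → t ∈ forests n x (word x t) B A
  forests-complete (suc n) x nil B A h _ p = nil∈ B A (↭-empty-inv (↭-trans (++↭ʳ++ B A) (↭-sym p)))
    where
    nil∈ : ∀ B A → B ++ A ≡ [] → nil ∈ forests (suc n) x [] B A
    nil∈ [] [] e = here refl
  forests-complete (suc n) x (node y u v) B A h (s≤s len) p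
    with B₁ , A₁ , B₂ , A₂ , d , r , s ← deal B A (y ∷ labels u) (labels v) p
    with (⊆B₁ , ⊆A₁) , (⊆B₂ , ⊆A₂) ← deal-⊆ d
    with B′ , A′ , zip , k ← intE-∈⁺ (x <ᵇ y) (λ y′ → forests n y′ (word y u)) B₁ A₁
           (side-<ᵇ B₁ (sorted-⊆ ⊆B₁ ⊆A₁ h) (∈-resp-↭ r (here refl))) =
    ∈-map⁺ build (splE-∈⁺ _ (not (x <ᵇ y)) _ (word y u) (word x v) (conv-∈⁺ _ _ d (k iu) iv))
    where
    lens = prefix-< (word y u) (not (x <ᵇ y)) (word x v) ℕP.≤-refl
    iu : u ∈ forests n y (word y u) B′ A′
    iu = forests-complete n y u B′ A′ (subst Sorted (sym zip) (sorted-unroot B₁ (sorted-⊆ ⊆B₁ ⊆A₁ h)))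
      (ℕP.≤-trans (proj₁ lens) len)
      (drop-∷ (↭-trans r (↭-trans (↭-reflexive (sym zip)) (ʳ++-shift y B′ A′))))
    iv : v ∈ forests n x (word x v) B₂ A₂
    iv = forests-complete n x v B₂ A₂ (sorted-⊆ ⊆B₂ ⊆A₂ h) (ℕP.≤-trans (ℕP.m<n⇒m<1+n (proj₂ lens)) len) s

  Unique-resp-↭ : ∀ {xs ys : List ℕ} → xs ↭ ys → Unique xs → Unique ys
  Unique-resp-↭ p = Permutationₛ.Unique-resp-↭ (setoid ℕ) (↭⇒↭ₛ p)

  unique-disjoint : ∀ {xs ys : List ℕ} → Unique (xs ++ ys) → ∀ {z} → z ∈ xs → z ∉ ys
  unique-disjoint {x ∷ xs} (a ∷ u) (here refl) q = All.lookup a (∈-++⁺ʳ xs q) refl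
  unique-disjoint {x ∷ xs} (a ∷ u) (there p) q = unique-disjoint u p q

  unique-++⁻ : ∀ (xs : List ℕ) {ys} → Unique (xs ++ ys) → Unique xs × Unique ys
  unique-++⁻ [] u = [] , u
  unique-++⁻ (x ∷ xs) (a ∷ u) = let p , q = unique-++⁻ xs u in (All.++⁻ˡ xs a ∷ p) , q

  build-injective : ∀ {p q} → build p ≡ build q → p ≡ q
  build-injective refl = refl

  forests-unique : ∀ n x w B A → Sorted (B ʳ++ (x ∷ A)) → Unique (forests n x w B A)
  forests-unique zero x w B A h = []
  forests-unique (suc n) x [] [] [] h = [] ∷ []
  forests-unique (suc n) x [] [] (_ ∷ _) h = []
  forests-unique (suc n) x [] (_ ∷ _) A h = []
  forests-unique (suc n) x (s ∷ w) B A h = Unique.map⁺ build-injective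
    (splE-unique Φ (not s) (forests n x) w (λ u v _ → conv-unique lab (Φ u) (forests n x v) B A (parts u v) (owns u)) same)
    where
    Φ : List Bool → Enum (ℕ × Forest)
    Φ u = intE s (λ y → forests n y u)
    lab : ℕ × Forest → List ℕ
    lab (y , t) = y ∷ labels t
    Φ-sound : ∀ u {B₁ A₁ y t} → Sorted (B₁ ʳ++ (x ∷ A₁)) → (y , t) ∈ Φ u B₁ A₁ →
              word y t ≡ u × y ∷ labels t ↭ B₁ ʳ++ A₁
    Φ-sound u {B₁} {A₁} {y} h₁ i with B′ , A′ , _ , zip , k ← intE-∈⁻ s (λ y → forests n y u) B₁ A₁ i
      with e , p ← forests-sound n y u B′ A′ (subst Sorted (sym zip) (sorted-unroot B₁ h₁)) k =
      e , ↭-trans (prep y p) (↭-trans (↭-sym (ʳ++-shift y B′ A′)) (↭-reflexive zip))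
    sorted₁ : ∀ {B₁ A₁ B₂ A₂} → Deal B A B₁ A₁ B₂ A₂ → Sorted (B₁ ʳ++ (x ∷ A₁))
    sorted₁ d = let (p , q) , _ = deal-⊆ d in sorted-⊆ p q h
    unique-parts : ∀ B₁ {A₁} → Unique (B₁ ʳ++ A₁) → Unique B₁ × Unique A₁
    unique-parts B₁ u = unique-++⁻ B₁ (Unique-resp-↭ (↭-sym (++↭ʳ++ B₁ _)) u)
    parts : ∀ u v {B₁ A₁ B₂ A₂} → Deal B A B₁ A₁ B₂ A₂ → Unique (Φ u B₁ A₁) × Unique (forests n x v B₂ A₂)
    parts u v {B₁} {A₁} {B₂} {A₂} d = let _ , (p , q) = deal-⊆ d
                                          h₁ = sorted-unroot B₁ (sorted₁ d)
                                          uB , uA = unique-parts B₁ (sorted-unique h₁) in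
      intE-unique s _ B₁ A₁ uB uA (λ B′ y A′ e → forests-unique n y u B′ A′ (subst Sorted (sym e) h₁)) ,
      forests-unique n x v B₂ A₂ (sorted-⊆ p q h)
    owns : ∀ u {B₁ A₁ B₂ A₂} → Deal B A B₁ A₁ B₂ A₂ → ∀ {t} → t ∈ Φ u B₁ A₁ →
           (∀ {z} → z ∈ B₁ ʳ++ A₁ → z ∈ lab t) × (∀ {z} → z ∈ B₂ ʳ++ A₂ → z ∉ lab t)
    owns u d i with _ , p ← Φ-sound u (sorted₁ d) i =
      (λ q → ∈-resp-↭ (↭-sym p) q) ,
      (λ q r → unique-disjoint (Unique-resp-↭ (↭-sym (deal-↭ d)) (sorted-unique (sorted-unroot B h))) (∈-resp-↭ p r) q)
    same : ∀ {p} u v u′ v′ → p ∈ conv (Φ u) (forests n x v) B A → p ∈ conv (Φ u′) (forests n x v′) B A → u ≡ u′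
    same u v u′ v′ p q with _ , _ , _ , _ , d , i , _ ← conv-∈⁻ (Φ u) (forests n x v) B A p
                          | _ , _ , _ , _ , d′ , i′ , _ ← conv-∈⁻ (Φ u′) (forests n x v′) B A q =
      trans (sym (proj₁ (Φ-sound u (sorted₁ d) i))) (proj₁ (Φ-sound u′ (sorted₁ d′) i′))

  -- With no label below, `upE` allows every label as the root; on the side of counts this is the
  -- integral over the label of the root.
  trees : List Bool → List ℕ → List (ℕ × Forest)
  trees w S = upE (λ x → forests (suc (length w)) x w) [] S

  module _ (w : List Bool) {S : List ℕ} (sorted : Sorted S) where

    zipper : ∀ P {x A} → S ≡ P ++ x ∷ A → (P ʳ++ []) ʳ++ (x ∷ A) ≡ S
    zipper P refl = LP.ʳ++-ʳ++ P

    trees-sound : ∀ {x t} → (x , t) ∈ trees w S → word x t ≡ w × x ∷ labels t ↭ S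
    trees-sound {x} {t} h with P , A , e , p ← upE-∈⁻ _ [] S h
      with q , r ← forests-sound (suc (length w)) x w (P ʳ++ []) A (subst Sorted (sym (zipper P e)) sorted) p =
      q , ↭-trans (prep x r) (↭-trans (↭-sym (ʳ++-shift x (P ʳ++ []) A)) (↭-reflexive (zipper P e)))

    trees-complete : ∀ {x t} → word x t ≡ w → x ∷ labels t ↭ S → (x , t) ∈ trees w S
    trees-complete {x} {t} refl h with P , A , refl ← ∈-∃++ (∈-resp-↭ h (here refl)) =
      upE-∈⁺ _ P [] (forests-complete _ x t (P ʳ++ []) A (subst Sorted (sym (zipper P refl)) sorted) ℕP.≤-refl
        (drop-∷ (↭-trans h (↭-trans (↭-reflexive (sym (zipper P refl))) (ʳ++-shift x (P ʳ++ []) A)))))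

    trees-unique : Unique (trees w S)
    trees-unique = upE-unique _ [] S (sorted-unique sorted) (λ P x A e →
      forests-unique (suc (length w)) x w (P ʳ++ []) A (subst Sorted (sym (zipper P e)) sorted))

  trees-length : ∀ w S → pos (length (trees w S)) ≡ up (F w) 0 (length S)
  trees-length w S = upE-counts (λ x → forests-counts (suc (length w)) x w) [] S

-- The walk around a tree as a polygon with paired sides

module LabelledPolygon where

  open Enumeration using (Forest; nil; node; labels; word; <ᵇ-true; <ᵇ-false; unique-++⁻; unique-disjoint)
  open import Data.Nat using (ℕ; zero; suc; s≤s; z≤n; _+_; _≤_; _<_; _<ᵇ_)
  import Data.Nat.Properties as ℕP
  open import Data.Nat.Solver using (module +-*-Solver)
  open import Data.Bool using (Bool; not)
  import Data.Bool.Properties as BP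
  open import Data.List using (List; []; _∷_; _++_; length; map)
  import Data.List.Properties as LP
  open import Data.List.Membership.Propositional using (_∈_; _∉_)
  open import Data.List.Membership.Propositional.Properties
  open import Data.List.Relation.Unary.Any using (here; there)
  open import Data.List.Relation.Unary.All as All using (All; []; _∷_)
  import Data.List.Relation.Unary.All.Properties as All
  open import Data.List.Relation.Unary.AllPairs using ([]; _∷_)
  open import Data.List.Relation.Unary.Unique.Propositional using (Unique)
  import Data.List.Relation.Unary.Unique.Propositional.Properties as Unique
  open import Data.Product using (_×_; _,_; proj₁; proj₂; ∃)
  open import Data.Sum using (inj₁; inj₂)
  open import Data.Unit using (⊤; tt)
  open import Data.Empty using (⊥-elim)
  open import Function using (_∘_)
  open import Relation.Binary.Definitions using (tri<; tri≈; tri>)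
  open import Relation.Binary.PropositionalEquality hiding ([_])

  sz : Forest → ℕ
  sz nil = 0
  sz (node y u v) = suc (sz u + suc (sz v))

  length-word : ∀ x t → length (word x t) ≡ sz t
  length-word x nil = refl
  length-word x (node y u v) = cong suc (trans (LP.length-++ (word y u))
    (cong₂ (λ a b → a + suc b) (length-word y u) (length-word x v)))

  -- The labels at successive corners; the root closes the walk, hence one entry more than there are
  -- steps.
  contour : ℕ → Forest → List ℕ
  contour x nil = x ∷ []
  contour x (node y u v) = x ∷ contour y u ++ contour x v

  length-contour : ∀ x t → length (contour x t) ≡ suc (sz t)
  length-contour x nil = refl
  length-contour x (node y u v) = cong suc (trans (LP.length-++ (contour y u))
    (cong₂ _+_ (length-contour y u) (length-contour x v)))

  -- The steps of the walk around the tree are numbered from n on; the two passages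
  -- of an edge are paired.
  partners : ℕ → Forest → List ℕ
  partners n nil = []
  partners n (node y u v) = suc (n + sz u) ∷ partners (suc n) u ++ n ∷ partners (suc (suc (n + sz u))) v

  length-partners : ∀ n t → length (partners n t) ≡ sz t
  length-partners n nil = refl
  length-partners n (node y u v) = cong suc (trans (LP.length-++ (partners (suc n) u))
    (cong₂ (λ a b → a + suc b) (length-partners (suc n) u) (length-partners _ v)))

  At : ∀ {A : Set} → (ℕ → A) → ℕ → List A → Set
  At f n [] = ⊤
  At f n (x ∷ xs) = f n ≡ x × At f (suc n) xs

  module _ {A : Set} {f : ℕ → A} where

    At-++⁺ : ∀ n {m} xs {ys} → n + length xs ≡ m → At f n xs → At f m ys → At f n (xs ++ ys)
    At-++⁺ n [] refl p q = subst (λ k → At f k _) (ℕP.+-identityʳ n) q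
    At-++⁺ n (x ∷ xs) e (p , ps) q = p , At-++⁺ (suc n) xs (trans (sym (ℕP.+-suc n (length xs))) e) ps q

    At-++⁻ : ∀ n {m} xs {ys} → n + length xs ≡ m → At f n (xs ++ ys) → At f n xs × At f m ys
    At-++⁻ n [] refl q = tt , subst (λ k → At f k _) (sym (ℕP.+-identityʳ n)) q
    At-++⁻ n (x ∷ xs) e (p , ps) =
      let r , s = At-++⁻ (suc n) xs (trans (sym (ℕP.+-suc n (length xs))) e) ps in (p , r) , s

    At-unique : ∀ n xs ys → length xs ≡ length ys → At f n xs → At f n ys → xs ≡ ys
    At-unique n [] [] e p q = refl
    At-unique n (x ∷ xs) (y ∷ ys) e (refl , ps) (refl , qs) =
      cong (_ ∷_) (At-unique (suc n) xs ys (ℕP.suc-injective e) ps qs)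

  At-cong : ∀ {A : Set} {f g : ℕ → A} n xs → (∀ i → n ≤ i → i < n + length xs → f i ≡ g i) → At f n xs → At g n xs
  At-cong n [] h p = tt
  At-cong n (x ∷ xs) h (p , ps) = trans (sym (h n ℕP.≤-refl (ℕP.m<m+n n (s≤s z≤n)))) p ,
    At-cong (suc n) xs (λ i q r → h i (ℕP.<⇒≤ q) (subst (i <_) (sym (ℕP.+-suc n (length xs))) r)) ps

  At-≡ : ∀ {A : Set} {f g : ℕ → A} n xs → At f n xs → At g n xs → ∀ i → n ≤ i → i < n + length xs → f i ≡ g i
  At-≡ n [] p q i h k = ⊥-elim (ℕP.<⇒≱ k (subst (_≤ i) (sym (ℕP.+-identityʳ n)) h))
  At-≡ {f = f} {g} n (x ∷ xs) (p , ps) (q , qs) i h k with ℕP.m≤n⇒m<n∨m≡n h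
  ... | inj₁ n<i = At-≡ {f = f} {g} (suc n) xs ps qs i n<i (subst (i <_) (ℕP.+-suc n (length xs)) k)
  ... | inj₂ refl = trans p (sym q)

  At-map : ∀ {A B : Set} {f : ℕ → A} (g : A → B) n xs → At f n xs → At (g ∘ f) n (map g xs)
  At-map g n [] p = tt
  At-map g n (x ∷ xs) (p , ps) = cong g p , At-map g (suc n) xs ps

  nth : ∀ {A : Set} → A → List A → ℕ → A
  nth d [] i = d
  nth d (x ∷ xs) zero = x
  nth d (x ∷ xs) (suc i) = nth d xs i

  At-suc : ∀ {A : Set} {f : ℕ → A} n xs → At (f ∘ suc) n xs → At f (suc n) xs
  At-suc n [] p = tt
  At-suc n (x ∷ xs) (p , ps) = p , At-suc (suc n) xs ps

  At-nth : ∀ {A : Set} (d : A) xs → At (nth d xs) 0 xs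
  At-nth d [] = tt
  At-nth d (x ∷ xs) = refl , At-suc {f = nth d (x ∷ xs)} 0 xs (At-nth d xs)

  -- Steps and corners of the walk around a forest, starting at n.
  data Edge : ℕ → Forest → ℕ → Set where
    opening : ∀ {n y u v} → Edge n (node y u v) n
    closing : ∀ {n y u v} → Edge n (node y u v) (suc (n + sz u))
    left : ∀ {n y u v i} → Edge (suc n) u i → Edge n (node y u v) i
    right : ∀ {n y u v i} → Edge (suc (suc (n + sz u))) v i → Edge n (node y u v) i

  data Corner : ℕ → Forest → ℕ → Set where
    start : ∀ {n t} → Corner n t n
    left : ∀ {n y u v i} → Corner (suc n) u i → Corner n (node y u v) i
    right : ∀ {n y u v i} → Corner (suc (suc (n + sz u))) v i → Corner n (node y u v) i

  end-eq : ∀ n a b → n + suc (a + suc b) ≡ suc (suc (n + a)) + b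
  end-eq = solve 3 (λ n a b → n :+ (con 1 :+ (a :+ (con 1 :+ b))) := con 1 :+ (con 1 :+ (n :+ a)) :+ b) refl
    where open +-*-Solver

  edge : ∀ n t i → n ≤ i → i < n + sz t → Edge n t i
  edge n nil i h k = ⊥-elim (ℕP.<⇒≱ k (subst (_≤ i) (sym (ℕP.+-identityʳ n)) h))
  edge n (node y u v) i h k with ℕP.m≤n⇒m<n∨m≡n h
  ... | inj₂ refl = opening
  ... | inj₁ n<i with ℕP.<-cmp i (suc (n + sz u))
  ...   | tri< i<c _ _ = left (edge (suc n) u i n<i i<c)
  ...   | tri≈ _ refl _ = closing
  ...   | tri> _ _ c<i = right (edge _ v i c<i (subst (i <_) (end-eq n (sz u) (sz v)) k))

  corner : ∀ n t i → n ≤ i → i ≤ n + sz t → Corner n t i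
  corner n t i h k with ℕP.m≤n⇒m<n∨m≡n h
  ... | inj₂ refl = start
  corner n nil i h k | inj₁ n<i = ⊥-elim (ℕP.<⇒≱ n<i (subst (i ≤_) (ℕP.+-identityʳ n) k))
  corner n (node y u v) i h k | inj₁ n<i with ℕP.<-cmp i (suc (suc (n + sz u)))
  ... | tri< i<c _ _ = left (corner (suc n) u i n<i (ℕP.≤-pred i<c))
  ... | tri≈ _ refl _ = right start
  ... | tri> _ _ c<i = right (corner _ v i (ℕP.<⇒≤ c<i) (subst (i ≤_) (end-eq n (sz u) (sz v)) k))

  left-end : ∀ n a b → suc n + a ≤ n + suc (a + suc b)
  left-end n a b = subst (_≤ n + suc (a + suc b)) (ℕP.+-suc n a) (ℕP.+-monoʳ-≤ n (s≤s (ℕP.m≤m+n a (suc b))))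

  edge-bounds : ∀ {n t i} → Edge n t i → n ≤ i × i < n + sz t
  edge-bounds {n} opening = ℕP.≤-refl , ℕP.m<m+n n (s≤s z≤n)
  edge-bounds {n} {node y u v} closing = ℕP.m≤n⇒m≤1+n (ℕP.m≤m+n n (sz u)) ,
    subst (suc (n + sz u) <_) (sym (end-eq n (sz u) (sz v))) (ℕP.m≤m+n _ (sz v))
  edge-bounds {n} {node y u v} (left p) = let h , k = edge-bounds p in
    ℕP.<⇒≤ h , ℕP.≤-trans k (left-end n (sz u) (sz v))
  edge-bounds {n} {node y u v} {i} (right p) = let h , k = edge-bounds p in
    ℕP.≤-trans (ℕP.m≤n⇒m≤1+n (ℕP.m≤n⇒m≤1+n (ℕP.m≤m+n n (sz u)))) h ,
    subst (i <_) (sym (end-eq n (sz u) (sz v))) k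

  corner-bounds : ∀ {n t i} → Corner n t i → n ≤ i × i ≤ n + sz t
  corner-bounds {n} {t} start = ℕP.≤-refl , ℕP.m≤m+n n (sz t)
  corner-bounds {n} {node y u v} (left p) = let h , k = corner-bounds p in
    ℕP.<⇒≤ h , ℕP.≤-trans k (left-end n (sz u) (sz v))
  corner-bounds {n} {node y u v} {i} (right p) = let h , k = corner-bounds p in
    ℕP.≤-trans (ℕP.m≤n⇒m≤1+n (ℕP.m≤n⇒m≤1+n (ℕP.m≤m+n n (sz u)))) h ,
    subst (i ≤_) (sym (end-eq n (sz u) (sz v))) k

  unique-node : ∀ {x y u v} → Unique (x ∷ labels (node y u v)) →
                x ≢ y × Unique (y ∷ labels u) × Unique (x ∷ labels v) × (∀ {z} → z ∈ y ∷ labels u → z ∉ x ∷ labels v)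
  unique-node {x} {y} {u} {v} ((x≢y ∷ x∉) ∷ h) =
    x≢y , proj₁ (unique-++⁻ (y ∷ labels u) h) ,
    (All.++⁻ʳ (labels u) x∉ ∷ proj₂ (unique-++⁻ (y ∷ labels u) h)) , apart
    where
    apart : ∀ {z} → z ∈ y ∷ labels u → z ∉ x ∷ labels v
    apart (here refl) (here refl) = x≢y refl
    apart (there p) (here refl) = All.lookup x∉ (∈-++⁺ˡ p) refl
    apart p (there q) = unique-disjoint h p q

  module Polygon (P Λ : ℕ → ℕ) where

    -- From position n on, `P` and `Λ` are the partners and the contour of the forest. The recursive
    -- form allows proofs by induction along `Edge` and `Corner`.
    data Fits : ℕ → ℕ → Forest → Set where
      nil : ∀ {n x} → Λ n ≡ x → Fits n x nil
      node : ∀ {n x y u v} → Λ n ≡ x → P n ≡ suc (n + sz u) → P (suc (n + sz u)) ≡ n →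
             Fits (suc n) y u → Fits (suc (suc (n + sz u))) x v → Fits n x (node y u v)

    fits⁺ : ∀ n x t → At P n (partners n t) → At Λ n (contour x t) → Fits n x t
    fits⁺ n x nil p (q , _) = nil q
    fits⁺ n x (node y u v) (p , ps) (q , qs) =
      let p₁ , r , p₂ = At-++⁻ (suc n) (partners (suc n) u) (cong (suc n +_) (length-partners (suc n) u)) ps
          q₁ , q₂ = At-++⁻ (suc n) (contour y u)
                      (trans (cong (suc n +_) (length-contour y u)) (ℕP.+-suc (suc n) (sz u))) qs in
      node q p r (fits⁺ (suc n) y u p₁ q₁) (fits⁺ _ x v p₂ q₂)

    fits⁻ : ∀ n x t → Fits n x t → At P n (partners n t) × At Λ n (contour x t)
    fits⁻ n x nil (nil q) = tt , (q , tt)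
    fits⁻ n x (node y u v) (node q p r f g) =
      let p₁ , q₁ = fits⁻ (suc n) y u f
          p₂ , q₂ = fits⁻ _ x v g in
      (p , At-++⁺ (suc n) (partners (suc n) u) (cong (suc n +_) (length-partners (suc n) u)) p₁ (r , p₂)) ,
      (q , At-++⁺ (suc n) (contour y u) (trans (cong (suc n +_) (length-contour y u)) (ℕP.+-suc (suc n) (sz u))) q₁ q₂)

    first : ∀ {n x t} → Fits n x t → Λ n ≡ x
    first (nil q) = q
    first (node q _ _ _ _) = q

    last : ∀ {n x t} → Fits n x t → Λ (n + sz t) ≡ x
    last {n} (nil q) = trans (cong Λ (ℕP.+-identityʳ n)) q
    last {n} (node {u = u} {v} q _ _ _ g) = trans (cong Λ (end-eq n (sz u) (sz v))) (last g)

    partner-edge : ∀ {n x t i} → Fits n x t → Edge n t i → Edge n t (P i)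
    partner-edge (node {n} {u = u} {v} _ p _ _ _) opening = subst (Edge _ _) (sym p) closing
    partner-edge (node _ _ r _ _) closing = subst (Edge _ _) (sym r) opening
    partner-edge (node _ _ _ f _) (left i) = left (partner-edge f i)
    partner-edge (node _ _ _ _ g) (right i) = right (partner-edge g i)

    partner-involutive : ∀ {n x t i} → Fits n x t → Edge n t i → P (P i) ≡ i
    partner-involutive (node _ p r _ _) opening = trans (cong P p) r
    partner-involutive (node _ p r _ _) closing = trans (cong P r) p
    partner-involutive (node _ _ _ f _) (left i) = partner-involutive f i
    partner-involutive (node _ _ _ _ g) (right i) = partner-involutive g i

    partner-≢ : ∀ {n x t i} → Fits n x t → Edge n t i → P i ≢ i
    partner-≢ {n} (node {u = u} _ p _ _ _) opening e = ℕP.m≢1+m+n n (trans (sym e) p)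
    partner-≢ {n} (node {u = u} _ _ r _ _) closing e = ℕP.m≢1+m+n n (trans (sym r) e)
    partner-≢ (node _ _ _ f _) (left i) = partner-≢ f i
    partner-≢ (node _ _ _ _ g) (right i) = partner-≢ g i

    -- Steps between the two passages of an edge belong to the subtree behind it, and so do their
    -- partners. This is how crossings are excluded.
    partner-nested : ∀ {n x t i j} → Fits n x t → Edge n t i → i < j → j < P i → P j < P i
    partner-nested {n} {j = j} (node {u = u} _ p _ f _) opening i<j j<Pi =
      subst (P j <_) (sym p) (proj₂ (edge-bounds (partner-edge f (edge (suc n) u j i<j (subst (j <_) p j<Pi)))))
    partner-nested {n} (node {u = u} _ _ r _ _) closing i<j j<Pi =
      ⊥-elim (ℕP.<-asym (ℕP.<-trans i<j (subst (_ <_) r j<Pi)) (s≤s (ℕP.m≤m+n n (sz u))))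
    partner-nested (node _ _ _ f _) (left i) = partner-nested f i
    partner-nested (node _ _ _ _ g) (right i) = partner-nested g i

    glue-start : ∀ {n x t i} → Fits n x t → Edge n t i → Λ i ≡ Λ (suc (P i))
    glue-start (node q p _ _ g) opening = trans q (sym (trans (cong (Λ ∘ suc) p) (first g)))
    glue-start (node _ _ r f _) closing = trans (last f) (sym (trans (cong (Λ ∘ suc) r) (first f)))
    glue-start (node _ _ _ f _) (left i) = glue-start f i
    glue-start (node _ _ _ _ g) (right i) = glue-start g i

    glue-end : ∀ {n x t i} → Fits n x t → Edge n t i → Λ (suc i) ≡ Λ (P i)
    glue-end (node q p _ f _) opening = trans (first f) (sym (trans (cong Λ p) (last f)))
    glue-end (node q _ r _ g) closing = trans (first g) (sym (trans (cong Λ r) q))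
    glue-end (node _ _ _ f _) (left i) = glue-end f i
    glue-end (node _ _ _ _ g) (right i) = glue-end g i

    corner-label : ∀ {n x t i} → Fits n x t → Corner n t i → Λ i ∈ x ∷ labels t
    corner-label f start = here (first f)
    corner-label (node _ _ _ f _) (left i) = there (∈-++⁺ˡ (corner-label f i))
    corner-label (node {y = y} {u} _ _ _ _ g) (right i) with corner-label g i
    ... | here e = here e
    ... | there p = there (∈-++⁺ʳ (y ∷ labels u) p)

    label-corner : ∀ {n x t z} → Fits n x t → z ∈ x ∷ labels t → ∃ λ i → Corner n t i × Λ i ≡ z
    label-corner {n} f (here refl) = n , start , first f
    label-corner (node {y = y} {u} _ _ _ f g) (there p) with ∈-++⁻ (y ∷ labels u) p
    ... | inj₁ q = let i , c , e = label-corner f q in i , left c , e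
    ... | inj₂ q = let i , c , e = label-corner g (there q) in i , right c , e

    -- Two successive corners of a vertex enclose the walk around one child, and the gluing at its
    -- opening step relates them. Distinct labels rule out coincidences between different vertices.
    corners-related : ∀ {_~_ : ℕ → ℕ → Set} → (∀ {i} → i ~ i) → (∀ {i j} → i ~ j → j ~ i) →
      (∀ {i j k} → i ~ j → j ~ k → i ~ k) → ∀ {n x t} → (∀ i → Edge n t i → i ~ suc (P i)) →
      Fits n x t → Unique (x ∷ labels t) → ∀ {i j} → Corner n t i → Corner n t j → Λ i ≡ Λ j → i ~ j
    corners-related {_~_} r s tr {n} {x} {t} = go
      where
      go : ∀ {n x t} → (∀ i → Edge n t i → i ~ suc (P i)) →
           Fits n x t → Unique (x ∷ labels t) → ∀ {i j} → Corner n t i → Corner n t j → Λ i ≡ Λ j → i ~ j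
      go glue f h start start e = r
      go {n} {t = node y u v} glue (node q p _ f g) h start (left j) e with _ , _ , _ , apart ← unique-node {u = u} {v} h =
        ⊥-elim (apart (corner-label f j) (here (trans (sym e) q)))
      go {n} {t = node y u v} glue (node q p _ f g) h (left i) start e with _ , _ , _ , apart ← unique-node {u = u} {v} h =
        ⊥-elim (apart (corner-label f i) (here (trans e q)))
      go {n} {t = node y u v} glue (node q p _ f g) h start (right j) e with _ , _ , k , _ ← unique-node {u = u} {v} h =
        tr (subst (λ m → n ~ suc m) p (glue n opening)) (go (λ i → glue i ∘ right) g k start j (trans (trans (first g) (sym q)) e))
      go {n} {t = node y u v} glue (node q p _ f g) h (right i) start e with _ , _ , k , _ ← unique-node {u = u} {v} h =
        tr (go (λ i → glue i ∘ right) g k i start (trans e (trans q (sym (first g))))) (s (subst (λ m → n ~ suc m) p (glue n opening)))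
      go {t = node y u v} glue (node q p _ f g) h (left i) (left j) e with _ , k , _ ← unique-node {u = u} {v} h =
        go (λ i → glue i ∘ left) f k i j e
      go {t = node y u v} glue (node q p _ f g) h (left i) (right j) e with _ , _ , _ , apart ← unique-node {u = u} {v} h =
        ⊥-elim (apart (corner-label f i) (subst (_∈ _) (sym e) (corner-label g j)))
      go {t = node y u v} glue (node q p _ f g) h (right i) (left j) e with _ , _ , _ , apart ← unique-node {u = u} {v} h =
        ⊥-elim (apart (corner-label f j) (subst (_∈ _) e (corner-label g i)))
      go {t = node y u v} glue (node q p _ f g) h (right i) (right j) e with _ , _ , k , _ ← unique-node {u = u} {v} h =
        go (λ i → glue i ∘ right) g k i j e

    -- The partner of the first step gives the size of the first subtree, the total size that of the
    -- rest, and `Λ` the labels.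
    fits-unique : ∀ {n x x′ t t′} → sz t ≡ sz t′ → Fits n x t → Fits n x′ t′ → (x , t) ≡ (x′ , t′)
    fits-unique e (nil q) (nil q′) = cong (_, nil) (trans (sym q) q′)
    fits-unique e (nil _) (node _ _ _ _ _) with () ← e
    fits-unique e (node _ _ _ _ _) (nil _) with () ← e
    fits-unique {n} e (node {u = u} {v} q p _ f g) (node {u = u′} {v′} q′ p′ _ f′ g′)
      with su ← ℕP.+-cancelˡ-≡ n _ _ (ℕP.suc-injective (trans (sym p) p′))
      with refl ← fits-unique su f f′
      with refl ← fits-unique (ℕP.suc-injective (ℕP.+-cancelˡ-≡ (sz u) _ _ (ℕP.suc-injective e))) g g′ = refl

    module _ (ε : ℕ → Bool) where

      At-word-node : ∀ {n x y u v} → At ε n (word x (node y u v)) →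
        ε n ≡ (x <ᵇ y) × At ε (suc n) (word y u) × ε (suc (n + sz u)) ≡ not (x <ᵇ y) × At ε (suc (suc (n + sz u))) (word x v)
      At-word-node {n} {x} {y} {u} {v} (p , ps) = p , At-++⁻ (suc n) (word y u) (cong (suc n +_) (length-word y u)) ps

      sign-≢ : ∀ {n x t i} → Fits n x t → At ε n (word x t) → Edge n t i → ε i ≢ ε (P i)
      sign-≢ {n} {x} {node y u v} (node _ p _ _ _) w opening e with a , _ , b , _ ← At-word-node {n} {x} {y} {u} {v} w =
        BP.not-¬ {x <ᵇ y} refl (trans (sym a) (trans e (trans (cong ε p) b)))
      sign-≢ {n} {x} {node y u v} (node _ _ r _ _) w closing e with a , _ , b , _ ← At-word-node {n} {x} {y} {u} {v} w =
        BP.not-¬ {x <ᵇ y} refl (trans (sym a) (trans (cong ε (sym r)) (trans (sym e) b)))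
      sign-≢ {n} {x} {node y u v} (node _ _ _ f _) w (left i) = sign-≢ f (proj₁ (proj₂ (At-word-node {n} {x} {y} {u} {v} w))) i
      sign-≢ {n} {x} {node y u v} (node _ _ _ _ g) w (right i) = sign-≢ g (proj₂ (proj₂ (proj₂ (At-word-node {n} {x} {y} {u} {v} w)))) i

      not-<ᵇ : ∀ {x y} → x ≢ y → not (x <ᵇ y) ≡ (y <ᵇ x)
      not-<ᵇ {x} {y} h with ℕP.<-cmp x y
      ... | tri< a _ _ rewrite <ᵇ-true a | <ᵇ-false (ℕP.<⇒≤ a) = refl
      ... | tri≈ _ e _ = ⊥-elim (h e)
      ... | tri> _ _ a rewrite <ᵇ-true a | <ᵇ-false (ℕP.<⇒≤ a) = refl

      sign : ∀ {n x t i} → Fits n x t → Unique (x ∷ labels t) → At ε n (word x t) → Edge n t i → ε i ≡ (Λ i <ᵇ Λ (suc i))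
      sign {n} {x} {node y u v} (node q _ _ f _) h w opening with a , _ ← At-word-node {n} {x} {y} {u} {v} w =
        trans a (sym (cong₂ _<ᵇ_ q (first f)))
      -- On the way back the word contains a negated comparison, which is the reversed comparison
      -- because the two labels differ.
      sign {n} {x} {node y u v} (node _ _ _ f g) h w closing with _ , _ , b , _ ← At-word-node {n} {x} {y} {u} {v} w =
        trans b (trans (not-<ᵇ (proj₁ (unique-node {u = u} {v} h))) (sym (cong₂ _<ᵇ_ (last f) (first g))))
      sign {n} {x} {node y u v} (node _ _ _ f _) h w (left i) =
        sign f (proj₁ (proj₂ (unique-node {u = u} {v} h))) (proj₁ (proj₂ (At-word-node {n} {x} {y} {u} {v} w))) i
      sign {n} {x} {node y u v} (node _ _ _ _ g) h w (right i) =
        sign g (proj₁ (proj₂ (proj₂ (unique-node {u = u} {v} h)))) (proj₂ (proj₂ (proj₂ (At-word-node {n} {x} {y} {u} {v} w)))) i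

      At-word : ∀ {n x t} → Fits n x t → (∀ i → Edge n t i → ε i ≡ (Λ i <ᵇ Λ (suc i))) →
                (∀ i → Edge n t i → ε i ≢ ε (P i)) → At ε n (word x t)
      At-word (nil _) s o = tt
      At-word {n} {x} {node y u v} (node q p r f g) s o =
        sn , At-++⁺ (suc n) (word y u) (cong (suc n +_) (length-word y u))
          (At-word f (λ i → s i ∘ left) (λ i → o i ∘ left))
          (BP.¬-not (λ e → o n opening (trans sn (trans (sym e) (cong ε (sym p))))) ,
           At-word g (λ i → s i ∘ right) (λ i → o i ∘ right))
        where
        sn : ε n ≡ (x <ᵇ y)
        sn = trans (s n opening) (cong₂ _<ᵇ_ q (first f))

  -- The forest of a non-crossing pairing, each vertex labelled by its first corner.
  data FirstCorners : ℕ → Forest → Set where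
    nil : ∀ {n} → FirstCorners n nil
    node : ∀ {n u v} → FirstCorners (suc n) u → FirstCorners (suc (suc (n + sz u))) v → FirstCorners n (node (suc n) u v)

  firstCorners-bounds : ∀ {n t z} → FirstCorners n t → z ∈ labels t → n < z × z < n + sz t
  firstCorners-bounds {n} (node {u = u} {v} f g) (here refl) = ℕP.≤-refl ,
    subst (suc n <_) (sym (end-eq n (sz u) (sz v))) (s≤s (s≤s (ℕP.≤-trans (ℕP.m≤m+n n (sz u)) (ℕP.m≤m+n _ (sz v)))))
  firstCorners-bounds {n} (node {u = u} {v} f g) (there p) with ∈-++⁻ (labels u) p
  ... | inj₁ q = let h , k = firstCorners-bounds f q in ℕP.<⇒≤ h , ℕP.≤-trans k (left-end n (sz u) (sz v))
  ... | inj₂ q = let h , k = firstCorners-bounds g q in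
    ℕP.≤-trans (s≤s (ℕP.m≤n⇒m≤1+n (ℕP.m≤n⇒m≤1+n (ℕP.m≤m+n n (sz u))))) h ,
    ℕP.≤-trans k (ℕP.≤-reflexive (sym (end-eq n (sz u) (sz v))))

  firstCorners-unique : ∀ {n t} → FirstCorners n t → Unique (labels t)
  firstCorners-unique nil = []
  firstCorners-unique {n} (node {u = u} {v} f g) =
    All.++⁺ (All.tabulate (λ p e → ℕP.<⇒≢ (proj₁ (firstCorners-bounds f p)) e))
            (All.tabulate (λ p e → ℕP.<⇒≢ (ℕP.≤-trans (s≤s (s≤s (ℕP.m≤n⇒m≤1+n (ℕP.m≤m+n n (sz u)))))
                                       (proj₁ (firstCorners-bounds g p))) e)) ∷
    Unique.++⁺ (firstCorners-unique f) (firstCorners-unique g)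
      (λ { (p , q) → ℕP.<⇒≱ (proj₁ (firstCorners-bounds g q))
             (ℕP.m≤n⇒m≤1+n (ℕP.<⇒≤ (proj₂ (firstCorners-bounds f p)))) })

  -- So the first corners represent the vertices, and `Λ` sends each corner to its representative.
  firstCorners-label : ∀ {P Λ n x t z} → Polygon.Fits P Λ n x t → FirstCorners n t → z ∈ labels t → Λ z ≡ z
  firstCorners-label {P} {Λ} (Polygon.node _ _ _ f g) (node a b) (here refl) = Polygon.first P Λ f
  firstCorners-label {P} {Λ} (Polygon.node {u = u} _ _ _ f g) (node a b) (there p) with ∈-++⁻ (labels u) p
  ... | inj₁ q = firstCorners-label f a q
  ... | inj₂ q = firstCorners-label g b q

-- Shapes of non-crossing pairings, and orders as labellings

module Orders where

  open Enumeration using (Forest; nil; node; labels; <ᵇ-true; <ᵇ-true⁻; extract)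
  open LabelledPolygon
  open import Data.Nat using (ℕ; zero; suc; s≤s; z≤n; _+_; _*_; _≤_; _<_; _<ᵇ_)
  import Data.Nat.Properties as ℕP
  open import Data.Nat.Solver using (module +-*-Solver)
  open import Data.Bool using (Bool; true; false)
  open import Data.List using (List; []; _∷_; _++_; length; map; upTo)
  import Data.List.Properties as LP
  open import Data.List.Membership.Propositional using (_∈_)
  open import Data.List.Membership.Propositional.Properties
  open import Data.List.Relation.Unary.Any using (here; there)
  open import Data.List.Relation.Unary.All as All using (All; []; _∷_)
  import Data.List.Relation.Unary.All.Properties as All
  open import Data.List.Relation.Unary.AllPairs using ([]; _∷_)
  open import Data.List.Relation.Unary.Unique.Propositional using (Unique)
  open import Data.List.Relation.Binary.Permutation.Propositional using (_↭_; prep; ↭-refl; ↭-sym; ↭-trans)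
  open import Data.List.Relation.Binary.Permutation.Propositional.Properties using (∈-resp-↭; ↭-length)
  open import Data.Product using (_×_; _,_; proj₁; proj₂; ∃)
  open import Data.Sum using (_⊎_; inj₁; inj₂)
  open import Data.Unit using (tt)
  open import Data.Empty using (⊥-elim)
  open import Function using (_∘_)
  open import Relation.Nullary using (yes; no)
  open import Relation.Binary.Definitions using (tri<; tri≈; tri>)
  open import Relation.Binary.PropositionalEquality

  module Shape (P : ℕ → ℕ) (K : ℕ) (involutive : ∀ i → i < K → P (P i) ≡ i) (fixfree : ∀ i → i < K → P i ≢ i)
               (nested : ∀ i j → j < K → i < j → j < P i → P j < P i) where

    Closed : ℕ → ℕ → Set
    Closed n e = ∀ i → n ≤ i → i < e → n ≤ P i × P i < e

    Shape : ℕ → ℕ → Set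
    Shape n e = ∃ λ t → n + sz t ≡ e × At P n (partners n t) × FirstCorners n t

    -- The partner c of step n cuts the interval: nesting makes `P` preserve the steps strictly
    -- between n and c, hence also those after c. The two parts become the first subtree and the
    -- remaining trees.
    shape : ∀ fuel n e → e ≤ n + fuel → n ≤ e → e ≤ K → Closed n e → Shape n e
    shape fuel n e h n≤e e≤K closed with ℕP.m≤n⇒m<n∨m≡n n≤e
    shape fuel n e h n≤e e≤K closed | inj₂ refl = nil , ℕP.+-identityʳ n , tt , nil
    shape zero n e h n≤e e≤K closed | inj₁ n<e = ⊥-elim (ℕP.<⇒≱ n<e (subst (e ≤_) (ℕP.+-identityʳ n) h))
    shape (suc fuel) n e h n≤e e≤K closed | inj₁ n<e =
      join (shape fuel (suc n) c (ℕP.≤-trans (ℕP.<⇒≤ c<e) h′) n<c (ℕP.≤-trans (ℕP.<⇒≤ c<e) e≤K) inside)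
           (shape fuel (suc c) e (ℕP.≤-trans h′ (ℕP.+-monoˡ-≤ fuel (ℕP.m≤n⇒m≤1+n n<c))) c<e e≤K outside)
      where
      c = P n
      h′ : e ≤ suc n + fuel
      h′ = subst (e ≤_) (ℕP.+-suc n fuel) h
      n<K = ℕP.≤-trans n<e e≤K
      c<e = proj₂ (closed n ℕP.≤-refl n<e)
      n<c : n < c
      n<c = ℕP.≤∧≢⇒< (proj₁ (closed n ℕP.≤-refl n<e)) (fixfree n n<K ∘ sym)
      Pc≡n : P c ≡ n
      Pc≡n = involutive n n<K
      inside : Closed (suc n) c
      inside i n<i i<c = ℕP.≤∧≢⇒< (proj₁ (closed i (ℕP.<⇒≤ n<i) (ℕP.<-trans i<c c<e)))
          (λ n≡Pi → ℕP.<⇒≢ i<c (trans (sym (involutive i i<K)) (cong P (sym n≡Pi)))) ,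
        nested n i i<K n<i i<c
        where i<K = ℕP.≤-trans (ℕP.<-trans i<c c<e) e≤K
      outside : Closed (suc c) e
      outside i c<i i<e with proj₁ (closed i (ℕP.≤-trans n≤e′ (ℕP.<⇒≤ c<i)) i<e) | proj₂ (closed i (ℕP.≤-trans n≤e′ (ℕP.<⇒≤ c<i)) i<e) | ℕP.<-cmp (P i) c
        where n≤e′ = ℕP.<⇒≤ n<c
      ... | _ | Pi<e | tri> _ _ c<Pi = c<Pi , Pi<e
      ... | _ | _ | tri≈ _ Pi≡c _ =
        ⊥-elim (ℕP.<⇒≢ (ℕP.<-trans n<c c<i) (trans (sym Pc≡n) (trans (cong P (sym Pi≡c)) (involutive i (ℕP.≤-trans i<e e≤K)))))
      ... | n≤Pi | Pi<e | tri< Pi<c _ _ with ℕP.m≤n⇒m<n∨m≡n n≤Pi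
      ...   | inj₂ n≡Pi = ⊥-elim (ℕP.<⇒≢ c<i (trans (cong P n≡Pi) (involutive i (ℕP.≤-trans i<e e≤K))))
      -- With `P i` strictly between n and c, nesting would put its partner i before c as well.
      ...   | inj₁ n<Pi = ⊥-elim (ℕP.<-asym c<i
                (subst (_< c) (involutive i (ℕP.≤-trans i<e e≤K)) (nested n (P i) (ℕP.≤-trans Pi<e e≤K) n<Pi Pi<c)))
      join : Shape (suc n) c → Shape (suc c) e → Shape n e
      join (u , uc , pu , fu) (v , ve , pv , fv) = node (suc n) u v ,
        trans (end-eq n (sz u) (sz v)) (trans (cong (λ m → suc m + sz v) uc) ve) ,
        (sym uc , At-++⁺ (suc n) (partners (suc n) u) (trans (cong (suc n +_) (length-partners (suc n) u)) uc) pu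
          (Pc≡n , subst (λ m → At P (suc c) (partners (suc m) v)) (sym uc) pv)) ,
        node fu (subst (λ m → FirstCorners (suc m) v) (sym uc) fv)

  relabel : (ℕ → ℕ) → Forest → Forest
  relabel R nil = nil
  relabel R (node y u v) = node (R y) (relabel R u) (relabel R v)

  sz-relabel : ∀ R t → sz (relabel R t) ≡ sz t
  sz-relabel R nil = refl
  sz-relabel R (node y u v) = cong₂ (λ a b → suc (a + suc b)) (sz-relabel R u) (sz-relabel R v)

  partners-relabel : ∀ R n t → partners n (relabel R t) ≡ partners n t
  partners-relabel R n nil = refl
  partners-relabel R n (node y u v) rewrite sz-relabel R u =
    cong₂ (λ p q → suc (n + sz u) ∷ p ++ n ∷ q) (partners-relabel R (suc n) u) (partners-relabel R _ v)

  contour-relabel : ∀ R x t → contour (R x) (relabel R t) ≡ map R (contour x t)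
  contour-relabel R x nil = refl
  contour-relabel R x (node y u v) = cong (R x ∷_)
    (trans (cong₂ _++_ (contour-relabel R y u) (contour-relabel R x v)) (sym (LP.map-++ R (contour y u) (contour x v))))

  labels-relabel : ∀ R t → labels (relabel R t) ≡ map R (labels t)
  labels-relabel R nil = refl
  labels-relabel R (node y u v) = cong (R y ∷_)
    (trans (cong₂ _++_ (labels-relabel R u) (labels-relabel R v)) (sym (LP.map-++ R (labels u) (labels v))))

  sz-labels : ∀ t → sz t ≡ length (labels t) * 2
  sz-labels nil = refl
  sz-labels (node y u v) = trans
    (cong₂ (λ a b → suc (a + suc b)) (sz-labels u) (sz-labels v))
    (trans (solve 2 (λ a b → con 1 :+ (a :* con 2 :+ (con 1 :+ b :* con 2)) := con 2 :+ (a :+ b) :* con 2) refl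
             (length (labels u)) (length (labels v)))
      (cong (λ k → suc (suc (k * 2))) (sym (LP.length-++ (labels u)))))
    where open +-*-Solver

  count : (ℕ → Bool) → List ℕ → ℕ
  count p [] = 0
  count p (x ∷ xs) with p x
  ... | true = suc (count p xs)
  ... | false = count p xs

  count-mono : ∀ p q xs → (∀ {x} → x ∈ xs → p x ≡ true → q x ≡ true) → count p xs ≤ count q xs
  count-mono p q [] h = z≤n
  count-mono p q (x ∷ xs) h with p x in e | q x in e′
  ... | false | false = count-mono p q xs (h ∘ there)
  ... | false | true = ℕP.m≤n⇒m≤1+n (count-mono p q xs (h ∘ there))
  ... | true | true = s≤s (count-mono p q xs (h ∘ there))
  ... | true | false with () ← trans (sym (h (here refl) e)) e′

  count-strict : ∀ p q xs → (∀ {x} → x ∈ xs → p x ≡ true → q x ≡ true) →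
                 ∀ {z} → z ∈ xs → p z ≡ false → q z ≡ true → count p xs < count q xs
  count-strict p q (x ∷ xs) h (here refl) pz qz rewrite pz | qz = s≤s (count-mono p q xs (h ∘ there))
  count-strict p q (x ∷ xs) h (there z∈) pz qz with p x in e | q x in e′
  ... | false | false = count-strict p q xs (h ∘ there) z∈ pz qz
  ... | false | true = ℕP.m≤n⇒m≤1+n (count-strict p q xs (h ∘ there) z∈ pz qz)
  ... | true | true = s≤s (count-strict p q xs (h ∘ there) z∈ pz qz)
  ... | true | false with () ← trans (sym (h (here refl) e)) e′

  count-true : ∀ xs → count (λ _ → true) xs ≡ length xs
  count-true [] = refl
  count-true (x ∷ xs) = cong suc (count-true xs)

  count-cong : ∀ {p q} xs → (∀ {x} → x ∈ xs → p x ≡ q x) → count p xs ≡ count q xs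
  count-cong {p} {q} xs h = ℕP.≤-antisym (count-mono p q xs (λ i e → trans (sym (h i)) e))
                                         (count-mono q p xs (λ i e → trans (h i) e))

  unique-⊆-↭ : ∀ {xs ys : List ℕ} → Unique xs → (∀ {x} → x ∈ xs → x ∈ ys) → length ys ≤ length xs → xs ↭ ys
  unique-⊆-↭ {[]} {[]} u h k = ↭-refl
  unique-⊆-↭ {x ∷ xs} {ys} (x∉ ∷ u) h k with ys′ , p ← extract (h (here refl)) =
    ↭-trans (prep x (unique-⊆-↭ u rest (ℕP.≤-pred (subst (_≤ suc (length xs)) (↭-length p) k)))) (↭-sym p)
    where
    rest : ∀ {z} → z ∈ xs → z ∈ ys′
    rest i with ∈-resp-↭ p (h (there i))
    ... | here refl = ⊥-elim (All.lookup x∉ i refl)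
    ... | there j = j

  map-unique : ∀ {A B : Set} (f : A → B) {xs} → (∀ {x y} → x ∈ xs → y ∈ xs → f x ≡ f y → x ≡ y) →
               Unique xs → Unique (map f xs)
  map-unique f h [] = []
  map-unique f h (x∉ ∷ u) =
    All.map⁺ (All.tabulate (λ i e → All.lookup x∉ i (h (here refl) (there i) e))) ∷
    map-unique f (λ i j → h (there i) (there j)) u

  -- Ranks turn an order of the vertices into labels 0, 1, 2, .... Totality is required on `C` only,
  -- which holds one corner of each vertex.
  module Rank (_≺_ : ℕ → ℕ → Bool) (C : List ℕ) (unique : Unique C)
              (irreflexive : ∀ i → (i ≺ i) ≡ false)
              (transitive : ∀ {i j k} → (i ≺ j) ≡ true → (j ≺ k) ≡ true → (i ≺ k) ≡ true)
              (total : ∀ {i j} → i ∈ C → j ∈ C → i ≢ j → (i ≺ j) ≡ true ⊎ (j ≺ i) ≡ true) where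

    rank : ℕ → ℕ
    rank i = count (_≺ i) C

    rank-mono : ∀ {i j} → i ∈ C → (i ≺ j) ≡ true → rank i < rank j
    rank-mono {i} {j} i∈ h = count-strict (_≺ i) (_≺ j) C (λ _ k → transitive k h) i∈ (irreflexive i) h

    rank-bound : ∀ {i} → i ∈ C → rank i < length C
    rank-bound {i} i∈ = subst (rank i <_) (count-true C)
      (count-strict (_≺ i) (λ _ → true) C (λ _ _ → refl) i∈ (irreflexive i) refl)

    rank-injective : ∀ {i j} → i ∈ C → j ∈ C → rank i ≡ rank j → i ≡ j
    rank-injective {i} {j} i∈ j∈ e with i ℕP.≟ j
    ... | yes p = p
    ... | no p with total i∈ j∈ p
    ...   | inj₁ h = ⊥-elim (ℕP.<⇒≢ (rank-mono i∈ h) e)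
    ...   | inj₂ h = ⊥-elim (ℕP.<⇒≢ (rank-mono j∈ h) (sym e))

    ranks : map rank C ↭ upTo (length C)
    ranks = unique-⊆-↭ (map-unique rank rank-injective unique) bounded
      (ℕP.≤-reflexive (trans (LP.length-upTo (length C)) (sym (LP.length-map rank C))))
      where
      bounded : ∀ {z} → z ∈ map rank C → z ∈ upTo (length C)
      bounded i with _ , j , refl ← ∈-map⁻ rank i = ∈-upTo⁺ (rank-bound j)

  -- Strong induction on `f i`. If f i < g i, then g takes the value f i at some j, which the common
  -- order puts below i; by induction f j = g j = f i, a contradiction. The other case is alike.
  order-determines : ∀ {K} (f g : ℕ → ℕ) →
    (∀ {i z} → i < K → z < f i → ∃ λ j → j < K × f j ≡ z) →
    (∀ {i z} → i < K → z < g i → ∃ λ j → j < K × g j ≡ z) →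
    (∀ {i j} → i < K → j < K → (f i <ᵇ f j) ≡ (g i <ᵇ g j)) →
    ∀ {i} → i < K → f i ≡ g i
  order-determines {K} f g f-onto g-onto same {i} i<K = go (suc (f i)) i i<K ℕP.≤-refl
    where
    f⇒g : ∀ {i j} → i < K → j < K → f i < f j → g i < g j
    f⇒g p q h = <ᵇ-true⁻ (trans (sym (same p q)) (<ᵇ-true h))
    g⇒f : ∀ {i j} → i < K → j < K → g i < g j → f i < f j
    g⇒f p q h = <ᵇ-true⁻ (trans (same p q) (<ᵇ-true h))
    go : ∀ n i → i < K → f i < n → f i ≡ g i
    go (suc n) i i<K (s≤s h) with ℕP.<-cmp (f i) (g i)
    ... | tri≈ _ e _ = e
    ... | tri< k _ _ with j , j<K , e ← g-onto i<K k =
      ⊥-elim (ℕP.<⇒≢ fj<fi (trans (go n j j<K (ℕP.≤-trans fj<fi h)) e))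
      where fj<fi = g⇒f j<K i<K (subst (_< g i) (sym e) k)
    ... | tri> _ _ k with j , j<K , e ← f-onto i<K k =
      ⊥-elim (ℕP.<⇒≢ (f⇒g j<K i<K fj<fi) (trans (sym (go n j j<K (ℕP.≤-trans fj<fi h))) e))
      where fj<fi = subst (_< f i) (sym e) k

-- Labelled trees against pairings with compatible orders

module Codes where

  open import Defs
  open RootedTrees using (up)
  open Zigzag using (zigzag; module Counting)
  open Enumeration using (Forest; labels; word; <ᵇ-true; <ᵇ-true⁻; <ᵇ-false; Unique-resp-↭; trees; trees-sound; trees-complete; trees-unique; trees-length; F; F-[]; F-∷)
  open LabelledPolygon
  open Orders
  open import Data.Nat using (ℕ; zero; suc; s≤s; z≤n; _+_; _*_; _^_; _≤_; _<_; _<ᵇ_; _<?_)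
  import Data.Nat.Properties as ℕP
  open import Data.Nat.Solver using (module +-*-Solver)
  import Data.Integer.Properties as ℤP
  open import Data.Bool using (Bool; true; false)
  import Data.Bool.Properties as BP
  open import Data.Fin using (Fin; toℕ; fromℕ<)
  import Data.Fin.Properties as FinP
  open import Data.Vec as Vec using (Vec; lookup; tabulate; toList)
  import Data.Vec.Properties as VecP
  open import Data.List using (List; []; _∷_; _++_; length; map; upTo; replicate)
  import Data.List.Properties as LP
  open import Data.List.Membership.Propositional using (_∈_)
  open import Data.List.Membership.Propositional.Properties
  open import Data.List.Relation.Unary.Any using (here; there)
  open import Data.List.Relation.Unary.All as All using (All; []; _∷_)
  open import Data.List.Relation.Unary.AllPairs as AllPairs using ([]; _∷_)
  import Data.List.Relation.Unary.AllPairs.Properties as AllPairs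
  open import Data.List.Relation.Unary.Unique.Propositional using (Unique)
  open import Data.List.Relation.Binary.Permutation.Propositional using (_↭_; ↭-reflexive; ↭-sym; ↭-trans)
  open import Data.List.Relation.Binary.Permutation.Propositional.Properties using (∈-resp-↭)
  open import Data.Product using (_×_; _,_; proj₁; proj₂; ∃)
  open import Data.Sum using (_⊎_; inj₁; inj₂)
  open import Data.Empty using (⊥-elim)
  open import Function using (_∘_; mk⇔; _⇔_)
  open import Relation.Nullary using (¬_; yes; no)
  open import Relation.Binary.Definitions using (tri<; tri≈; tri>)
  open import Relation.Binary.PropositionalEquality

  -- The corner i of a k-gon, where the last corner k is the corner 0 again.
  at : ∀ {k} → 0 < k → ℕ → Fin k
  at {k} 0<k i with i <? k
  ... | yes i<k = fromℕ< i<k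
  ... | no _ = fromℕ< 0<k

  module _ {k : ℕ} (0<k : 0 < k) where

    toℕ-at : ∀ {i} → i < k → toℕ (at 0<k i) ≡ i
    toℕ-at {i} i<k with i <? k
    ... | yes p = FinP.toℕ-fromℕ< p
    ... | no ¬p = ⊥-elim (¬p i<k)

    toℕ-at-end : toℕ (at 0<k k) ≡ 0
    toℕ-at-end with k <? k
    ... | yes p = ⊥-elim (ℕP.<-irrefl refl p)
    ... | no _ = FinP.toℕ-fromℕ< 0<k

    at-toℕ : ∀ i → at 0<k (toℕ i) ≡ i
    at-toℕ i = FinP.toℕ-injective (toℕ-at (FinP.toℕ<n i))

  next-at : ∀ {k} (0<k : 0 < k) i → next i ≡ at 0<k (suc (toℕ i))
  next-at {suc n} 0<k i with n ℕP.≟ toℕ i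
  ... | yes n≡i = FinP.toℕ-injective (sym (trans (cong (λ j → toℕ (at 0<k (suc j))) (sym n≡i)) (toℕ-at-end 0<k)))
  ... | no n≢i = FinP.toℕ-injective (trans (cong suc (FinP.toℕ-lower₁ i n≢i))
          (sym (toℕ-at 0<k (s≤s (ℕP.≤∧≢⇒< (ℕP.≤-pred (FinP.toℕ<n i)) (n≢i ∘ sym))))))

  toList-eps : ∀ m l → toList (eps m l) ≡ zigzag l m
  toList-eps zero l = refl
  toList-eps (suc m) l = trans (VecP.toList-++ (Vec.replicate l true Vec.++ Vec.replicate l false) (eps m l))
    (trans (cong₂ _++_ (trans (VecP.toList-++ (Vec.replicate l true) (Vec.replicate l false))
               (cong₂ _++_ (VecP.toList-replicate l true) (VecP.toList-replicate l false)))
             (toList-eps m l))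
      (LP.++-assoc (replicate l true) (replicate l false) (zigzag l m)))

  At-lookup : ∀ {A : Set} {n} (v : Vec A n) (f : ℕ → A) j → (∀ i → f (j + toℕ i) ≡ lookup v i) → At f j (toList v)
  At-lookup Vec.[] f j h = _
  At-lookup (x Vec.∷ v) f j h = trans (cong f (sym (ℕP.+-identityʳ j))) (h Fin.zero) ,
    At-lookup v f (suc j) (λ i → trans (cong f (sym (ℕP.+-suc j (toℕ i)))) (h (Fin.suc i)))

  module Encoding (m l : ℕ) (0<K : 0 < K m l) where

    k : ℕ
    k = K m l

    at′ : ℕ → Fin k
    at′ = at 0<K

    ε′ : ℕ → Bool
    ε′ i = ε m l (at′ i)

    ε-toℕ : ∀ i → ε m l i ≡ ε′ (toℕ i)
    ε-toℕ i = cong (ε m l) (sym (at-toℕ 0<K i))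

    S : List ℕ
    S = upTo (suc (m * l))

    S-sorted : AllPairs.AllPairs _<_ S
    S-sorted = AllPairs.applyUpTo⁺₁ (λ i → i) (suc (m * l)) (λ i<j _ → i<j)

    At-ε : At ε′ 0 (zigzag l m)
    At-ε = subst (At ε′ 0) (toList-eps m l)
      (At-lookup (eps m l) ε′ 0 (λ i → cong (ε m l) (at-toℕ 0<K i)))

    length-zigzag : length (zigzag l m) ≡ k
    length-zigzag = trans (cong length (sym (toList-eps m l))) (VecP.length-toList (eps m l))

    -- The matrix keeps only the comparisons of labels. For a tree with the right word the default 0
    -- of `nth` is never read.
    encode : ℕ × Forest → Pairing m l × Order m l
    encode (x , t) =
      tabulate (λ i → at′ (nth 0 (partners 0 t) (toℕ i))) ,
      tabulate (λ i → tabulate (λ j → nth 0 (contour x t) (toℕ i) <ᵇ nth 0 (contour x t) (toℕ j)))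

    lookup₂-tabulate : ∀ (f : Fin k → Fin k → Bool) i j → lookup (lookup (tabulate (λ i → tabulate (f i))) i) j ≡ f i j
    lookup₂-tabulate f i j = trans (cong (λ v → lookup v j) (VecP.lookup∘tabulate (λ i → tabulate (f i)) i))
                                   (VecP.lookup∘tabulate (f i) j)

    -- Stated for arbitrary `P` and `Λ`, to serve both a given labelled tree and a given pairing
    -- with vertices named by first corners.
    module Decode (p : Pairing m l) (P Λ : ℕ → ℕ) (Λ-end : Λ k ≡ Λ 0)
                  (P-lookup : ∀ i → toℕ (lookup p i) ≡ P (toℕ i))
                  (x : ℕ) (t : Forest) (size : sz t ≡ k) where

      Λ-at : ∀ {i} → i ≤ k → Λ (toℕ (at′ i)) ≡ Λ i
      Λ-at {i} h with ℕP.m≤n⇒m<n∨m≡n h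
      ... | inj₁ i<k = cong Λ (toℕ-at 0<K i<k)
      ... | inj₂ refl = trans (cong Λ (toℕ-at-end 0<K)) (sym Λ-end)

      Λ-next : ∀ i → Λ (toℕ (next i)) ≡ Λ (suc (toℕ i))
      Λ-next i = trans (cong (Λ ∘ toℕ) (next-at 0<K i)) (Λ-at (FinP.toℕ<n i))

      edgeᶠ : ∀ i → Edge 0 t (toℕ i)
      edgeᶠ i = edge 0 t (toℕ i) z≤n (subst (toℕ i <_) (sym size) (FinP.toℕ<n i))

      cornerⁿ : ∀ {i} → i ≤ k → Corner 0 t i
      cornerⁿ {i} i≤k = corner 0 t i z≤n (subst (i ≤_) (sym size) i≤k)

      open Polygon P Λ

      module _ (fits : Fits 0 x t) where

        same-label : ∀ {i j} → Same m l p i j → Λ (toℕ i) ≡ Λ (toℕ j)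
        same-label s-refl = refl
        same-label (s-step (glue₁ i)) = trans (glue-start fits (edgeᶠ i))
          (sym (trans (Λ-next (lookup p i)) (cong (Λ ∘ suc) (P-lookup i))))
        same-label (s-step (glue₂ i)) = trans (Λ-next i)
          (trans (glue-end fits (edgeᶠ i)) (cong Λ (sym (P-lookup i))))
        same-label (s-sym h) = sym (same-label h)
        same-label (s-trans h h′) = trans (same-label h) (same-label h′)

        -- Together with `same-label`: if the labels are distinct, the classes of `Same` are the
        -- vertices of the tree.
        label-same : Unique (x ∷ labels t) → ∀ {i j} → i ≤ k → j ≤ k → Λ i ≡ Λ j → Same m l p (at′ i) (at′ j)
        label-same u {i} {j} hi hj e = corners-related {λ i j → Same m l p (at′ i) (at′ j)} s-refl s-sym s-trans
          step fits u (cornerⁿ hi) (cornerⁿ hj) e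
          where
          step : ∀ i → Edge 0 t i → Same m l p (at′ i) (at′ (suc (P i)))
          step i h = subst (Same m l p (at′ i)) (trans (next-at 0<K (lookup p (at′ i)))
            (cong (at′ ∘ suc) (trans (P-lookup (at′ i)) (cong P (toℕ-at 0<K (subst (i <_) size (proj₂ (edge-bounds h))))))))
            (s-step (glue₁ (at′ i)))

    module _ {x t} (word≡ : word x t ≡ zigzag l m) where

      private
        P Λ : ℕ → ℕ
        P = nth 0 (partners 0 t)
        Λ = nth 0 (contour x t)
        p = proj₁ (encode (x , t))
        o = proj₂ (encode (x , t))

      open Polygon P Λ

      size-encode : sz t ≡ k
      size-encode = trans (sym (length-word x t)) (trans (cong length word≡) length-zigzag)

      fits-encode : Fits 0 x t
      fits-encode = fits⁺ 0 x t (At-nth 0 (partners 0 t)) (At-nth 0 (contour x t))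

      P-bound : ∀ {i} → i < k → P i < k
      P-bound {i} i<k = subst (P i <_) size-encode
        (proj₂ (edge-bounds (partner-edge fits-encode (edge 0 t i z≤n (subst (i <_) (sym size-encode) i<k)))))

      lookup-p : ∀ i → toℕ (lookup p i) ≡ P (toℕ i)
      lookup-p i = trans (cong toℕ (VecP.lookup∘tabulate (λ i → at′ (P (toℕ i))) i)) (toℕ-at 0<K (P-bound (FinP.toℕ<n i)))

      lookup-o : ∀ i j → lookup (lookup o i) j ≡ (Λ (toℕ i) <ᵇ Λ (toℕ j))
      lookup-o = lookup₂-tabulate (λ i j → Λ (toℕ i) <ᵇ Λ (toℕ j))

      Λ-end : Λ k ≡ Λ 0
      Λ-end = trans (cong Λ (sym size-encode)) (trans (last fits-encode) (sym (first fits-encode)))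

      open Decode p P Λ Λ-end lookup-p x t size-encode

      LT⇒< : ∀ i j → LT m l o i j → Λ (toℕ i) < Λ (toℕ j)
      LT⇒< i j h = <ᵇ-true⁻ (trans (sym (lookup-o i j)) h)

      <⇒LT : ∀ i j → Λ (toℕ i) < Λ (toℕ j) → LT m l o i j
      <⇒LT i j h = trans (lookup-o i j) (<ᵇ-true h)

      encode-valid : Unique (x ∷ labels t) → Valid m l (encode (x , t))
      encode-valid unique = (involutive , fixfree) , compatible , noncrossing , order , oriented
        where
        involutive : ∀ i → lookup p (lookup p i) ≡ i
        involutive i = FinP.toℕ-injective (trans (lookup-p (lookup p i))
          (trans (cong P (lookup-p i)) (partner-involutive fits-encode (edgeᶠ i))))
        fixfree : ∀ i → lookup p i ≢ i
        fixfree i e = partner-≢ fits-encode (edgeᶠ i) (trans (sym (lookup-p i)) (cong toℕ e))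
        At-word-ε : At ε′ 0 (word x t)
        At-word-ε = subst (At ε′ 0) (sym word≡) At-ε
        compatible : CompatibleEps m l p
        compatible i e = sign-≢ ε′ fits-encode At-word-ε (edgeᶠ i)
          (trans (sym (ε-toℕ i)) (trans e (trans (ε-toℕ (lookup p i)) (cong ε′ (lookup-p i)))))
        noncrossing : NonCrossing m l p
        noncrossing a b c d a<b b<c c<d refl refl = ℕP.<-asym c<d
          (subst₂ _<_ (sym (lookup-p b)) (sym (lookup-p a))
            (partner-nested fits-encode (edgeᶠ a) a<b (subst (toℕ b <_) (lookup-p a) b<c)))
        invariant : ∀ i i′ j j′ → Same m l p i i′ → Same m l p j j′ → LT m l o i j → LT m l o i′ j′
        invariant i i′ j j′ h h′ lt =
          <⇒LT i′ j′ (subst₂ _<_ (same-label fits-encode h) (same-label fits-encode h′) (LT⇒< i j lt))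
        total : ∀ i j → ¬ Same m l p i j → LT m l o i j ⊎ LT m l o j i
        total i j h with ℕP.<-cmp (Λ (toℕ i)) (Λ (toℕ j))
        ... | tri< q _ _ = inj₁ (<⇒LT i j q)
        ... | tri> _ _ q = inj₂ (<⇒LT j i q)
        ... | tri≈ _ e _ = ⊥-elim (h (subst₂ (Same m l p) (at-toℕ 0<K i) (at-toℕ 0<K j)
                (label-same fits-encode unique (ℕP.<⇒≤ (FinP.toℕ<n i)) (ℕP.<⇒≤ (FinP.toℕ<n j)) e)))
        order : IsTotalOrderOnClasses m l p o
        order = invariant , (λ i h → ℕP.<-irrefl refl (LT⇒< i i h)) ,
          (λ i j k h h′ → <⇒LT i k (ℕP.<-trans (LT⇒< i j h) (LT⇒< j k h′))) , total
        sign-at : ∀ i → ε m l i ≡ (Λ (toℕ i) <ᵇ Λ (suc (toℕ i)))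
        sign-at i = trans (ε-toℕ i) (sign ε′ fits-encode unique At-word-ε (edgeᶠ i))
        arrow : ∀ i → Λ (toℕ (head m l i)) < Λ (toℕ (tail m l i))
        arrow i with ε m l i in e
        ... | true = subst (Λ (toℕ i) <_) (sym (Λ-next i)) (<ᵇ-true⁻ (trans (sym (sign-at i)) e))
        -- The sign `false` only denies the opposite strict inequality. The partner of i passes the
        -- same edge with sign `true`, which yields the strict one.
        ... | false = subst₂ _<_
                (sym (trans (Λ-next i) (trans (glue-end fits-encode (edgeᶠ i)) (cong Λ (sym (lookup-p i))))))
                (sym (trans (glue-start fits-encode (edgeᶠ i)) (cong (Λ ∘ suc) (sym (lookup-p i)))))
                (<ᵇ-true⁻ (trans (sym (sign-at (lookup p i))) (BP.¬-not (λ e′ → compatible i (trans e (sym e′))))))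
        path-label : ∀ {i j} → Path m l p j i → Λ (toℕ i) < Λ (toℕ j)
        path-label (one e h h′) = subst₂ _<_ (same-label fits-encode h′) (sym (same-label fits-encode h)) (arrow e)
        path-label (more e h q) = ℕP.<-trans (path-label q) (subst (Λ (toℕ (head m l e)) <_) (sym (same-label fits-encode h)) (arrow e))
        oriented : CompatibleOrientation m l p o
        oriented i j h = <⇒LT i j (path-label h)

      -- The labels form an initial segment of the natural numbers, as `order-determines` demands.
      onto : ∀ {n} → x ∷ labels t ↭ upTo n → ∀ {i z} → i < k → z < Λ i → ∃ λ j → j < k × Λ j ≡ z
      onto {n} perm {i} {z} i<k z<Λi with label-corner fits-encode (∈-resp-↭ (↭-sym perm) (∈-upTo⁺ {n} z<n))
        where
        z<n : z < n
        z<n = ℕP.<-trans z<Λi (∈-upTo⁻ (∈-resp-↭ perm (corner-label fits-encode (cornerⁿ (ℕP.<⇒≤ i<k)))))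
      ... | j , c , e with ℕP.m≤n⇒m<n∨m≡n (subst (j ≤_) size-encode (proj₂ (corner-bounds c)))
      ...   | inj₁ j<k = j , j<k , e
      -- The closing corner k is the corner 0 again.
      ...   | inj₂ refl = 0 , 0<K , trans (sym Λ-end) e

    -- The pairing gives `P`, the comparisons give `Λ` by `order-determines`, and these two fix the
    -- tree.
    encode-injective : ∀ {n x t x′ t′} → word x t ≡ zigzag l m → word x′ t′ ≡ zigzag l m →
                       x ∷ labels t ↭ upTo n → x′ ∷ labels t′ ↭ upTo n →
                       encode (x , t) ≡ encode (x′ , t′) → (x , t) ≡ (x′ , t′)
    encode-injective {n} {x} {t} {x′} {t′} w w′ perm perm′ e =
      Polygon.fits-unique P Λ (trans size (sym size′)) (fits-encode w) fits′
      where
      P = nth 0 (partners 0 t)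
      Λ = nth 0 (contour x t)
      P′ = nth 0 (partners 0 t′)
      Λ′ = nth 0 (contour x′ t′)
      size = size-encode w
      size′ = size-encode w′
      P-same : ∀ i → i < k → P′ i ≡ P i
      P-same i i<k = trans (cong P′ (sym (toℕ-at 0<K i<k))) (trans (sym (lookup-p w′ (at′ i)))
        (trans (cong (λ c → toℕ (lookup (proj₁ c) (at′ i))) (sym e)) (trans (lookup-p w (at′ i)) (cong P (toℕ-at 0<K i<k)))))
      same : ∀ {i j} → i < k → j < k → (Λ i <ᵇ Λ j) ≡ (Λ′ i <ᵇ Λ′ j)
      same {i} {j} i<k j<k = subst₂ (λ a b → (Λ a <ᵇ Λ b) ≡ (Λ′ a <ᵇ Λ′ b)) (toℕ-at 0<K i<k) (toℕ-at 0<K j<k)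
        (trans (sym (lookup-o w (at′ i) (at′ j)))
          (trans (cong (λ c → lookup (lookup (proj₂ c) (at′ i)) (at′ j)) e) (lookup-o w′ (at′ i) (at′ j))))
      Λ-same : ∀ i → i ≤ k → Λ′ i ≡ Λ i
      Λ-same i h with ℕP.m≤n⇒m<n∨m≡n h
      ... | inj₁ i<k = sym (order-determines Λ Λ′ (onto w perm) (onto w′ perm′) same i<k)
      ... | inj₂ refl = trans (Λ-end w′) (trans (sym (order-determines Λ Λ′ (onto w perm) (onto w′ perm′) same 0<K)) (sym (Λ-end w)))
      fits′ : Polygon.Fits P Λ 0 x′ t′
      fits′ = Polygon.fits⁺ P Λ 0 x′ t′
        (At-cong 0 (partners 0 t′) (λ i _ h → P-same i (subst (i <_) (trans (length-partners 0 t′) size′) h)) (At-nth 0 (partners 0 t′)))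
        (At-cong 0 (contour x′ t′) (λ i _ h → Λ-same i (ℕP.≤-pred (subst (i <_) (trans (length-contour x′ t′) (cong suc size′)) h)))
          (At-nth 0 (contour x′ t′)))

    -- The tree is built from the pairing alone, with first corners as labels; their ranks in the
    -- order then replace them.
    module _ (p : Pairing m l) (o : Order m l) (valid : Valid m l (p , o)) where

      private
        involutive = proj₁ (proj₁ valid)
        fixfree = proj₂ (proj₁ valid)
        compatible = proj₁ (proj₂ valid)
        noncrossing = proj₁ (proj₂ (proj₂ valid))
        order = proj₁ (proj₂ (proj₂ (proj₂ valid)))
        oriented = proj₂ (proj₂ (proj₂ (proj₂ valid)))
        invariant = proj₁ order
        irreflexive = proj₁ (proj₂ order)
        transitive = proj₁ (proj₂ (proj₂ order))
        total = proj₂ (proj₂ (proj₂ order))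

        P : ℕ → ℕ
        P i = toℕ (lookup p (at′ i))

        P-toℕ : ∀ i → toℕ (lookup p i) ≡ P (toℕ i)
        P-toℕ i = cong (toℕ ∘ lookup p) (sym (at-toℕ 0<K i))

        at-P : ∀ i → at′ (P i) ≡ lookup p (at′ i)
        at-P i = at-toℕ 0<K (lookup p (at′ i))

        P-involutive : ∀ i → i < k → P (P i) ≡ i
        P-involutive i i<k = trans (cong (toℕ ∘ lookup p) (at-P i))
          (trans (cong toℕ (involutive (at′ i))) (toℕ-at 0<K i<k))

        P-fixfree : ∀ i → i < k → P i ≢ i
        P-fixfree i i<k e = fixfree (at′ i) (FinP.toℕ-injective (trans e (sym (toℕ-at 0<K i<k))))

        P-nested : ∀ i j → j < k → i < j → j < P i → P j < P i
        P-nested i j j<k i<j j<Pi with ℕP.<-cmp (P j) (P i)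
        ... | tri< h _ _ = h
        ... | tri≈ _ e _ = ⊥-elim (ℕP.<⇒≢ i<j (trans (sym (P-involutive i (ℕP.<-trans i<j j<k)))
                (trans (cong P (sym e)) (P-involutive j j<k))))
        ... | tri> _ _ h = ⊥-elim (noncrossing (at′ i) (at′ j) (lookup p (at′ i)) (lookup p (at′ j))
                (subst₂ _<_ (sym (toℕ-at 0<K (ℕP.<-trans i<j j<k))) (sym (toℕ-at 0<K j<k)) i<j)
                (subst (_< P i) (sym (toℕ-at 0<K j<k)) j<Pi) h refl refl)

        shape₀ = Shape.shape P k P-involutive P-fixfree P-nested k 0 k ℕP.≤-refl z≤n ℕP.≤-refl
          (λ i _ _ → z≤n , FinP.toℕ<n (lookup p (at′ i)))

        t₀ : Forest
        t₀ = proj₁ shape₀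
        size₀ : sz t₀ ≡ k
        size₀ = proj₁ (proj₂ shape₀)
        partners₀ = proj₁ (proj₂ (proj₂ shape₀))
        corners₀ = proj₂ (proj₂ (proj₂ shape₀))

        -- The first corner of the vertex at the corner i.
        Λ₀ : ℕ → ℕ
        Λ₀ = nth 0 (contour 0 t₀)

        fits₀ : Polygon.Fits P Λ₀ 0 0 t₀
        fits₀ = Polygon.fits⁺ P Λ₀ 0 0 t₀ partners₀ (At-nth 0 (contour 0 t₀))

        Λ₀-end : Λ₀ k ≡ Λ₀ 0
        Λ₀-end = trans (cong Λ₀ (sym size₀)) (trans (Polygon.last P Λ₀ fits₀) (sym (Polygon.first P Λ₀ fits₀)))

        C : List ℕ
        C = 0 ∷ labels t₀

        C-unique : Unique C
        C-unique = All.tabulate (λ i e → ℕP.<⇒≢ (proj₁ (firstCorners-bounds corners₀ i)) e) ∷ firstCorners-unique corners₀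

        C-bound : ∀ {c} → c ∈ C → c < k
        C-bound (here refl) = 0<K
        C-bound {c} (there i) = subst (c <_) size₀ (proj₂ (firstCorners-bounds corners₀ i))

        C-fixed : ∀ {c} → c ∈ C → Λ₀ c ≡ c
        C-fixed (here refl) = Polygon.first P Λ₀ fits₀
        C-fixed (there i) = firstCorners-label fits₀ corners₀ i

        open Decode p P Λ₀ Λ₀-end P-toℕ 0 t₀ size₀

        Λ₀-C : ∀ {i} → i ≤ k → Λ₀ i ∈ C
        Λ₀-C i≤k = Polygon.corner-label P Λ₀ fits₀ (cornerⁿ i≤k)

        same-first : ∀ {i} → i ≤ k → Same m l p (at′ i) (at′ (Λ₀ i))
        same-first i≤k = label-same fits₀ C-unique i≤k (ℕP.<⇒≤ (C-bound (Λ₀-C i≤k))) (sym (C-fixed (Λ₀-C i≤k)))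

        _≺_ : ℕ → ℕ → Bool
        i ≺ j = lookup (lookup o (at′ i)) (at′ j)

        ≺-cong : ∀ {i i′ j j′} → Same m l p (at′ i) (at′ i′) → Same m l p (at′ j) (at′ j′) → (i ≺ j) ≡ (i′ ≺ j′)
        ≺-cong {i} {i′} {j} {j′} h h′ with i ≺ j in e | i′ ≺ j′ in e′
        ... | true | true = refl
        ... | false | false = refl
        ... | true | false = trans (sym (invariant _ _ _ _ h h′ e)) e′
        ... | false | true = trans (sym e) (invariant _ _ _ _ (s-sym h) (s-sym h′) e′)

        ≺-total : ∀ {i j} → i ≤ k → j ≤ k → Λ₀ i ≢ Λ₀ j → (i ≺ j) ≡ true ⊎ (j ≺ i) ≡ true
        ≺-total i≤k j≤k h = total _ _ (λ s → h (trans (sym (Λ-at i≤k)) (trans (same-label fits₀ s) (Λ-at j≤k))))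

        open Rank _≺_ C C-unique (λ i → BP.¬-not (irreflexive (at′ i))) (transitive _ _ _)
          (λ i j i≢j → ≺-total (ℕP.<⇒≤ (C-bound i)) (ℕP.<⇒≤ (C-bound j))
            (λ e → i≢j (trans (sym (C-fixed i)) (trans e (C-fixed j)))))

        rank-first : ∀ {i} → i ≤ k → rank i ≡ rank (Λ₀ i)
        rank-first {i} i≤k = count-cong C (λ {c} _ → ≺-cong {c} {c} {i} {Λ₀ i} s-refl (same-first i≤k))

        ≺⇒< : ∀ {i j} → i ≤ k → (i ≺ j) ≡ true → rank i < rank j
        ≺⇒< {i} {j} i≤k h = subst (_< rank j) (sym (rank-first i≤k))
          (rank-mono (Λ₀-C i≤k) (trans (sym (≺-cong {i} {Λ₀ i} {j} {j} (same-first i≤k) s-refl)) h))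

        ≺-rank : ∀ {i j} → i ≤ k → j ≤ k → (rank i <ᵇ rank j) ≡ (i ≺ j)
        ≺-rank {i} {j} i≤k j≤k with i ≺ j in e
        ... | true = <ᵇ-true (≺⇒< i≤k e)
        ... | false with Λ₀ i ℕP.≟ Λ₀ j
        ...   | yes q = <ᵇ-false (ℕP.≤-reflexive (trans (rank-first j≤k) (trans (cong rank (sym q)) (sym (rank-first i≤k)))))
        ...   | no q with ≺-total i≤k j≤k q
        ...     | inj₁ h with () ← trans (sym h) e
        ...     | inj₂ h = <ᵇ-false (ℕP.<⇒≤ (≺⇒< j≤k h))

        t : Forest
        t = relabel rank t₀

        x : ℕ
        x = rank 0

        Λ : ℕ → ℕ
        Λ = nth 0 (contour x t)

        Λ-rank : ∀ {i} → i ≤ k → Λ i ≡ rank i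
        Λ-rank {i} i≤k = trans
          (At-≡ {f = Λ} {rank ∘ Λ₀} 0 (contour x t) (At-nth 0 (contour x t))
            (subst (At (rank ∘ Λ₀) 0) (sym (contour-relabel rank 0 t₀)) (At-map rank 0 (contour 0 t₀) (At-nth 0 (contour 0 t₀))))
            i z≤n (subst (i <_) (sym (trans (length-contour x t) (cong suc (trans (sz-relabel rank t₀) size₀)))) (s≤s i≤k)))
          (sym (rank-first i≤k))

        partners-t : At P 0 (partners 0 t)
        partners-t = subst (At P 0) (sym (partners-relabel rank 0 t₀)) partners₀

        size : sz t ≡ k
        size = trans (sz-relabel rank t₀) size₀

        fits : Polygon.Fits P Λ 0 x t
        fits = Polygon.fits⁺ P Λ 0 x t partners-t (At-nth 0 (contour x t))

        edge-< : ∀ {i} → Edge 0 t i → i < k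
        edge-< {i} h = subst (i <_) size (proj₂ (edge-bounds h))

        -- A single edge is a directed path, so the compatible order compares its two ends.
        sign-rank : ∀ i → i < k → ε′ i ≡ (rank i <ᵇ rank (suc i))
        sign-rank i i<k with ε m l (at′ i) in e | oriented (head m l (at′ i)) (tail m l (at′ i)) (one (at′ i) s-refl s-refl)
        ... | true | h = sym (<ᵇ-true (≺⇒< (ℕP.<⇒≤ i<k) (subst (LT m l o (at′ i)) next≡ h)))
          where
          next≡ : next (at′ i) ≡ at′ (suc i)
          next≡ = trans (next-at 0<K (at′ i)) (cong (at′ ∘ suc) (toℕ-at 0<K i<k))
        ... | false | h = sym (<ᵇ-false (ℕP.<⇒≤ (≺⇒< i<k (subst (λ c → LT m l o c (at′ i)) next≡ h))))
          where
          next≡ : next (at′ i) ≡ at′ (suc i)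
          next≡ = trans (next-at 0<K (at′ i)) (cong (at′ ∘ suc) (toℕ-at 0<K i<k))

        word-t : word x t ≡ zigzag l m
        word-t = At-unique {f = ε′} 0 (word x t) (zigzag l m) (trans (length-word x t) (trans size (sym length-zigzag)))
          (Polygon.At-word P Λ ε′ fits
            (λ i h → trans (sign-rank i (edge-< h)) (sym (cong₂ _<ᵇ_ (Λ-rank (ℕP.<⇒≤ (edge-< h))) (Λ-rank (edge-< h)))))
            (λ i h e → compatible (at′ i) (trans e (cong (ε m l) (at-P i)))))
          At-ε

        -- The walk passes each edge twice, and a tree has one vertex more than edges.
        vertices : length C ≡ suc (m * l)
        vertices = cong suc (ℕP.*-cancelʳ-≡ (length (labels t₀)) (m * l) 2 (trans (sym (sz-labels t₀)) (trans size₀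
          (solve 2 (λ m l → m :* (l :+ l) := m :* l :* con 2) refl m l))))
          where open +-*-Solver

        labels-t : x ∷ labels t ↭ upTo (suc (m * l))
        labels-t = ↭-trans (↭-reflexive (cong (x ∷_) (labels-relabel rank t₀)))
          (↭-trans ranks (↭-reflexive (cong upTo vertices)))

        encode-t : encode (x , t) ≡ (p , o)
        encode-t = cong₂ _,_
          (trans (VecP.tabulate-cong pairing) (VecP.tabulate∘lookup p))
          (trans (VecP.tabulate-cong (λ i → trans (VecP.tabulate-cong (ordering i)) (VecP.tabulate∘lookup (lookup o i))))
                 (VecP.tabulate∘lookup o))
          where
          pairing : ∀ i → at′ (nth 0 (partners 0 t) (toℕ i)) ≡ lookup p i
          pairing i = trans (cong at′ (trans
            (At-≡ {f = nth 0 (partners 0 t)} {P} 0 (partners 0 t) (At-nth 0 (partners 0 t)) partners-t (toℕ i) z≤n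
              (subst (toℕ i <_) (sym (trans (length-partners 0 t) size)) (FinP.toℕ<n i)))
            (sym (P-toℕ i)))) (at-toℕ 0<K (lookup p i))
          ordering : ∀ i j → (Λ (toℕ i) <ᵇ Λ (toℕ j)) ≡ lookup (lookup o i) j
          ordering i j = trans (cong₂ _<ᵇ_ (Λ-rank (ℕP.<⇒≤ (FinP.toℕ<n i))) (Λ-rank (ℕP.<⇒≤ (FinP.toℕ<n j))))
            (trans (≺-rank (ℕP.<⇒≤ (FinP.toℕ<n i)) (ℕP.<⇒≤ (FinP.toℕ<n j)))
              (cong₂ (λ a b → lookup (lookup o a) b) (at-toℕ 0<K i) (at-toℕ 0<K j)))

      encode-surjective : ∃ λ c → c ∈ trees (zigzag l m) S × encode c ≡ (p , o)
      encode-surjective = (x , t) , trees-complete (zigzag l m) S-sorted word-t labels-t , encode-t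

    codes : List (Pairing m l × Order m l)
    codes = map encode (trees (zigzag l m) S)

    codes-unique : Unique codes
    codes-unique = map-unique encode injective (trees-unique (zigzag l m) S-sorted)
      where
      injective : ∀ {c c′} → c ∈ trees (zigzag l m) S → c′ ∈ trees (zigzag l m) S → encode c ≡ encode c′ → c ≡ c′
      injective i j = let w , p = trees-sound (zigzag l m) S-sorted i
                          w′ , p′ = trees-sound (zigzag l m) S-sorted j in encode-injective w w′ p p′

    codes-valid : ∀ c → (c ∈ codes) ⇔ Valid m l c
    codes-valid c = mk⇔ valid member
      where
      valid : c ∈ codes → Valid m l c
      valid i = let _ , j , e = ∈-map⁻ encode i
                    w , perm = trees-sound (zigzag l m) S-sorted j in
        subst (Valid m l) (sym e) (encode-valid w (Unique-resp-↭ (↭-sym perm) (AllPairs.map ℕP.<⇒≢ S-sorted)))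
      member : Valid m l c → c ∈ codes
      member v = let _ , i , e = encode-surjective (proj₁ c) (proj₂ c) v in subst (_∈ codes) e (∈-map⁺ encode i)

  codes-length : ∀ m l 0<K → length (Encoding.codes (suc m) l 0<K) ≡ suc m ^ (suc m * l)
  codes-length m l 0<K = trans (LP.length-map (Encoding.encode (suc m) l 0<K) (trees w S′))
    (ℤP.+-injective (trans (trees-length w S′)
      (trans (cong (up (F w) 0) (LP.length-upTo (suc (suc m * l)))) (Counting.up-zigzag F F-[] F-∷ l m))))
    where
    w = zigzag l (suc m)
    S′ = upTo (suc (suc m * l))

open import Defs
open import Data.Nat using (ℕ; suc; _*_; _^_; _≤_; s≤s; z≤n)
open import Data.List using (List; length)
open import Data.List.Relation.Unary.Unique.Propositional using (Unique)
open import Data.List.Membership.Propositional using (_∈_)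
open import Data.Product using (Σ; _×_; _,_)
open import Function.Bundles using (_⇔_)
open import Relation.Binary.PropositionalEquality using (_≡_)

theorem1p2 : (m l : ℕ) → 1 ≤ m → 1 ≤ l →
    Σ (List (Pairing m l × Order m l)) λ L →
    Unique L × (∀ x → (x ∈ L) ⇔ Valid m l x) × (length L ≡ m ^ (m * l))
-- For positive m and l the number of sides computes to a successor, so `s≤s z≤n` shows that the
-- polygon has a corner 0.
theorem1p2 (suc m) (suc l) _ _ = codes , codes-unique , codes-valid , codes-length m (suc l) (s≤s z≤n)
  where
  open Codes using (codes-length)
  open Codes.Encoding (suc m) (suc l) (s≤s z≤n)
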